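{- For each integer $n\ge 2$, let $\sigma$ and $\pi$ be two independent uniformly random permutations of $[n]=\{1,\dots,n\}$. Then, as $n\to\infty$, \[ \mathbb{E}\left[U(\sigma,\pi)\right] = O\left( n^{1/3}\log^{11/6}(n)\right), \] i.e. there is an absolute constant $C>0$ such that $\mathbb{E}[U(\sigma,\pi)] \le C\, n^{1/3}\log^{11/6}(n)$ for all sufficiently large $n$.
   Context: A permutation $\sigma\in S_n$ is written as the sequence $\sigma(1),\sigma(2),\dots,\sigma(n)$. The pattern of a sequence $a_1,\dots,a_m$ of distinct real numbers is the permutation in $S_m$ obtained by replacing the $i$th smallest element of the sequence by $i$, for each $i$. Two sequences of distinct real numbers of the same length are order-isomorphic, written $\mathbf{a}\sim\mathbf{b}$, if they have the same pattern. Two permutations $\sigma,\pi\in S_n$ are $\ell$-similar if the sequences $\sigma(1),\dots,\sigma(n)$ and $\pi(1),\dots,\pi(n)$ can be partitioned into (not necessarily contiguous) subsequences $\sigma^{(1)},\dots,\sigma^{(\ell)}$ and $\pi^{(1)},\dots,\pi^{(\ell)}$ respectively such that $\sigma^{(i)}\sim\pi^{(i)}$ for each $i\in[\ell]$. $U(\sigma,\pi)$ denotes the smallest $\ell$ for which $\sigma$ and $\pi$ are $\ell$-similar. Here $\log^{a}(n)$ denotes $(\log n)^a$. -}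

module Defs where

open import Data.Fin.Base using (Fin; zero; suc; toℕ; punchIn)
open import Data.Fin.Permutation using (Permutation′; _⟨$⟩ʳ_; id; insert; insert-remove; remove; insert-punchIn)
  renaming (_≈_ to _≈ₚ_)
open import Data.Fin.Properties using (any?; all?; suc-injective) renaming (_≟_ to _≟ꟳ_)
open import Data.Integer.Base using (+_)
open import Data.List.Base using (List; []; _∷_; [_]; map; filter; length; allFin; tabulate; cartesianProductWith)
open import Data.Nat.ListAction using (sum)
import Data.List.Properties as Listₚ
open import Data.List.Relation.Unary.All.Properties using (tabulate⁺)
open import Data.List.Relation.Unary.Any using (Any; here)
open import Data.List.Relation.Unary.Any.Properties using (cartesianProductWith⁺)
open import Data.List.Membership.Propositional.Properties using (∈-allFin)
open import Data.Nat.Base as ℕ using (ℕ; zero; suc; z≤n; s≤s; _!)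
import Data.Nat.Properties as ℕₚ
open import Data.Nat.Properties using (_≟_; _≤?_; _!≢0; m*n≢0)
open import Data.Product.Base using (∃; _×_; _,_; proj₁)
open import Data.Rational.Unnormalised.Base
  using (ℚᵘ; 0ℚᵘ; 1ℚᵘ; _≤_; _+_; _*_; _/_; +-*-rawSemiring; nonNegative)
import Data.Rational.Unnormalised.Properties as ℚₚ
open import Data.Vec.Base as Vec using (Vec; []; _∷_; lookup)
open import Data.Vec.Properties using (lookup-allFin)
open import Algebra.Definitions.RawSemiring +-*-rawSemiring using (_^_) public
open import Function.Base using (_∘_)
open import Relation.Binary.PropositionalEquality
  using (_≡_; refl; sym; trans; cong; cong₂; module ≡-Reasoning)
open import Relation.Nullary using (Dec; yes; no; contradiction)
open import Relation.Nullary.Decidable using (map′)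
open import Relation.Unary using (Pred; Decidable)
open import Level using (0ℓ)

private
  variable
    n ℓ : ℕ

-- For distinct entries, the i-th smallest entry x is the one with exactly i
-- entries y ≤ x.
patternOf : List ℕ → List ℕ
patternOf xs = map (λ x → length (filter (_≤? x) xs)) xs

infix 4 _∼_

_∼_ : List ℕ → List ℕ → Set
xs ∼ ys = patternOf xs ≡ patternOf ys

-- Permutations act on {0,…,n-1}; patterns are unaffected by the shift from
-- {1,…,n}.  A partition of σ(0),…,σ(n-1) into ℓ subsequences is a colouring
-- of the positions with ℓ colours (a colour may be unused), and the i-th
-- subsequence consists of the entries at the positions of colour i, in order.
subsequence : Permutation′ n → Vec (Fin ℓ) n → Fin ℓ → List ℕ
subsequence {n} σ c i =
  map (λ j → toℕ (σ ⟨$⟩ʳ j)) (filter (λ j → lookup c j ≟ꟳ i) (allFin n))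

Similar : ℕ → Permutation′ n → Permutation′ n → Set
Similar {n} ℓ σ π = ∃ λ (c : Vec (Fin ℓ) n) → ∃ λ (d : Vec (Fin ℓ) n) →
  ∀ i → subsequence σ c i ∼ subsequence π d i

∃Vec? : ∀ {m} {P : Pred (Vec (Fin ℓ) m) 0ℓ} → Decidable P → Dec (∃ P)
∃Vec? {m = zero}  P? = map′ ([] ,_) (λ { ([] , p) → p }) (P? [])
∃Vec? {m = suc m} P? =
  map′ (λ { (x , xs , p) → x ∷ xs , p }) (λ { (x ∷ xs , p) → x , xs , p })
       (any? λ x → ∃Vec? λ xs → P? (x ∷ xs))

Similar? : ∀ ℓ (σ π : Permutation′ n) → Dec (Similar ℓ σ π)
Similar? ℓ σ π = ∃Vec? λ c → ∃Vec? λ d → all? λ i →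
  Listₚ.≡-dec _≟_ (patternOf (subsequence σ c i)) (patternOf (subsequence π d i))

filter-≟-tabulate : ∀ {m} (f : Fin m → Fin n) → (∀ {i j} → f i ≡ f j → i ≡ j) →
                    ∀ k → filter (_≟ꟳ f k) (tabulate f) ≡ [ f k ]
filter-≟-tabulate f inj zero = trans
  (Listₚ.filter-accept (_≟ꟳ f zero) refl)
  (cong (f zero ∷_) (Listₚ.filter-none (_≟ꟳ f zero)
    (tabulate⁺ λ i eq → contradiction (inj {suc i} {zero} eq) λ ())))
filter-≟-tabulate f inj (suc k) = trans
  (Listₚ.filter-reject (_≟ꟳ f (suc k)) λ eq → contradiction (inj {zero} {suc k} eq) λ ())
  (filter-≟-tabulate (f ∘ suc) (suc-injective ∘ inj) k)

subsequence-singletons : ∀ (σ : Permutation′ n) i →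
  subsequence σ (Vec.allFin n) i ≡ [ toℕ (σ ⟨$⟩ʳ i) ]
subsequence-singletons σ i = cong (map _) (trans
  (Listₚ.filter-≐ _ (_≟ꟳ i)
    ((λ {j} → trans (sym (lookup-allFin j))) , (λ {j} → trans (lookup-allFin j)))
    (allFin _))
  (filter-≟-tabulate (λ j → j) (λ eq → eq) i))

patternOf-singleton : ∀ x → patternOf [ x ] ≡ [ 1 ]
patternOf-singleton x =
  cong (λ ys → [ length ys ]) (Listₚ.filter-accept (_≤? x) ℕₚ.≤-refl)

similar-n : ∀ (σ π : Permutation′ n) → Similar n σ π
similar-n {n} σ π = Vec.allFin n , Vec.allFin n , λ i → trans (pat σ i) (sym (pat π i))
  where
  pat : ∀ ρ i → patternOf (subsequence ρ (Vec.allFin n) i) ≡ [ 1 ]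
  pat ρ i = trans (cong patternOf (subsequence-singletons ρ i)) (patternOf-singleton (toℕ (ρ ⟨$⟩ʳ i)))

least : ∀ {P : Pred ℕ 0ℓ} → Decidable P → ∀ m → P m →
        ∃ λ k → P k × (∀ j → P j → k ℕ.≤ j)
least P? m pm with P? 0
least P? m       pm | yes p0 = 0 , p0 , λ _ _ → z≤n
least P? zero    pm | no ¬p0 = contradiction pm ¬p0
least P? (suc m) pm | no ¬p0 with least (P? ∘ suc) m pm
... | k , pk , min = suc k , pk , λ where
  zero    p0 → contradiction p0 ¬p0
  (suc j) pj → s≤s (min j pj)

U : Permutation′ n → Permutation′ n → ℕ
U {n} σ π = proj₁ (least (λ ℓ → Similar? ℓ σ π) n (similar-n σ π))

permutations : ∀ n → List (Permutation′ n)
permutations zero    = [ id ]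
permutations (suc n) = cartesianProductWith (insert zero) (allFin (suc n)) (permutations n)

-- By these two facts every permutation is listed exactly once, up to pointwise
-- equality.
permutations-complete : ∀ (π : Permutation′ n) → Any (π ≈ₚ_) (permutations n)
permutations-complete {zero}  π = here λ ()
permutations-complete {suc n} π =
  cartesianProductWith⁺ (insert zero) step (∈-allFin (π ⟨$⟩ʳ zero))
    (permutations-complete (remove zero π))
  where
  open ≡-Reasoning
  step : ∀ {j ρ} → π ⟨$⟩ʳ zero ≡ j → remove zero π ≈ₚ ρ → π ≈ₚ insert zero j ρ
  step         refl eq zero    = refl
  step {_} {ρ} refl eq (suc k) = begin
    π ⟨$⟩ʳ suc k                                         ≡⟨ insert-remove zero π (suc k) ⟨
    insert zero (π ⟨$⟩ʳ zero) (remove zero π) ⟨$⟩ʳ suc k ≡⟨ insert-punchIn zero _ (remove zero π) k ⟩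
    _                                                    ≡⟨ cong (punchIn _) (eq k) ⟩
    _                                                    ≡⟨ insert-punchIn zero _ ρ k ⟨
    insert zero (π ⟨$⟩ʳ zero) ρ ⟨$⟩ʳ suc k               ∎

length-cartesianProductWith : ∀ {A B C : Set} (f : A → B → C) xs ys →
  length (cartesianProductWith f xs ys) ≡ length xs ℕ.* length ys
length-cartesianProductWith f []       ys = refl
length-cartesianProductWith f (x ∷ xs) ys = trans
  (Listₚ.length-++ (map (f x) ys))
  (cong₂ ℕ._+_ (Listₚ.length-map (f x) ys) (length-cartesianProductWith f xs ys))

length-permutations : ∀ n → length (permutations n) ≡ n !
length-permutations zero    = refl
length-permutations (suc n) = trans
  (length-cartesianProductWith (insert zero) (allFin (suc n)) (permutations n))
  (cong₂ ℕ._*_ (Listₚ.length-tabulate {n = suc n} (λ i → i)) (length-permutations n))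

𝔼 : ∀ n → (Permutation′ n → Permutation′ n → ℕ) → ℚᵘ
𝔼 n X = (+ sum (cartesianProductWith X (permutations n) (permutations n)) / (n ! ℕ.* n !))
          {{m*n≢0 (n !) (n !) {{n !≢0}} {{n !≢0}}}}

-- A non-negative real is presented as the infimum of an inhabited set of
-- non-negative rationals.
record ℝ⁺ : Set₁ where
  field
    Bound     : Pred ℚᵘ 0ℓ
    nonneg    : ∀ {q} → Bound q → 0ℚᵘ ≤ q
    inhabited : ∃ Bound

open ℝ⁺ public

-- A rational is at most inf S iff it is a lower bound of S.
infix 4 _≤ᴿ_

_≤ᴿ_ : ℚᵘ → ℝ⁺ → Set
p ≤ᴿ x = ∀ q → Bound x q → p ≤ q

fromℚ : ∀ p → 0ℚᵘ ≤ p → ℝ⁺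
fromℚ p 0≤p = record
  { Bound     = p ≤_
  ; nonneg    = ℚₚ.≤-trans 0≤p
  ; inhabited = p , ℚₚ.≤-refl
  }

0≤n/1 : ∀ n → 0ℚᵘ ≤ + n / 1
0≤n/1 n = ℚₚ.nonNegative⁻¹ (+ n / 1)

fromℕ : ℕ → ℝ⁺
fromℕ n = fromℚ (+ n / 1) (0≤n/1 n)

0≤1 : 0ℚᵘ ≤ 1ℚᵘ
0≤1 = 0≤n/1 1

0≤* : ∀ {p q} → 0ℚᵘ ≤ p → 0ℚᵘ ≤ q → 0ℚᵘ ≤ p * q
0≤* {p} {q} 0≤p 0≤q = ℚₚ.nonNegative⁻¹ (p * q)
  {{ℚₚ.nonNeg*nonNeg⇒nonNeg p {{nonNegative 0≤p}} q {{nonNegative 0≤q}}}}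

0≤^ : ∀ {p} k → 0ℚᵘ ≤ p → 0ℚᵘ ≤ p ^ k
0≤^ zero    0≤p = 0≤1
0≤^ (suc k) 0≤p = 0≤* 0≤p (0≤^ k 0≤p)

1≤^ : ∀ {p} k → 1ℚᵘ ≤ p → 1ℚᵘ ≤ p ^ k
p≤p^suc : ∀ {p} k → 1ℚᵘ ≤ p → p ≤ p ^ suc k
1≤^ zero    1≤p = ℚₚ.≤-refl
1≤^ (suc k) 1≤p = ℚₚ.≤-trans 1≤p (p≤p^suc k 1≤p)
p≤p^suc {p} k 1≤p = ℚₚ.≤-trans
  (ℚₚ.≤-reflexive (ℚₚ.≃-sym (ℚₚ.*-identityʳ p)))
  (ℚₚ.*-monoʳ-≤-nonNeg p {{nonNegative (ℚₚ.≤-trans 0≤1 1≤p)}} (1≤^ k 1≤p))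

infixl 7 _·_

_·_ : ℝ⁺ → ℝ⁺ → ℝ⁺
x · y = record
  { Bound     = λ q → ∃ λ u → ∃ λ v → Bound x u × Bound y v × u * v ≤ q
  ; nonneg    = λ { (u , v , bu , bv , uv≤q) → ℚₚ.≤-trans (0≤* (nonneg x bu) (nonneg y bv)) uv≤q }
  ; inhabited = let (u , bu) = inhabited x ; (v , bv) = inhabited y
                in u * v , u , v , bu , bv , ℚₚ.≤-refl
  }

infixr 8 _^[_/_]

-- q ≥ x^(a/b) iff q^b ≥ x^a.
_^[_/_] : ℝ⁺ → (a b : ℕ) .{{_ : ℕ.NonZero b}} → ℝ⁺
x ^[ a / b@(suc b-1) ] = record
  { Bound     = λ q → 0ℚᵘ ≤ q × ∃ λ u → Bound x u × u ^ a ≤ q ^ b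
  ; nonneg    = proj₁
  ; inhabited =
      let (u , bu) = inhabited x
          q   = 1ℚᵘ + u ^ a
          0≤w = 0≤^ a (nonneg x bu)
          1≤q = ℚₚ.p≤p+q 1ℚᵘ (u ^ a) {{nonNegative 0≤w}}
          w≤q = ℚₚ.p≤q+p (u ^ a) 1ℚᵘ
      in q , ℚₚ.≤-trans 0≤1 1≤q , u , bu , ℚₚ.≤-trans w≤q (p≤p^suc b-1 1≤q)
  }

-- (1 + q/k)^k increases to e^q as k → ∞, so the rationals q > log n are exactly
-- those with n ≤ (1 + q/k)^k for some k ≥ 1, when n ≥ 2.  (For n ≤ 1 the
-- infimum is 0.)
log : ℕ → ℝ⁺
log n = record
  { Bound     = λ q → 0ℚᵘ ≤ q × ∃ λ k-1 → + n / 1 ≤ (1ℚᵘ + q * (+ 1 / suc k-1)) ^ suc k-1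
  ; nonneg    = proj₁
  ; inhabited = + n / 1 , 0≤n/1 n , 0 , n≤
  }
  where
  open ℚₚ.≤-Reasoning
  n≤ : + n / 1 ≤ (1ℚᵘ + (+ n / 1) * (+ 1 / 1)) ^ 1
  n≤ = begin
    + n / 1                           ≃⟨ ℚₚ.*-identityʳ (+ n / 1) ⟨
    (+ n / 1) * 1ℚᵘ                   ≤⟨ ℚₚ.p≤q+p _ 1ℚᵘ ⟩
    1ℚᵘ + (+ n / 1) * 1ℚᵘ             ≃⟨ ℚₚ.*-identityʳ _ ⟨
    (1ℚᵘ + (+ n / 1) * 1ℚᵘ) * 1ℚᵘ     ∎

{-# OPTIONS --safe #-}

-- Cut the positions of σ and π into m windows of w consecutive positions and their values into m
-- blocks of b consecutive values.  Among all pairs of a point x of σ and a point y of π, some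
-- displacement between the cells of x and y occurs at least (2m)⁻² of the time, and pairs with the
-- same displacement in distinct rows and columns form a common pattern.  Put q² ~ log n.  For random
-- σ and π a cell has at most q points, and at every displacement at most O(q²) pairs share a row or
-- a column, simultaneously for all windows and blocks; this follows from the factorial moments of
-- the number of points of a random permutation in a rectangle.  So if ys has y₀ more points than xs,
-- a greedy choice of common patterns exhausts xs after O(q⁵ m² / y₀) steps.
--
-- This is applied at the scales u = q 8ⁱ with m = 4ⁱ: the points of one permutation left over from
-- the previous scale are matched into a fresh slice of the other one which has 7 u more points, and
-- these 7 u leftover points are carried to the next scale, with the roles of σ and π exchanged.  The
-- leftover points are arbitrary, but they lie in a slice of size O(u), which is all that the degree
-- bounds need.  The costs form a geometric series dominated by q⁴ 2ᴶ, where q 8ᴶ ~ n, that is by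
-- n^(1/3) log^(11/6) n.
module Submission where

-- The factors of `q⁵` have separate origins: `q` for keeping one point of `π` per cell, `q²` for
-- discarding conflicting pairs, and `q²` for the rounds of halving that exhaust at most
-- `n ≤ 2^(q²)` points. The first factor is `q` and not `q²` because cells are kept very sparse: a
-- cell has mean at most `2^(-16q)`, so `q` points in one cell have probability at most
-- `2^(-16q²) ≤ n^(-16)`, which survives the union bound. This sparsity is lost at small scales. The
-- descent therefore stops at a level `a` with `2^a` well beyond `2^(16q)`, and the remaining
-- `O(q 8^a)` points are matched one by one. With top level `J = 3a` this remainder is `O(q 2^J)`,
-- below the other costs.
--
-- The sets actually matched depend on both permutations, so no probability is ever computed for
-- them. All events concern arbitrary windows, blocks and displacements, and each is estimated over
-- one permutation with the other one fixed.
--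
-- The final exponent comes from `(q⁴ 2^J)³ = q¹¹ (q 8^J) ≤ q¹¹ n` together with `q² ~ log n`.

-- Inequalities for powers and factorials, with 4 in the place of e.

module Arithmetic where
  open import Data.Nat.Base
  open import Data.Nat.Properties
  open import Data.Nat.Tactic.RingSolver using (solve-∀)
  open import Relation.Binary.PropositionalEquality
    using (_≡_; refl; sym; trans; cong; cong₂; subst)
  open import Relation.Nullary using (yes; no)

  [m*n]^k≡m^k*n^k : ∀ m n k → (m * n) ^ k ≡ m ^ k * n ^ k
  [m*n]^k≡m^k*n^k m n zero    = refl
  [m*n]^k≡m^k*n^k m n (suc k) = trans (cong (m * n *_) ([m*n]^k≡m^k*n^k m n k))
    (interchange m n (m ^ k) (n ^ k))
    where
    interchange : ∀ a b c d → a * b * (c * d) ≡ a * c * (b * d)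
    interchange = solve-∀

  m<2^m : ∀ m → m < 2 ^ m
  m<2^m zero    = s≤s z≤n
  m<2^m (suc m) = begin-strict
    suc m             <⟨ s≤s (m<2^m m) ⟩
    suc (2 ^ m)       ≤⟨ +-monoˡ-≤ (2 ^ m) (m^n>0 2 m) ⟩
    2 ^ m + 2 ^ m     ≡⟨ cong (2 ^ m +_) (sym (+-identityʳ (2 ^ m))) ⟩
    2 ^ suc m         ∎
    where open ≤-Reasoning

  -- Bernoulli's inequality `(1 - 1/(k+1))^i ≥ 1 - i/(k+1)` with denominators cleared; for exponents
  -- above `k` the truncated difference vanishes.
  bernoulli : ∀ k i → suc k ^ i * (suc k ∸ i) ≤ k ^ i * suc k
  bernoulli k zero    = ≤-refl
  bernoulli k (suc i) with i ≤? k
  ... | no  i≰k rewrite m≤n⇒m∸n≡0 (≰⇒≥ i≰k) | *-zeroʳ (suc k ^ suc i) = z≤n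
  ... | yes i≤k = begin
    suc k * suc k ^ i * (k ∸ i)     ≡⟨ move (suc k) (suc k ^ i) (k ∸ i) ⟩
    suc k ^ i * (suc k * (k ∸ i))   ≤⟨ *-monoʳ-≤ (suc k ^ i) (step (k ∸ i) (m∸n+n≡m i≤k)) ⟩
    suc k ^ i * (k * (suc k ∸ i))   ≡⟨ move′ (suc k ^ i) k (suc k ∸ i) ⟩
    k * (suc k ^ i * (suc k ∸ i))   ≤⟨ *-monoʳ-≤ k (bernoulli k i) ⟩
    k * (k ^ i * suc k)             ≡⟨ sym (*-assoc k (k ^ i) (suc k)) ⟩
    k * k ^ i * suc k               ∎
    where
    open ≤-Reasoning
    move : ∀ a b c → a * b * c ≡ b * (a * c)
    move = solve-∀
    move′ : ∀ a b c → a * (b * c) ≡ b * (a * c)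
    move′ = solve-∀
    step : ∀ d → d + i ≡ k → suc k * d ≤ k * (suc k ∸ i)
    step d refl = subst (suc (d + i) * d ≤_) (cong ((d + i) *_) (sym (m+n∸n≡m (suc d) i)))
      (≤-trans (m≤m+n _ i) (≤-reflexive (expand d i)))
      where
      expand : ∀ d i → suc (d + i) * d + i ≡ (d + i) * suc d
      expand = solve-∀

  private
    half : ∀ k → ⌈ k /2⌉ + ⌈ k /2⌉ ≤ suc k
    half zero          = z≤n
    half (suc zero)    = ≤-refl
    half (suc (suc k)) = s≤s (≤-trans (≤-reflexive (+-suc ⌈ k /2⌉ ⌈ k /2⌉)) (s≤s (half k)))

  -- For `i ≤ (k+1)/2` the factor `1 - i/(k+1)` in Bernoulli's inequality is at least 1/2.
  1+k^i≤2*k^i : ∀ k i → i + i ≤ suc k → suc k ^ i ≤ 2 * k ^ i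
  1+k^i≤2*k^i k i 2i≤1+k = *-cancelʳ-≤ _ _ (suc k) (begin
    suc k ^ i * suc k                          ≤⟨ *-monoʳ-≤ (suc k ^ i) {x = suc k} 1+k≤ ⟩
    suc k ^ i * (2 * (suc k ∸ i))              ≡⟨ move (suc k ^ i) (suc k ∸ i) ⟩
    2 * (suc k ^ i * (suc k ∸ i))              ≤⟨ *-monoʳ-≤ 2 (bernoulli k i) ⟩
    2 * (k ^ i * suc k)                        ≡⟨ *-assoc 2 (k ^ i) (suc k) ⟨
    2 * k ^ i * suc k                          ∎)
    where
    open ≤-Reasoning
    move : ∀ a b → a * (2 * b) ≡ 2 * (a * b)
    move = solve-∀
    1+k≤ : suc k ≤ 2 * (suc k ∸ i)
    1+k≤ = begin
      suc k                       ≡⟨ m+n∸n≡m (suc k) (suc k) ⟨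
      suc k + suc k ∸ suc k       ≤⟨ ∸-monoʳ-≤ (suc k + suc k) 2i≤1+k ⟩
      suc k + suc k ∸ (i + i)     ≡⟨ cong₂ _∸_ (double (suc k)) (double i) ⟩
      2 * suc k ∸ 2 * i           ≡⟨ *-distribˡ-∸ 2 (suc k) i ⟨
      2 * (suc k ∸ i)             ∎
      where
      double : ∀ x → x + x ≡ 2 * x
      double = solve-∀

  -- In essence `(1 + 1/n)^n ≤ 4`: the exponent is split into two halves, each short enough to cost
  -- only a factor 2.
  1+n^k≤4*n^k : ∀ n k → k ≤ n → suc n ^ k ≤ 4 * n ^ k
  1+n^k≤4*n^k n k k≤n = begin
    suc n ^ k                         ≡⟨ split (suc n) ⟩
    suc n ^ i * suc n ^ j             ≤⟨ *-mono-≤ (1+k^i≤2*k^i n i 2i≤1+n) (1+k^i≤2*k^i n j 2j≤1+n) ⟩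
    2 * n ^ i * (2 * n ^ j)           ≡⟨ square (n ^ i) (n ^ j) ⟩
    4 * (n ^ i * n ^ j)               ≡⟨ cong (4 *_) (split n) ⟨
    4 * n ^ k                         ∎
    where
    open ≤-Reasoning
    i = ⌊ k /2⌋
    j = ⌈ k /2⌉
    split : ∀ x → x ^ k ≡ x ^ i * x ^ j
    split x = trans (cong (x ^_) (sym (⌊n/2⌋+⌈n/2⌉≡n k))) (^-distribˡ-+-* x i j)
    2j≤1+n : j + j ≤ suc n
    2j≤1+n = ≤-trans (half k) (s≤s k≤n)
    2i≤1+n : i + i ≤ suc n
    2i≤1+n = ≤-trans (+-mono-≤ (⌊n/2⌋≤⌈n/2⌉ k) (⌊n/2⌋≤⌈n/2⌉ k)) 2j≤1+n
    square : ∀ x y → 2 * x * (2 * y) ≡ 4 * (x * y)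
    square = solve-∀

  -- Stirling's lower bound `h! ≥ (h/e)^h`, weakened from e to 4.
  h^h≤4^h*h! : ∀ h → h ^ h ≤ 4 ^ h * h !
  h^h≤4^h*h! zero    = ≤-refl
  h^h≤4^h*h! (suc h) = begin
    suc h * suc h ^ h                 ≤⟨ *-monoʳ-≤ (suc h) (1+n^k≤4*n^k h h ≤-refl) ⟩
    suc h * (4 * h ^ h)               ≤⟨ *-monoʳ-≤ (suc h) (*-monoʳ-≤ 4 (h^h≤4^h*h! h)) ⟩
    suc h * (4 * (4 ^ h * h !))       ≡⟨ move (suc h) (4 ^ h) (h !) ⟩
    4 * 4 ^ h * (suc h * h !)         ∎
    where
    open ≤-Reasoning
    move : ∀ a b c → a * (4 * (b * c)) ≡ 4 * b * (a * c)
    move = solve-∀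

  -- A form of `(1 + y/k)^k ≤ e^y` that is uniform in `k`; it converts the bounds defining `log`
  -- into comparisons with powers of 4.
  [k+y]^k≤4^y*k^k : ∀ k y → (k + y) ^ k ≤ 4 ^ y * k ^ k
  [k+y]^k≤4^y*k^k k zero    rewrite +-identityʳ k | +-identityʳ (k ^ k) = ≤-refl
  [k+y]^k≤4^y*k^k k (suc y) = begin
    (k + suc y) ^ k                   ≡⟨ cong (_^ k) (+-suc k y) ⟩
    suc (k + y) ^ k                   ≤⟨ 1+n^k≤4*n^k (k + y) k (m≤m+n k y) ⟩
    4 * (k + y) ^ k                   ≤⟨ *-monoʳ-≤ 4 ([k+y]^k≤4^y*k^k k y) ⟩
    4 * (4 ^ y * k ^ k)               ≡⟨ *-assoc 4 (4 ^ y) (k ^ k) ⟨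
    4 * 4 ^ y * k ^ k                 ∎
    where open ≤-Reasoning

-- Factorial moments and tails for the number of points of a random permutation in a rectangle.

module Moments where
  open import Data.Bool.Base using (Bool; true; false; _∧_; if_then_else_)
  open import Data.Fin.Base using (Fin; zero; suc; punchIn)
  open import Data.Fin.Permutation using (Permutation′; _⟨$⟩ʳ_; insert; insert-punchIn)
  open import Data.List.Base using (List; []; _∷_; map; length; allFin; tabulate; cartesianProductWith; _++_)
  open import Data.List.Properties using (map-cong; map-tabulate; map-++; map-∘; length-tabulate)
  open import Data.Nat.Base
  open import Data.Nat.ListAction using (sum)
  open import Data.Nat.ListAction.Properties using (sum-++)
  open import Data.Nat.Properties
  open import Data.Nat.Tactic.RingSolver using (solve-∀)
  open import Data.Sum.Base using (inj₁; inj₂)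
  open import Function.Base using (_∘_)
  open import Relation.Binary.PropositionalEquality
    using (_≡_; refl; sym; trans; cong; cong₂; module ≡-Reasoning)
  open import Defs using (permutations)
  open Arithmetic

  ∑ : ∀ {A : Set} → List A → (A → ℕ) → ℕ
  ∑ xs f = sum (map f xs)

  ∑-cong : ∀ {A : Set} {f g : A → ℕ} → (∀ x → f x ≡ g x) → ∀ xs → ∑ xs f ≡ ∑ xs g
  ∑-cong eq xs = cong sum (map-cong eq xs)

  ∑-mono : ∀ {A : Set} {f g : A → ℕ} → (∀ x → f x ≤ g x) → ∀ xs → ∑ xs f ≤ ∑ xs g
  ∑-mono le []       = z≤n
  ∑-mono le (x ∷ xs) = +-mono-≤ (le x) (∑-mono le xs)

  ∑-+ : ∀ {A : Set} (f g : A → ℕ) xs → ∑ xs (λ x → f x + g x) ≡ ∑ xs f + ∑ xs g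
  ∑-+ f g []       = refl
  ∑-+ f g (x ∷ xs) = trans (cong (f x + g x +_) (∑-+ f g xs))
    (interchange (f x) (g x) (∑ xs f) (∑ xs g))
    where
    interchange : ∀ a b c d → a + b + (c + d) ≡ a + c + (b + d)
    interchange = solve-∀

  ∑-*ʳ : ∀ {A : Set} (f : A → ℕ) c xs → ∑ xs (λ x → f x * c) ≡ ∑ xs f * c
  ∑-*ʳ f c []       = refl
  ∑-*ʳ f c (x ∷ xs) = trans (cong (f x * c +_) (∑-*ʳ f c xs)) (sym (*-distribʳ-+ c (f x) (∑ xs f)))

  ∑-*ˡ : ∀ {A : Set} (f : A → ℕ) c xs → ∑ xs (λ x → c * f x) ≡ c * ∑ xs f
  ∑-*ˡ f c xs = trans (∑-cong (λ x → *-comm c (f x)) xs) (trans (∑-*ʳ f c xs) (*-comm _ c))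

  ∑-const : ∀ {A : Set} c (xs : List A) → ∑ xs (λ _ → c) ≡ length xs * c
  ∑-const c []       = refl
  ∑-const c (x ∷ xs) = cong (c +_) (∑-const c xs)

  ∑-swap : ∀ {A B : Set} (f : A → B → ℕ) xs ys →
           ∑ xs (λ x → ∑ ys (f x)) ≡ ∑ ys (λ y → ∑ xs (λ x → f x y))
  ∑-swap f []       ys = sym (trans (∑-const 0 ys) (*-zeroʳ (length ys)))
  ∑-swap f (x ∷ xs) ys = trans (cong (∑ ys (f x) +_) (∑-swap f xs ys))
    (sym (∑-+ (f x) (λ y → ∑ xs (λ x → f x y)) ys))

  ∑-product : ∀ {A B C : Set} (g : C → ℕ) (f : A → B → C) xs ys →
              ∑ (cartesianProductWith f xs ys) g ≡ ∑ xs (λ x → ∑ ys (λ y → g (f x y)))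
  ∑-product g f []       ys = refl
  ∑-product g f (x ∷ xs) ys = begin
    sum (map g (map (f x) ys ++ cartesianProductWith f xs ys))       ≡⟨ cong sum (map-++ g (map (f x) ys) _) ⟩
    sum (map g (map (f x) ys) ++ map g (cartesianProductWith f xs ys)) ≡⟨ sum-++ (map g (map (f x) ys)) _ ⟩
    sum (map g (map (f x) ys)) + ∑ (cartesianProductWith f xs ys) g  ≡⟨ cong₂ _+_ (cong sum (sym (map-∘ ys))) (∑-product g f xs ys) ⟩
    ∑ ys (λ y → g (f x y)) + ∑ xs (λ x → ∑ ys (λ y → g (f x y)))     ∎
    where open ≡-Reasoning

  ⟦_⟧ : Bool → ℕ
  ⟦ b ⟧ = if b then 1 else 0

  count : ∀ {n} → (Fin n → Bool) → ℕ
  count {zero}  P = 0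
  count {suc n} P = ⟦ P zero ⟧ + count (P ∘ suc)

  count-cong : ∀ {n} {P Q : Fin n → Bool} → (∀ i → P i ≡ Q i) → count P ≡ count Q
  count-cong {zero}  eq = refl
  count-cong {suc n} eq = cong₂ _+_ (cong ⟦_⟧ (eq zero)) (count-cong (eq ∘ suc))

  ⟦⟧≤1 : ∀ b → ⟦ b ⟧ ≤ 1
  ⟦⟧≤1 false = z≤n
  ⟦⟧≤1 true  = ≤-refl

  count≤n : ∀ {n} (P : Fin n → Bool) → count P ≤ n
  count≤n {zero}  P = z≤n
  count≤n {suc n} P = +-mono-≤ (⟦⟧≤1 (P zero)) (count≤n (P ∘ suc))

  count-∑ : ∀ {n} (P : Fin n → Bool) → ∑ (allFin n) (⟦_⟧ ∘ P) ≡ count P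
  count-∑ P = trans (cong sum (map-tabulate (λ i → i) (⟦_⟧ ∘ P))) (go P)
    where
    go : ∀ {n} (P : Fin n → Bool) → sum (tabulate (⟦_⟧ ∘ P)) ≡ count P
    go {zero}  P = refl
    go {suc n} P = cong (⟦ P zero ⟧ +_) (go (P ∘ suc))

  count-punchIn : ∀ {n} (P : Fin (suc n) → Bool) j → ⟦ P j ⟧ + count (P ∘ punchIn j) ≡ count P
  count-punchIn         P zero    = refl
  count-punchIn {suc n} P (suc j) = begin
    ⟦ P (suc j) ⟧ + (⟦ P zero ⟧ + count (P ∘ suc ∘ punchIn j))   ≡⟨ +-left-comm ⟦ P (suc j) ⟧ ⟦ P zero ⟧ _ ⟩
    ⟦ P zero ⟧ + (⟦ P (suc j) ⟧ + count (P ∘ suc ∘ punchIn j))   ≡⟨ cong (⟦ P zero ⟧ +_) (count-punchIn (P ∘ suc) j) ⟩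
    ⟦ P zero ⟧ + count (P ∘ suc)                                ∎
    where
    open ≡-Reasoning
    +-left-comm : ∀ a b c → a + (b + c) ≡ b + (a + c)
    +-left-comm = solve-∀

  falling : ℕ → ℕ → ℕ
  falling zero    n       = 1
  falling (suc h) zero    = 0
  falling (suc h) (suc n) = suc n * falling h n

  falling-pred : ∀ h n → falling (suc h) n ≡ n * falling h (pred n)
  falling-pred h zero    = refl
  falling-pred h (suc n) = refl

  -- Splits off the last factor `n - h` rather than the first; the additive form stays true for
  -- `h > n`.
  falling-top : ∀ h n → falling (suc h) n + h * falling h n ≡ n * falling h n
  falling-top zero    zero    = refl
  falling-top zero    (suc n) = +-identityʳ _
  falling-top (suc h) zero    = *-zeroʳ h
  falling-top (suc h) (suc n) = begin
    suc n * falling (suc h) n + suc h * (suc n * falling h n)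
      ≡⟨ regroup (suc n) (falling (suc h) n) h (falling h n) ⟩
    suc n * (falling (suc h) n + h * falling h n + falling h n)
      ≡⟨ cong (λ x → suc n * (x + falling h n)) (falling-top h n) ⟩
    suc n * (n * falling h n + falling h n)
      ≡⟨ cong (suc n *_) (+-comm (n * falling h n) (falling h n)) ⟩
    suc n * (suc n * falling h n) ∎
    where
    open ≡-Reasoning
    regroup : ∀ a b c d → a * b + (1 + c) * (a * d) ≡ a * (b + c * d + d)
    regroup = solve-∀

  -- Pascal's rule for falling factorials. It describes how a factorial moment changes when one more
  -- point is hit.
  falling-suc : ∀ h n → falling (suc h) (suc n) ≡ falling (suc h) n + suc h * falling h n
  falling-suc h n = begin
    falling h n + n * falling h n                          ≡⟨ cong (falling h n +_) (falling-top h n) ⟨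
    falling h n + (falling (suc h) n + h * falling h n)    ≡⟨ regroup (falling h n) (falling (suc h) n) h ⟩
    falling (suc h) n + suc h * falling h n                ∎
    where
    open ≡-Reasoning
    regroup : ∀ a b c → a + (b + c * a) ≡ b + (1 + c) * a
    regroup = solve-∀

  falling-> : ∀ h n → n < h → falling h n ≡ 0
  falling-> (suc h) zero    _         = refl
  falling-> (suc h) (suc n) (s≤s n<h) = trans (cong (suc n *_) (falling-> h n n<h)) (*-zeroʳ (suc n))

  falling≤^ : ∀ h n → falling h n ≤ n ^ h
  falling≤^ zero    n       = ≤-refl
  falling≤^ (suc h) zero    = z≤n
  falling≤^ (suc h) (suc n) = *-monoʳ-≤ (suc n) (≤-trans (falling≤^ h n) (^-monoˡ-≤ h (n≤1+n n)))

  h!≤falling : ∀ h n → h ≤ n → h ! ≤ falling h n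
  h!≤falling zero    n       z≤n       = ≤-refl
  h!≤falling (suc h) (suc n) (s≤s h≤n) = *-mono-≤ (s≤s h≤n) (h!≤falling h n h≤n)

  falling-! : ∀ h n → h ≤ n → falling h n * (n ∸ h) ! ≡ n !
  falling-! zero    n       z≤n       = +-identityʳ _
  falling-! (suc h) (suc n) (s≤s h≤n) =
    trans (*-assoc (suc n) (falling h n) _) (cong (suc n *_) (falling-! h n h≤n))

  -- Factor by factor, `(z - j)/(n - j) ≤ z/n` because `z ≤ n`.
  falling-ratio : ∀ h z n → z ≤ n → falling h z * n ^ h ≤ z ^ h * falling h n
  falling-ratio zero    z n z≤n′ = ≤-refl
  falling-ratio (suc h) z n z≤n′ = begin
    falling (suc h) z * (n * n ^ h)             ≡⟨ cong (_* (n * n ^ h)) (top z) ⟩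
    (z ∸ h) * falling h z * (n * n ^ h)         ≡⟨ regroup (z ∸ h) (falling h z) n (n ^ h) ⟩
    (z ∸ h) * n * (falling h z * n ^ h)         ≤⟨ *-mono-≤ cross (falling-ratio h z n z≤n′) ⟩
    z * (n ∸ h) * (z ^ h * falling h n)         ≡⟨ regroup z (n ∸ h) (z ^ h) (falling h n) ⟩
    z * z ^ h * ((n ∸ h) * falling h n)         ≡⟨ cong (z * z ^ h *_) (top n) ⟨
    z * z ^ h * falling (suc h) n               ∎
    where
    open ≤-Reasoning
    regroup : ∀ a b c d → a * b * (c * d) ≡ a * c * (b * d)
    regroup = solve-∀
    top : ∀ m → falling (suc h) m ≡ (m ∸ h) * falling h m
    top m = sym (trans (*-distribʳ-∸ (falling h m) m h)
      (trans (cong (_∸ h * falling h m) (sym (falling-top h m))) (m+n∸n≡m (falling (suc h) m) (h * falling h m))))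
    cross : (z ∸ h) * n ≤ z * (n ∸ h)
    cross = begin
      (z ∸ h) * n       ≡⟨ *-distribʳ-∸ n z h ⟩
      z * n ∸ h * n     ≤⟨ ∸-monoʳ-≤ (z * n) (*-monoʳ-≤ h z≤n′) ⟩
      z * n ∸ h * z     ≡⟨ cong (z * n ∸_) (*-comm h z) ⟩
      z * n ∸ z * h     ≡⟨ *-distribˡ-∸ z n h ⟨
      z * (n ∸ h)       ∎

  hits : ∀ {n} → (Fin n → Bool) → (Fin n → Bool) → Permutation′ n → ℕ
  hits E Z τ = count (λ i → E i ∧ Z (τ ⟨$⟩ʳ i))

  private
    module _ {n} (Z : Fin (suc n) → Bool) where
      z = count Z
      zⱼ : Fin (suc n) → ℕ
      zⱼ j = count (Z ∘ punchIn j)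

      -- The induction for the factorial moments removes the first position together with its value
      -- `j`, so sums over `j` of the remaining `zⱼ` are needed. Here only `j` in `Z` count, and
      -- each leaves `z - 1` values.
      ∑-falling-true : ∀ h → ∑ (allFin (suc n)) (λ j → ⟦ Z j ⟧ * falling h (zⱼ j)) ≡ falling (suc h) z
      ∑-falling-true h = begin
        ∑ (allFin (suc n)) (λ j → ⟦ Z j ⟧ * falling h (zⱼ j))      ≡⟨ ∑-cong pointwise (allFin (suc n)) ⟩
        ∑ (allFin (suc n)) (λ j → ⟦ Z j ⟧ * falling h (pred z))    ≡⟨ ∑-*ʳ (⟦_⟧ ∘ Z) _ (allFin (suc n)) ⟩
        ∑ (allFin (suc n)) (⟦_⟧ ∘ Z) * falling h (pred z)          ≡⟨ cong (_* falling h (pred z)) (count-∑ Z) ⟩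
        z * falling h (pred z)                                     ≡⟨ falling-pred h z ⟨
        falling (suc h) z                                          ∎
        where
        open ≡-Reasoning
        pointwise : ∀ j → ⟦ Z j ⟧ * falling h (zⱼ j) ≡ ⟦ Z j ⟧ * falling h (pred z)
        pointwise j with Z j | count-punchIn Z j
        ... | true  | eq rewrite sym eq = refl
        ... | false | eq = refl

      -- A double count: each of the `falling h z` injective `h`-tuples from `Z` avoids all but `h`
      -- of the `suc n` values `j`.
      ∑-falling : ∀ h → ∑ (allFin (suc n)) (λ j → falling h (zⱼ j)) + h * falling h z ≡ suc n * falling h z
      ∑-falling h = +-cancelˡ-≡ (falling (suc h) z) _ _ (begin
        falling (suc h) z + (S + h * falling h z)        ≡⟨ +-left-comm (falling (suc h) z) S _ ⟩
        S + (falling (suc h) z + h * falling h z)        ≡⟨ cong (S +_) (falling-top h z) ⟩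
        S + z * falling h z                              ≡⟨ cong (λ x → S + x * falling h z) (count-∑ Z) ⟨
        S + ∑ js (⟦_⟧ ∘ Z) * falling h z                 ≡⟨ cong (S +_) (∑-*ʳ (⟦_⟧ ∘ Z) _ js) ⟨
        S + ∑ js (λ j → ⟦ Z j ⟧ * falling h z)           ≡⟨ ∑-+ (falling h ∘ zⱼ) (λ j → ⟦ Z j ⟧ * falling h z) js ⟨
        ∑ js (λ j → falling h (zⱼ j) + ⟦ Z j ⟧ * falling h z) ≡⟨ ∑-cong pointwise js ⟩
        ∑ js (λ j → ⟦ Z j ⟧ * falling h (zⱼ j) + falling h z) ≡⟨ ∑-+ (λ j → ⟦ Z j ⟧ * falling h (zⱼ j)) (λ _ → falling h z) js ⟩
        ∑ js (λ j → ⟦ Z j ⟧ * falling h (zⱼ j)) + ∑ js (λ _ → falling h z)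
          ≡⟨ cong₂ _+_ (∑-falling-true h) (trans (∑-const _ js) (cong (_* falling h z) (length-tabulate {n = suc n} (λ i → i)))) ⟩
        falling (suc h) z + suc n * falling h z          ∎)
        where
        open ≡-Reasoning
        js = allFin (suc n)
        S = ∑ js (λ j → falling h (zⱼ j))
        +-left-comm : ∀ a b c → a + (b + c) ≡ b + (a + c)
        +-left-comm = solve-∀
        pointwise : ∀ j → falling h (zⱼ j) + ⟦ Z j ⟧ * falling h z ≡ ⟦ Z j ⟧ * falling h (zⱼ j) + falling h z
        pointwise j with Z j | count-punchIn Z j
        ... | true  | eq = cong₂ _+_ (sym (+-identityʳ (falling h (zⱼ j)))) (+-identityʳ (falling h z))
        ... | false | eq rewrite eq = +-identityʳ _

      -- The common factor `falling h e` takes care of `h > n`: there the truncated `n ∸ h` can make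
      -- the bare identity false, but the factor is zero since `e ≤ n < h`.
      ∑-falling-! : ∀ h e → e ≤ n →
        falling h e * (∑ (allFin (suc n)) (λ j → falling h (zⱼ j)) * (n ∸ h) !)
          ≡ falling h e * (falling h z * (suc n ∸ h) !)
      ∑-falling-! h e e≤n with ≤-<-connex h n
      ... | inj₂ n<h rewrite falling-> h e (≤-<-trans e≤n n<h) = refl
      ... | inj₁ h≤n = cong (falling h e *_) (begin
        S * (n ∸ h) !                               ≡⟨ cong (_* (n ∸ h) !) S≡ ⟩
        (suc n ∸ h) * falling h z * (n ∸ h) !       ≡⟨ cong (λ x → x * falling h z * (n ∸ h) !) (+-∸-assoc 1 h≤n) ⟩
        suc (n ∸ h) * falling h z * (n ∸ h) !       ≡⟨ regroup (suc (n ∸ h)) (falling h z) ((n ∸ h) !) ⟩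
        falling h z * suc (n ∸ h) !                 ≡⟨ cong (λ x → falling h z * x !) (+-∸-assoc 1 h≤n) ⟨
        falling h z * (suc n ∸ h) !                 ∎)
        where
        open ≡-Reasoning
        S = ∑ (allFin (suc n)) (λ j → falling h (zⱼ j))
        regroup : ∀ a b c → a * b * c ≡ b * (a * c)
        regroup = solve-∀
        S≡ : S ≡ (suc n ∸ h) * falling h z
        S≡ = sym (trans (*-distribʳ-∸ (falling h z) (suc n) h)
          (trans (cong (_∸ h * falling h z) (sym (∑-falling h))) (m+n∸n≡m S (h * falling h z))))

  -- The factorial moments are those of the hypergeometric distribution:
  -- 𝔼[falling h (hits E Z τ)] = falling h |E| · falling h |Z| / falling h n.
  factorial-moment : ∀ n (E Z : Fin n → Bool) h →
    ∑ (permutations n) (falling h ∘ hits E Z) ≡ falling h (count E) * (falling h (count Z) * (n ∸ h) !)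
  factorial-moment zero    E Z zero    = refl
  factorial-moment zero    E Z (suc h) = refl
  factorial-moment (suc n) E Z h       = trans (∑-product _ (insert zero) (allFin (suc n)) (permutations n)) (by-first (E zero) refl h)
    where
    open ≡-Reasoning
    js = allFin (suc n)
    e = count (E ∘ suc)
    hitsⱼ : Fin (suc n) → Permutation′ n → ℕ
    hitsⱼ j = hits (E ∘ suc) (Z ∘ punchIn j)

    hits-insert : ∀ j ρ → hits E Z (insert zero j ρ) ≡ ⟦ E zero ∧ Z j ⟧ + hitsⱼ j ρ
    hits-insert j ρ = cong (⟦ E zero ∧ Z j ⟧ +_)
      (count-cong λ i → cong (λ x → E (suc i) ∧ Z x) (insert-punchIn zero j ρ i))

    rest : ∀ h → ∑ js (λ j → ∑ (permutations n) (falling h ∘ hitsⱼ j)) ≡ falling h e * (falling h (count Z) * (suc n ∸ h) !)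
    rest h = begin
      ∑ js (λ j → ∑ (permutations n) (falling h ∘ hitsⱼ j))
        ≡⟨ ∑-cong (λ j → factorial-moment n (E ∘ suc) (Z ∘ punchIn j) h) js ⟩
      ∑ js (λ j → falling h e * (falling h (zⱼ Z j) * (n ∸ h) !))
        ≡⟨ ∑-*ˡ _ (falling h e) js ⟩
      falling h e * ∑ js (λ j → falling h (zⱼ Z j) * (n ∸ h) !)
        ≡⟨ cong (falling h e *_) (∑-*ʳ (falling h ∘ zⱼ Z) ((n ∸ h) !) js) ⟩
      falling h e * (∑ js (λ j → falling h (zⱼ Z j)) * (n ∸ h) !)
        ≡⟨ ∑-falling-! Z h e (count≤n (E ∘ suc)) ⟩
      falling h e * (falling h (count Z) * (suc n ∸ h) !) ∎

    by-first : ∀ b → E zero ≡ b → ∀ h →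
      ∑ js (λ j → ∑ (permutations n) (λ ρ → falling h (hits E Z (insert zero j ρ))))
        ≡ falling h (⟦ E zero ⟧ + e) * (falling h (count Z) * (suc n ∸ h) !)
    by-first false eq h = begin
      ∑ js (λ j → ∑ (permutations n) (λ ρ → falling h (hits E Z (insert zero j ρ))))
        ≡⟨ ∑-cong (λ j → ∑-cong (λ ρ → cong (falling h) (trans (hits-insert j ρ) (cong (λ b → ⟦ b ∧ Z j ⟧ + hitsⱼ j ρ) eq))) (permutations n)) js ⟩
      ∑ js (λ j → ∑ (permutations n) (falling h ∘ hitsⱼ j))
        ≡⟨ rest h ⟩
      falling h e * (falling h (count Z) * (suc n ∸ h) !)
        ≡⟨ cong (λ b → falling h (⟦ b ⟧ + e) * (falling h (count Z) * (suc n ∸ h) !)) eq ⟨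
      falling h (⟦ E zero ⟧ + e) * (falling h (count Z) * (suc n ∸ h) !) ∎
    by-first true eq zero = trans
      (∑-cong (λ j → ∑-cong {g = falling 0 ∘ hitsⱼ j} (λ ρ → refl) (permutations n)) js) (rest 0)
    by-first true eq (suc h) = begin
      ∑ js (λ j → ∑ (permutations n) (λ ρ → falling (suc h) (hits E Z (insert zero j ρ))))
        ≡⟨ ∑-cong split-∑ js ⟩
      ∑ js (λ j → A j + B j)
        ≡⟨ ∑-+ A B js ⟩
      ∑ js A + ∑ js B
        ≡⟨ cong₂ _+_ (rest (suc h)) second ⟩
      falling (suc h) e * (falling (suc h) (count Z) * (n ∸ h) !)
        + suc h * falling h e * (falling (suc h) (count Z) * (n ∸ h) !)
        ≡⟨ *-distribʳ-+ (falling (suc h) (count Z) * (n ∸ h) !) (falling (suc h) e) (suc h * falling h e) ⟨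
      (falling (suc h) e + suc h * falling h e) * (falling (suc h) (count Z) * (n ∸ h) !)
        ≡⟨ cong (_* (falling (suc h) (count Z) * (n ∸ h) !)) (falling-suc h e) ⟨
      falling (suc h) (suc e) * (falling (suc h) (count Z) * (n ∸ h) !)
        ≡⟨ cong (λ b → falling (suc h) (⟦ b ⟧ + e) * (falling (suc h) (count Z) * (n ∸ h) !)) eq ⟨
      falling (suc h) (⟦ E zero ⟧ + e) * (falling (suc h) (count Z) * (n ∸ h) !) ∎
      where
      A B : Fin (suc n) → ℕ
      A j = ∑ (permutations n) (falling (suc h) ∘ hitsⱼ j)
      B j = ⟦ Z j ⟧ * suc h * ∑ (permutations n) (falling h ∘ hitsⱼ j)

      expand : ∀ j ρ → falling (suc h) (hits E Z (insert zero j ρ))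
                     ≡ falling (suc h) (hitsⱼ j ρ) + ⟦ Z j ⟧ * suc h * falling h (hitsⱼ j ρ)
      expand j ρ = trans (cong (falling (suc h)) (trans (hits-insert j ρ) (cong (λ b → ⟦ b ∧ Z j ⟧ + hitsⱼ j ρ) eq))) (split (Z j) (hitsⱼ j ρ))
        where
        split : ∀ b m → falling (suc h) (⟦ b ⟧ + m) ≡ falling (suc h) m + ⟦ b ⟧ * suc h * falling h m
        split false m = sym (+-identityʳ _)
        split true  m = trans (falling-suc h m) (cong (λ x → falling (suc h) m + x * falling h m) (sym (+-identityʳ (suc h))))

      split-∑ : ∀ j → ∑ (permutations n) (λ ρ → falling (suc h) (hits E Z (insert zero j ρ))) ≡ A j + B j
      split-∑ j = trans (∑-cong (expand j) (permutations n)) (trans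
        (∑-+ (falling (suc h) ∘ hitsⱼ j) (λ ρ → ⟦ Z j ⟧ * suc h * falling h (hitsⱼ j ρ)) (permutations n))
        (cong (A j +_) (∑-*ˡ (falling h ∘ hitsⱼ j) (⟦ Z j ⟧ * suc h) (permutations n))))

      second : ∑ js (λ j → ⟦ Z j ⟧ * suc h * ∑ (permutations n) (falling h ∘ hitsⱼ j))
             ≡ suc h * falling h e * (falling (suc h) (count Z) * (n ∸ h) !)
      second = begin
        ∑ js (λ j → ⟦ Z j ⟧ * suc h * ∑ (permutations n) (falling h ∘ hitsⱼ j))
          ≡⟨ ∑-cong (λ j → trans (cong (⟦ Z j ⟧ * suc h *_) (factorial-moment n (E ∘ suc) (Z ∘ punchIn j) h))
                             (regroup ⟦ Z j ⟧ (suc h) (falling h e) (falling h (zⱼ Z j)) ((n ∸ h) !))) js ⟩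
        ∑ js (λ j → ⟦ Z j ⟧ * falling h (zⱼ Z j) * (suc h * falling h e * (n ∸ h) !))
          ≡⟨ ∑-*ʳ (λ j → ⟦ Z j ⟧ * falling h (zⱼ Z j)) (suc h * falling h e * (n ∸ h) !) js ⟩
        ∑ js (λ j → ⟦ Z j ⟧ * falling h (zⱼ Z j)) * (suc h * falling h e * (n ∸ h) !)
          ≡⟨ cong (_* (suc h * falling h e * (n ∸ h) !)) (∑-falling-true Z h) ⟩
        falling (suc h) (count Z) * (suc h * falling h e * (n ∸ h) !)
          ≡⟨ regroup′ (falling (suc h) (count Z)) (suc h * falling h e) ((n ∸ h) !) ⟩
        suc h * falling h e * (falling (suc h) (count Z) * (n ∸ h) !) ∎
        where
        regroup : ∀ a b c d f → a * b * (c * (d * f)) ≡ a * d * (b * c * f)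
        regroup = solve-∀
        regroup′ : ∀ a b c → a * (b * c) ≡ b * (a * c)
        regroup′ = solve-∀

  exceeds : ℕ → ℕ → ℕ
  exceeds h m = ⟦ h ≤ᵇ m ⟧

  exceeds-falling : ∀ h m → exceeds h m * h ! ≤ falling h m
  exceeds-falling h m with h ≤ᵇ m | ≤ᵇ⇒≤ h m
  ... | false | _   = z≤n
  ... | true  | h≤m = ≤-trans (≤-reflexive (+-identityʳ (h !))) (h!≤falling h m (h≤m _))

  falling-tail : ∀ h z n → z ≤ n → falling h z * (n ∸ h) ! * n ^ h ≤ z ^ h * n !
  falling-tail h z n z≤n′ with ≤-<-connex h n
  ... | inj₂ n<h rewrite falling-> h z (≤-<-trans z≤n′ n<h) = z≤n
  ... | inj₁ h≤n = begin
    falling h z * (n ∸ h) ! * n ^ h       ≡⟨ regroup (falling h z) ((n ∸ h) !) (n ^ h) ⟩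
    falling h z * n ^ h * (n ∸ h) !       ≤⟨ *-monoˡ-≤ ((n ∸ h) !) (falling-ratio h z n z≤n′) ⟩
    z ^ h * falling h n * (n ∸ h) !       ≡⟨ *-assoc (z ^ h) (falling h n) _ ⟩
    z ^ h * (falling h n * (n ∸ h) !)     ≡⟨ cong (z ^ h *_) (falling-! h n h≤n) ⟩
    z ^ h * n !                           ∎
    where
    open ≤-Reasoning
    regroup : ∀ a b c → a * b * c ≡ a * c * b
    regroup = solve-∀

  -- Markov's inequality for the factorial moment of order `h`: a permutation with at least `h` hits
  -- contributes at least `h !` to it.
  tail : ∀ {n} (E Z : Fin n → Bool) h →
    ∑ (permutations n) (exceeds h ∘ hits E Z) * h ! * n ^ h ≤ (count E * count Z) ^ h * n !
  tail {n} E Z h = begin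
    ∑ (permutations n) (exceeds h ∘ hits E Z) * h ! * n ^ h
      ≡⟨ cong (_* n ^ h) (∑-*ʳ _ (h !) (permutations n)) ⟨
    ∑ (permutations n) (λ τ → exceeds h (hits E Z τ) * h !) * n ^ h
      ≤⟨ *-monoˡ-≤ (n ^ h) (∑-mono (λ τ → exceeds-falling h (hits E Z τ)) (permutations n)) ⟩
    ∑ (permutations n) (falling h ∘ hits E Z) * n ^ h
      ≡⟨ cong (_* n ^ h) (factorial-moment n E Z h) ⟩
    falling h (count E) * (falling h (count Z) * (n ∸ h) !) * n ^ h
      ≡⟨ *-assoc (falling h (count E)) _ (n ^ h) ⟩
    falling h (count E) * (falling h (count Z) * (n ∸ h) ! * n ^ h)
      ≤⟨ *-mono-≤ (falling≤^ h (count E)) (falling-tail h (count Z) n (count≤n Z)) ⟩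
    count E ^ h * (count Z ^ h * n !)
      ≡⟨ *-assoc (count E ^ h) (count Z ^ h) (n !) ⟨
    count E ^ h * count Z ^ h * n !
      ≡⟨ cong (_* n !) ([m*n]^k≡m^k*n^k (count E) (count Z) h) ⟨
    (count E * count Z) ^ h * n ! ∎
    where open ≤-Reasoning

  -- The sparse case: the mean is at most `1/B`, and `mean^h` is already small enough, so `h !` is
  -- given away.
  tail-few : ∀ {n} (E Z : Fin n → Bool) h e z B .{{_ : NonZero n}} → count E ≤ e → count Z ≤ z → e * z * B ≤ n →
    ∑ (permutations n) (exceeds h ∘ hits E Z) * B ^ h ≤ n !
  tail-few {n} E Z h e z B E≤e Z≤z ezB≤n = *-cancelʳ-≤ _ _ (n ^ h) {{m^n≢0 n h}} (begin
    T * B ^ h * n ^ h                          ≡⟨ regroup T (B ^ h) (n ^ h) ⟩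
    T * n ^ h * B ^ h                          ≤⟨ *-monoˡ-≤ (B ^ h) (*-monoˡ-≤ (n ^ h) (m≤m*n T (h !) {{h !≢0}})) ⟩
    T * h ! * n ^ h * B ^ h                    ≤⟨ *-monoˡ-≤ (B ^ h) (tail E Z h) ⟩
    (count E * count Z) ^ h * n ! * B ^ h      ≤⟨ *-monoˡ-≤ (B ^ h) (*-monoˡ-≤ (n !) (^-monoˡ-≤ h (*-mono-≤ E≤e Z≤z))) ⟩
    (e * z) ^ h * n ! * B ^ h                  ≡⟨ regroup′ ((e * z) ^ h) (n !) (B ^ h) ⟩
    n ! * ((e * z) ^ h * B ^ h)                ≡⟨ cong (n ! *_) ([m*n]^k≡m^k*n^k (e * z) B h) ⟨
    n ! * (e * z * B) ^ h                      ≤⟨ *-monoʳ-≤ (n !) (^-monoˡ-≤ h ezB≤n) ⟩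
    n ! * n ^ h                                ∎)
    where
    open ≤-Reasoning
    T = ∑ (permutations n) (exceeds h ∘ hits E Z)
    regroup : ∀ a b c → a * b * c ≡ a * c * b
    regroup = solve-∀
    regroup′ : ∀ a b c → a * b * c ≡ b * (a * c)
    regroup′ = solve-∀

  -- When `h` is at least eight times the mean, `mean^h / h! ≤ (4 mean / h)^h ≤ 2^(-h)`. The
  -- constant 8 is the 4 from Stirling times the 2 that is gained.
  tail-many : ∀ {n} (E Z : Fin n → Bool) h e z .{{_ : NonZero n}} → count E ≤ e → count Z ≤ z → 8 * (e * z) ≤ h * n →
    ∑ (permutations n) (exceeds h ∘ hits E Z) * 2 ^ h ≤ n !
  tail-many {n} E Z h e z E≤e Z≤z 8ez≤hn =
    *-cancelʳ-≤ _ _ (4 ^ h * h ! * n ^ h) {{m*n≢0 _ _ {{m*n≢0 _ _ {{m^n≢0 4 h}} {{h !≢0}}}} {{m^n≢0 n h}}}} (begin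
    T * 2 ^ h * (4 ^ h * h ! * n ^ h)          ≡⟨ regroup T (2 ^ h) (4 ^ h) (h !) (n ^ h) ⟩
    2 ^ h * 4 ^ h * (T * h ! * n ^ h)          ≡⟨ cong (_* (T * h ! * n ^ h)) ([m*n]^k≡m^k*n^k 2 4 h) ⟨
    8 ^ h * (T * h ! * n ^ h)                  ≤⟨ *-monoʳ-≤ (8 ^ h) (tail E Z h) ⟩
    8 ^ h * ((count E * count Z) ^ h * n !)    ≤⟨ *-monoʳ-≤ (8 ^ h) (*-monoˡ-≤ (n !) (^-monoˡ-≤ h (*-mono-≤ E≤e Z≤z))) ⟩
    8 ^ h * ((e * z) ^ h * n !)                ≡⟨ *-assoc (8 ^ h) ((e * z) ^ h) (n !) ⟨
    8 ^ h * (e * z) ^ h * n !                  ≡⟨ cong (_* n !) ([m*n]^k≡m^k*n^k 8 (e * z) h) ⟨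
    (8 * (e * z)) ^ h * n !                    ≤⟨ *-monoˡ-≤ (n !) (^-monoˡ-≤ h 8ez≤hn) ⟩
    (h * n) ^ h * n !                          ≡⟨ cong (_* n !) ([m*n]^k≡m^k*n^k h n h) ⟩
    h ^ h * n ^ h * n !                        ≤⟨ *-monoˡ-≤ (n !) (*-monoˡ-≤ (n ^ h) (h^h≤4^h*h! h)) ⟩
    4 ^ h * h ! * n ^ h * n !                  ≡⟨ *-comm (4 ^ h * h ! * n ^ h) (n !) ⟩
    n ! * (4 ^ h * h ! * n ^ h)                ∎)
    where
    open ≤-Reasoning
    T = ∑ (permutations n) (exceeds h ∘ hits E Z)
    regroup : ∀ a b c d f → a * b * (c * d * f) ≡ b * c * (a * d * f)
    regroup = solve-∀

-- Greedy independent sets, pigeonhole, and duplicate-free lists.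

module Lists where
  open import Data.Bool.Base using (Bool; true; false; T)
  open import Data.Fin.Base using (Fin; zero; suc)
  open import Data.List.Base using (List; []; _∷_; map; length; filter; allFin; tabulate; _++_)
  open import Data.List.Properties using (length-++; length-filter)
  open import Data.List.Membership.Propositional using (_∈_)
  open import Data.List.Membership.Propositional.Properties
    using (∈-∃++; ∈-filter⁺; ∈-filter⁻; ∈-allFin)
  open import Data.List.Relation.Binary.Permutation.Propositional using (_↭_; ↭-refl; ↭-trans; prep)
  open import Data.List.Relation.Binary.Permutation.Propositional.Properties using (∈-resp-↭; shift; ↭-length)
  open import Data.List.Relation.Unary.All as All using (All; []; _∷_)
  import Data.List.Relation.Unary.All.Properties as Allₚ
  open import Data.List.Relation.Unary.AllPairs using (AllPairs; []; _∷_)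
  open import Data.List.Relation.Unary.Any using (here; there)
  open import Data.List.Relation.Unary.Unique.Propositional using (Unique)
  open import Data.Nat.Base
  open import Data.Nat.Properties
  open import Data.Product.Base using (∃; _×_; _,_; proj₁; proj₂)
  open import Function.Base using (_∘_)
  open import Relation.Binary.Core using (Rel)
  open import Relation.Binary.Definitions using () renaming (Decidable to Decidable₂)
  open import Relation.Binary.PropositionalEquality using (_≡_; _≢_; refl; sym; trans; cong)
  open import Relation.Nullary using (¬_; yes; no; contradiction)
  open import Relation.Nullary.Decidable using (¬?; T?)
  open import Relation.Unary using (Pred; Decidable)
  open import Level using (0ℓ)
  open Moments

  private
    variable
      A B : Set

  length-filter-split : {P : Pred A 0ℓ} (P? : Decidable P) (xs : List A) →
    length xs ≡ length (filter P? xs) + length (filter (¬? ∘ P?) xs)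
  length-filter-split P? []       = refl
  length-filter-split P? (x ∷ xs) with P? x
  ... | yes _ = cong suc (length-filter-split P? xs)
  ... | no  _ = trans (cong suc (length-filter-split P? xs)) (sym (+-suc _ _))

  length-filter-filter : {P Q : Pred A 0ℓ} (P? : Decidable P) (Q? : Decidable Q) (xs : List A) →
    length (filter P? (filter Q? xs)) ≤ length (filter P? xs)
  length-filter-filter P? Q? []       = z≤n
  length-filter-filter P? Q? (x ∷ xs) with Q? x
  ... | no  _ with P? x
  ...   | yes _ = m≤n⇒m≤1+n (length-filter-filter P? Q? xs)
  ...   | no  _ = length-filter-filter P? Q? xs
  length-filter-filter P? Q? (x ∷ xs) | yes _ with P? x
  ...   | yes _ = s≤s (length-filter-filter P? Q? xs)
  ...   | no  _ = length-filter-filter P? Q? xs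

  module _ {R : Rel A 0ℓ} (R? : Decidable₂ R) (R-refl : ∀ x → R x x) (D : ℕ) where

    private
      go : ∀ k xs → length xs ≤ k → (∀ x → x ∈ xs → length (filter (R? x) xs) ≤ D) →
        ∃ λ ys → (∀ {x} → x ∈ ys → x ∈ xs) × AllPairs (λ x y → ¬ R x y) ys × length xs ≤ D * length ys
      go k       []         _         deg = [] , (λ ()) , [] , z≤n
      go (suc k) xs@(x ∷ xs′) (s≤s len) deg =
        x ∷ ys , mem , All.tabulate (λ y∈ys → proj₂ (∈-filter⁻ (¬? ∘ R? x) {xs = xs} (ys⊆ y∈ys))) ∷ indep , bound
        where
        rest = filter (¬? ∘ R? x) xs
        shorter : length rest ≤ k
        shorter with R? x x
        ... | yes _ = ≤-trans (length-filter (¬? ∘ R? x) xs′) len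
        ... | no ¬r = contradiction (R-refl x) ¬r
        rec = go k rest shorter λ y y∈ →
          ≤-trans (length-filter-filter (R? y) (¬? ∘ R? x) xs) (deg y (proj₁ (∈-filter⁻ (¬? ∘ R? x) {xs = xs} y∈)))
        ys = proj₁ rec
        ys⊆ = proj₁ (proj₂ rec)
        indep = proj₁ (proj₂ (proj₂ rec))
        mem : ∀ {y} → y ∈ x ∷ ys → y ∈ xs
        mem (here refl) = here refl
        mem (there y∈)  = proj₁ (∈-filter⁻ (¬? ∘ R? x) {xs = xs} (ys⊆ y∈))
        open ≤-Reasoning
        bound : length xs ≤ D * suc (length ys)
        bound = begin
          length xs                                   ≡⟨ length-filter-split (R? x) xs ⟩
          length (filter (R? x) xs) + length rest     ≤⟨ +-mono-≤ (deg x (here refl)) (proj₂ (proj₂ (proj₂ rec))) ⟩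
          D + D * length ys                           ≡⟨ *-suc D (length ys) ⟨
          D * suc (length ys)                         ∎

    abstract
      -- Choosing an element deletes its at most `D` neighbours, itself included by reflexivity, and
      -- deletion never raises a degree.
      greedy-independent : ∀ xs → (∀ x → x ∈ xs → length (filter (R? x) xs) ≤ D) →
        ∃ λ ys → (∀ {x} → x ∈ ys → x ∈ xs) × AllPairs (λ x y → ¬ R x y) ys × length xs ≤ D * length ys
      greedy-independent xs = go (length xs) xs ≤-refl

  module _ (key : A → ℕ) where

    private
      fibre : ℕ → List A → List A
      fibre t = filter (λ a → key a ≟ t)

      fibres-bound : ∀ c D K xs → (∀ {x} → x ∈ xs → key x < K) →
        (∀ t → t < K → c * length (fibre t xs) ≤ D) → c * length xs ≤ K * D
      fibres-bound c D zero    []      _  _ = ≤-reflexive (*-zeroʳ c)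
      fibres-bound c D zero    (x ∷ _) lt _ = contradiction (lt (here refl)) n≮0
      fibres-bound c D (suc K) xs      lt small = begin
        c * length xs                                    ≡⟨ cong (c *_) (length-filter-split key≟K xs) ⟩
        c * (length (fibre K xs) + length rest)          ≡⟨ *-distribˡ-+ c (length (fibre K xs)) (length rest) ⟩
        c * length (fibre K xs) + c * length rest        ≤⟨ +-mono-≤ (small K ≤-refl) (fibres-bound c D K rest lt′ small′) ⟩
        D + K * D                                        ∎
        where
        open ≤-Reasoning
        key≟K : Decidable (λ a → key a ≡ K)
        key≟K a = key a ≟ K
        rest = filter (¬? ∘ key≟K) xs
        lt′ : ∀ {x} → x ∈ rest → key x < K
        lt′ x∈ = let (x∈xs , k≢K) = ∈-filter⁻ (¬? ∘ key≟K) {xs = xs} x∈ in ≤∧≢⇒< (s≤s⁻¹ (lt x∈xs)) k≢K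
        small′ : ∀ t → t < K → c * length (fibre t rest) ≤ D
        small′ t t<K = ≤-trans (*-monoʳ-≤ c (length-filter-filter (λ a → key a ≟ t) (¬? ∘ key≟K) xs)) (small t (m<n⇒m<1+n t<K))

    private
      pigeonhole′ : ∀ K .{{_ : NonZero K}} xs → (∀ {x} → x ∈ xs → key x < K) →
        ∃ λ t → t < K × length xs ≤ K * length (filter (λ a → key a ≟ t) xs)
      pigeonhole′ K xs lt with anyUpTo? (λ t → length xs ≤? K * length (fibre t xs)) K
      ... | yes found = found
      -- If no fibre is large enough, `K` times each is at most `length xs - 1`; adding up the `K`
      -- fibres would give `K * length xs ≤ K * (length xs - 1)`.
      ... | no  none  = contradiction (fibres-bound K (pred (length xs)) K xs lt small)
        (<⇒≱ (*-monoʳ-< K (pred< xs nonempty)))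
        where
        nonempty : length xs ≢ 0
        nonempty eq = none (0 , >-nonZero⁻¹ K , ≤-trans (≤-reflexive eq) z≤n)
        pred< : ∀ (xs : List A) → length xs ≢ 0 → pred (length xs) < length xs
        pred< []      ≢0 = contradiction refl ≢0
        pred< (_ ∷ _) _  = ≤-refl
        small : ∀ t → t < K → K * length (fibre t xs) ≤ pred (length xs)
        small t t<K = <⇒≤pred (≰⇒> λ le → none (t , t<K , le))

    abstract
      pigeonhole : ∀ K .{{_ : NonZero K}} xs → (∀ {x} → x ∈ xs → key x < K) →
        ∃ λ t → t < K × length xs ≤ K * length (filter (λ a → key a ≟ t) xs)
      pigeonhole = pigeonhole′

  extract : ∀ {xs ys : List A} → Unique xs → (∀ {x} → x ∈ xs → x ∈ ys) → ∃ λ zs → ys ↭ xs ++ zs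
  extract {xs = []}     {ys} []         _  = ys , ↭-refl
  extract {xs = x ∷ xs} {ys} (x∉ ∷ uniq) xs⊆ with ∈-∃++ (xs⊆ (here refl))
  ... | us , vs , refl =
    let (zs , p) = extract uniq xs⊆′ in zs , ↭-trans (shift x us vs) (prep x p)
    where
    xs⊆′ : ∀ {y} → y ∈ xs → y ∈ us ++ vs
    xs⊆′ y∈ with ∈-resp-↭ (shift x us vs) (xs⊆ (there y∈))
    ... | here refl = contradiction refl (All.lookup x∉ y∈)
    ... | there y∈′ = y∈′

  unique-length-≤ : ∀ {xs ys : List A} → Unique xs → (∀ {x} → x ∈ xs → x ∈ ys) → length xs ≤ length ys
  unique-length-≤ {xs = xs} uniq xs⊆ =
    let (zs , p) = extract uniq xs⊆
    in ≤-trans (m≤m+n _ _) (≤-reflexive (trans (sym (length-++ xs {zs})) (sym (↭-length p))))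

  unique-map : ∀ (f : A → B) {xs} → Unique xs → (∀ {x y} → x ∈ xs → y ∈ xs → f x ≡ f y → x ≡ y) → Unique (map f xs)
  unique-map f []                 inj = []
  unique-map f {x ∷ xs} (x∉ ∷ uniq) inj =
    Allₚ.map⁺ (All.tabulate λ y∈ eq → All.lookup x∉ y∈ (inj (here refl) (there y∈) eq))
    ∷ unique-map f uniq λ x∈ y∈ → inj (there x∈) (there y∈)

  length-filter-allFin : ∀ {n} (P : Fin n → Bool) → length (filter (T? ∘ P) (allFin n)) ≡ count P
  length-filter-allFin {n} P = go n (λ i → i)
    where
    go : ∀ m (f : Fin m → Fin n) → length (filter (T? ∘ P) (tabulate f)) ≡ count (P ∘ f)
    go zero    f = refl
    go (suc m) f with P (f zero)
    ... | true  = cong suc (go m (f ∘ suc))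
    ... | false = go m (f ∘ suc)

  unique-length≤count : ∀ {n} {xs : List (Fin n)} (P : Fin n → Bool) → Unique xs → (∀ {x} → x ∈ xs → T (P x)) → length xs ≤ count P
  unique-length≤count P uniq all = ≤-trans
    (unique-length-≤ uniq λ x∈ → ∈-filter⁺ (T? ∘ P) (∈-allFin _) (all x∈))
    (≤-reflexive (length-filter-allFin P))

-- From a family of common patterns to an upper bound for `U`.

module CommonPatterns where
  open import Data.Fin.Base as Fin using (Fin; zero; suc; toℕ; fromℕ<)
  open import Data.Fin.Permutation using (Permutation′; _⟨$⟩ʳ_)
  import Data.Fin.Properties as Finₚ
  open import Data.List.Base using (List; []; _∷_; map; length; filter; allFin; concat; _++_)
  open import Data.List.Properties using (length-++; map-++; concat-++; map-cong-local; map-∘; filter-≐; filter-accept; filter-reject)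
  open import Data.List.Membership.Propositional using (_∈_; _∉_)
  open import Data.List.Membership.Propositional.Properties
    using (∈-filter⁺; ∈-filter⁻; ∈-allFin; ∈-++⁺ˡ; ∈-++⁺ʳ; ∈-++⁻)
  open import Data.List.Relation.Binary.Permutation.Propositional using (_↭_; ↭-refl; ↭-sym; ↭-trans; ↭-reflexive; ↭⇒↭ₛ)
  open import Data.List.Relation.Binary.Permutation.Propositional.Properties as Perm
    using (∈-resp-↭; ↭-length; ↭-map-inv; ++-identityʳ)
  import Data.List.Relation.Binary.Permutation.Setoid.Properties as PermSetoid
  open import Data.List.Relation.Unary.All as All using (All; []; _∷_)
  import Data.List.Relation.Unary.All.Properties as Allₚ
  open import Data.List.Relation.Unary.AllPairs as AllPairs using (AllPairs; []; _∷_)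
  import Data.List.Relation.Unary.AllPairs.Properties as AllPairsₚ
  open import Data.List.Relation.Unary.Any using (here; there)
  open import Data.List.Relation.Unary.Unique.Propositional using (Unique)
  open import Data.List.Relation.Unary.Unique.Propositional.Properties using (allFin⁺)
  open import Data.Nat.Base
  open import Data.Nat.Properties
  open import Data.Product.Base using (∃; _×_; _,_; proj₁; proj₂; swap)
  open import Data.Sum.Base as Sum using (_⊎_; inj₁; inj₂)
  open import Data.Vec.Base as Vec using (lookup)
  open import Data.Vec.Properties using (lookup∘tabulate)
  open import Function.Base using (_∘_)
  open import Relation.Binary.Core using (Rel)
  open import Relation.Binary.Definitions using (Symmetric)
  open import Relation.Binary.PropositionalEquality
    using (_≡_; refl; sym; trans; cong; cong₂; subst; setoid; resp₂; module ≡-Reasoning)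
  open import Relation.Nullary using (yes; no; contradiction)
  open import Relation.Unary using (Pred)
  open import Level using (0ℓ)
  open import Defs using (patternOf; _∼_; subsequence; Similar; Similar?; similar-n; least; U)
  open import Data.Empty using (⊥)
  open Lists

  private
    variable
      A : Set
      n : ℕ

  AllPairs-resp-↭ : {R : Rel A 0ℓ} → Symmetric R → ∀ {xs ys} → xs ↭ ys → AllPairs R xs → AllPairs R ys
  AllPairs-resp-↭ {A} {R} R-sym xs↭ys = PermSetoid.AllPairs-resp-↭ (setoid A) R-sym (resp₂ R) (↭⇒↭ₛ xs↭ys)

  Unique-resp-↭ : {xs ys : List A} → xs ↭ ys → Unique xs → Unique ys
  Unique-resp-↭ = AllPairs-resp-↭ (λ x≢y eq → x≢y (sym eq))

  unique⇒↭ : {xs ys : List A} → Unique xs → Unique ys →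
    (∀ {x} → x ∈ xs → x ∈ ys) → (∀ {x} → x ∈ ys → x ∈ xs) → ys ↭ xs
  unique⇒↭ {xs = xs} {ys} xs! ys! xs⊆ys ys⊆xs with extract xs! xs⊆ys
  ... | []     , p = ↭-trans p (++-identityʳ xs)
  ... | z ∷ zs , p = contradiction
    (≤-trans (≤-reflexive (trans (sym (length-++ xs)) (sym (↭-length p)))) (unique-length-≤ ys! ys⊆xs))
    (<⇒≱ (m<m+n (length xs) z<s))

  <-sorted-≡ : {xs ys : List (Fin n)} → AllPairs Fin._<_ xs → AllPairs Fin._<_ ys →
    (∀ {x} → x ∈ xs → x ∈ ys) → (∀ {x} → x ∈ ys → x ∈ xs) → xs ≡ ys
  <-sorted-≡ {xs = []}     {[]}     _ _ _ _ = refl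
  <-sorted-≡ {xs = []}     {y ∷ _}  _ _ _ ys⊆ = contradiction (ys⊆ (here refl)) λ ()
  <-sorted-≡ {xs = x ∷ _}  {[]}     _ _ xs⊆ _ = contradiction (xs⊆ (here refl)) λ ()
  <-sorted-≡ {xs = x ∷ xs} {y ∷ ys} (x< ∷ xs↗) (y< ∷ ys↗) xs⊆ ys⊆ = cong₂ _∷_ x≡y
    (<-sorted-≡ xs↗ ys↗
      (λ z∈ → drop-head x≡y x< z∈ (xs⊆ (there z∈)))
      (λ z∈ → drop-head (sym x≡y) y< z∈ (ys⊆ (there z∈))))
    where
    drop-head : ∀ {x y : Fin _} {xs ys} → x ≡ y → All (x Fin.<_) xs → ∀ {z} → z ∈ xs → z ∈ y ∷ ys → z ∈ ys
    drop-head refl x< z∈ (here refl)  = contradiction (All.lookup x< z∈) (<-irrefl refl)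
    drop-head refl x< z∈ (there z∈′) = z∈′
    x≡y : x ≡ y
    x≡y with xs⊆ (here refl) | ys⊆ (here refl)
    ... | here eq  | _        = eq
    ... | there _  | here eq  = sym eq
    ... | there x∈ | there y∈ = contradiction (All.lookup x< y∈) (<-asym (All.lookup y< x∈))

  -- Strictness in both coordinates makes pairs that stand in this relation differ in both entries,
  -- so a class of agreeing pairs never uses a point twice.
  SameOrder : Rel (ℕ × ℕ) 0ℓ
  SameOrder (a , b) (a′ , b′) = (a < a′ × b < b′) ⊎ (a′ < a × b′ < b)

  SameOrder-sym : Symmetric SameOrder
  SameOrder-sym = Sum.swap

  SameOrder-swap : ∀ {p q} → SameOrder p q → SameOrder (swap p) (swap q)
  SameOrder-swap = Sum.map swap swap

  value : Permutation′ n → Fin n → ℕ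
  value σ i = toℕ (σ ⟨$⟩ʳ i)

  Agree : Permutation′ n → Permutation′ n → Rel (Fin n × Fin n) 0ℓ
  Agree σ π (x , y) (x′ , y′) = SameOrder (toℕ x , toℕ y) (toℕ x′ , toℕ y′)
                              × SameOrder (value σ x , value π y) (value σ x′ , value π y′)

  Agree-sym : ∀ {σ π : Permutation′ n} → Symmetric (Agree σ π)
  Agree-sym (p , q) = SameOrder-sym p , SameOrder-sym q

  -- The unit in which the construction is assembled. Coverage is required only up to `↭`, so the
  -- order of pairs inside a class is ignored until the colourings are read off.
  record Matching (σ π : Permutation′ n) (xs ys : List (Fin n)) (k : ℕ) : Set where
    field
      classes : List (List (Fin n × Fin n))
      agree   : All (AllPairs (Agree σ π)) classes
      left    : xs ↭ map proj₁ (concat classes)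
      right   : ys ↭ map proj₂ (concat classes)
      size    : length classes ≤ k
  open Matching

  module _ {σ π : Permutation′ n} where

    Matching-[] : ∀ {k} → Matching σ π [] [] k
    Matching-[] = record { classes = [] ; agree = [] ; left = ↭-refl ; right = ↭-refl ; size = z≤n }

    Matching-class : ∀ M → AllPairs (Agree σ π) M → Matching σ π (map proj₁ M) (map proj₂ M) 1
    Matching-class M agr = record
      { classes = M ∷ []
      ; agree   = agr ∷ []
      ; left    = ↭-sym (Perm.map⁺ proj₁ (++-identityʳ M))
      ; right   = ↭-sym (Perm.map⁺ proj₂ (++-identityʳ M))
      ; size    = ≤-refl
      }

    Matching-++ : ∀ {xs ys xs′ ys′ k k′} → Matching σ π xs ys k → Matching σ π xs′ ys′ k′ →
                  Matching σ π (xs ++ xs′) (ys ++ ys′) (k + k′)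
    Matching-++ m m′ = record
      { classes = classes m ++ classes m′
      ; agree   = Allₚ.++⁺ (agree m) (agree m′)
      ; left    = ↭-trans (Perm.++⁺ (left m) (left m′)) (↭-reflexive (joined proj₁))
      ; right   = ↭-trans (Perm.++⁺ (right m) (right m′)) (↭-reflexive (joined proj₂))
      ; size    = ≤-trans (≤-reflexive (length-++ (classes m))) (+-mono-≤ (size m) (size m′))
      }
      where
      joined : (f : Fin n × Fin n → Fin n) →
        map f (concat (classes m)) ++ map f (concat (classes m′)) ≡ map f (concat (classes m ++ classes m′))
      joined f = trans (sym (map-++ f (concat (classes m)) _)) (cong (map f) (concat-++ (classes m) (classes m′)))

    Matching-resp : ∀ {xs ys xs′ ys′ k k′} → xs′ ↭ xs → ys′ ↭ ys → k ≤ k′ → Matching σ π xs ys k → Matching σ π xs′ ys′ k′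
    Matching-resp p q k≤k′ m = record
      { classes = classes m
      ; agree   = agree m
      ; left    = ↭-trans p (left m)
      ; right   = ↭-trans q (right m)
      ; size    = ≤-trans (size m) k≤k′
      }

    Matching-trivial : ∀ xs ys → length xs ≡ length ys → Matching σ π xs ys (length xs)
    Matching-trivial []       []       _  = Matching-[]
    Matching-trivial (x ∷ xs) (y ∷ ys) eq =
      Matching-++ (Matching-class ((x , y) ∷ []) ([] ∷ [])) (Matching-trivial xs ys (cong pred eq))

  Matching-swap : ∀ {σ π : Permutation′ n} {xs ys k} → Matching σ π xs ys k → Matching π σ ys xs k
  Matching-swap {n} {σ} {π} m = record
    { classes = map (map swap) (classes m)
    ; agree   = Allₚ.map⁺ (All.map (λ {M} → swapped {M}) (agree m))
    ; left    = ↭-trans (right m) (↭-reflexive (flipped proj₁ (classes m)))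
    ; right   = ↭-trans (left m) (↭-reflexive (flipped proj₂ (classes m)))
    ; size    = ≤-trans (≤-reflexive (length-map (map swap) (classes m))) (size m)
    }
    where
    open import Data.List.Properties using (length-map; concat-map)
    swapped : ∀ {M} → AllPairs (Agree σ π) M → AllPairs (Agree π σ) (map swap M)
    swapped agr = AllPairsₚ.map⁺ (AllPairs.map (λ (p , q) → SameOrder-swap p , SameOrder-swap q) agr)
    flipped : (f : Fin n × Fin n → Fin n) → ∀ Ms → map (f ∘ swap) (concat Ms) ≡ map f (concat (map (map swap) Ms))
    flipped f Ms = trans (map-∘ (concat Ms)) (cong (map f) (sym (concat-map Ms)))

  nth : List (List A) → ℕ → List A
  nth []       _       = []
  nth (M ∷ _)  zero    = M
  nth (_ ∷ Ms) (suc k) = nth Ms k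

  nth-All : {P : Pred (List A) 0ℓ} → P [] → ∀ {Ms} → All P Ms → ∀ k → P (nth Ms k)
  nth-All p[] []       k       = p[]
  nth-All p[] (p ∷ _)  zero    = p
  nth-All p[] (_ ∷ ps) (suc k) = nth-All p[] ps k

  module _ (f : A → Fin n) where
    open import Data.List.Membership.DecPropositional (Finₚ._≟_ {n}) using (_∈?_)

    colour : List (List A) → Fin n → ℕ
    colour []       j = 0
    colour (M ∷ Ms) j with j ∈? map f M
    ... | yes _ = 0
    ... | no  _ = suc (colour Ms j)

    ∈-concat⁻ : ∀ M Ms {j} → j ∈ map f (concat (M ∷ Ms)) → j ∈ map f M ⊎ j ∈ map f (concat Ms)
    ∈-concat⁻ M Ms {j} j∈ = ∈-++⁻ (map f M) (subst (j ∈_) (map-++ f M (concat Ms)) j∈)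

    colour-< : ∀ Ms {j} → j ∈ map f (concat Ms) → colour Ms j < length Ms
    colour-< (M ∷ Ms) {j} j∈ with j ∈? map f M | ∈-concat⁻ M Ms j∈
    ... | yes _  | _        = s≤s z≤n
    ... | no ¬j∈ | inj₁ j∈′ = contradiction j∈′ ¬j∈
    ... | no _   | inj₂ j∈′ = s≤s (colour-< Ms j∈′)

    ∈-colour : ∀ Ms {j} → j ∈ map f (concat Ms) → j ∈ map f (nth Ms (colour Ms j))
    ∈-colour (M ∷ Ms) {j} j∈ with j ∈? map f M | ∈-concat⁻ M Ms j∈
    ... | yes j∈′ | _        = j∈′
    ... | no ¬j∈  | inj₁ j∈′ = contradiction j∈′ ¬j∈
    ... | no _    | inj₂ j∈′ = ∈-colour Ms j∈′

    nth⊆concat : ∀ Ms k {j} → j ∈ map f (nth Ms k) → j ∈ map f (concat Ms)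
    nth⊆concat (M ∷ Ms) zero    {j} j∈ = subst (j ∈_) (sym (map-++ f M (concat Ms))) (∈-++⁺ˡ j∈)
    nth⊆concat (M ∷ Ms) (suc k) {j} j∈ = subst (j ∈_) (sym (map-++ f M (concat Ms))) (∈-++⁺ʳ (map f M) (nth⊆concat Ms k j∈))

    colour-nth : ∀ Ms k {j} → Unique (map f (concat Ms)) → j ∈ map f (nth Ms k) → colour Ms j ≡ k
    colour-nth (M ∷ Ms) k {j} uniq j∈ with j ∈? map f M | k
    ... | yes _   | zero   = refl
    ... | no ¬j∈  | zero   = contradiction j∈ ¬j∈
    ... | yes j∈M | suc k′ = contradiction (nth⊆concat Ms k′ j∈) (disjoint (map f M) (subst Unique (map-++ f M (concat Ms)) uniq) j∈M)
      where
      disjoint : ∀ xs {ys} {j : Fin n} → Unique (xs ++ ys) → j ∈ xs → j ∉ ys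
      disjoint (x ∷ xs) (x∉ ∷ _)    (here refl) j∈ys = contradiction refl (All.lookup x∉ (∈-++⁺ʳ xs j∈ys))
      disjoint (x ∷ xs) (_ ∷ uniq) (there j∈)  j∈ys = disjoint xs uniq j∈ j∈ys
    ... | no _    | suc k′ = cong suc (colour-nth Ms k′ (suffix (map f M) (subst Unique (map-++ f M (concat Ms)) uniq)) j∈)
      where
      suffix : ∀ xs {ys : List (Fin n)} → Unique (xs ++ ys) → Unique ys
      suffix []       uniq       = uniq
      suffix (x ∷ xs) (_ ∷ uniq) = suffix xs uniq

  allFin-sorted : ∀ n → AllPairs Fin._<_ (allFin n)
  allFin-sorted n = AllPairsₚ.tabulate⁺-< λ i<j → i<j

  -- A pattern depends on its entries only through the comparisons between them.
  patternOf-map : (g h : A → ℕ) (xs : List A) →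
    (∀ {x y} → x ∈ xs → y ∈ xs → (g x ≤ g y → h x ≤ h y) × (h x ≤ h y → g x ≤ g y)) →
    map g xs ∼ map h xs
  patternOf-map {A} g h xs iff = begin
    patternOf (map g xs)                                          ≡⟨ map-∘ xs ⟨
    map (λ x → length (filter (_≤? g x) (map g xs))) xs           ≡⟨ map-cong-local (All.tabulate rank) ⟩
    map (λ x → length (filter (_≤? h x) (map h xs))) xs           ≡⟨ map-∘ xs ⟩
    patternOf (map h xs)                                          ∎
    where
    open ≡-Reasoning
    ranks : ∀ a b ys → (∀ {y} → y ∈ ys → (g y ≤ a → h y ≤ b) × (h y ≤ b → g y ≤ a)) →
      length (filter (_≤? a) (map g ys)) ≡ length (filter (_≤? b) (map h ys))
    ranks a b []       _    = refl
    ranks a b (y ∷ ys) iff with g y ≤? a | h y ≤? b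
    ... | yes p | yes q = trans (cong length (filter-accept (_≤? a) p)) (trans (cong suc (ranks a b ys (iff ∘ there)))
                            (cong length (sym (filter-accept (_≤? b) q))))
    ... | no ¬p | no ¬q = trans (cong length (filter-reject (_≤? a) ¬p)) (trans (ranks a b ys (iff ∘ there))
                            (cong length (sym (filter-reject (_≤? b) ¬q))))
    ... | yes p | no ¬q = contradiction (proj₁ (iff (here refl)) p) ¬q
    ... | no ¬p | yes q = contradiction (proj₂ (iff (here refl)) q) ¬p
    rank : ∀ {x} → x ∈ xs → length (filter (_≤? g x) (map g xs)) ≡ length (filter (_≤? h x) (map h xs))
    rank x∈ = ranks _ _ xs λ y∈ → iff y∈ x∈

  AllPairs-lookup : {R : Rel A 0ℓ} → Symmetric R → ∀ {xs x y} → AllPairs R xs → x ∈ xs → y ∈ xs → x ≡ y ⊎ R x y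
  AllPairs-lookup R-sym (px ∷ pxs) (here refl) (here refl) = inj₁ refl
  AllPairs-lookup R-sym (px ∷ pxs) (here refl) (there y∈)  = inj₂ (All.lookup px y∈)
  AllPairs-lookup R-sym (px ∷ pxs) (there x∈)  (here refl) = inj₂ (R-sym (All.lookup px x∈))
  AllPairs-lookup R-sym (px ∷ pxs) (there x∈)  (there y∈)  = AllPairs-lookup R-sym pxs x∈ y∈

  module _ {σ π : Permutation′ n} {k : ℕ} (m : Matching σ π (allFin n) (allFin n) k) where
    private
      Ms = classes m
      ℓ = length Ms

      covered : (f : Fin n × Fin n → Fin n) → allFin n ↭ map f (concat Ms) → ∀ j → j ∈ map f (concat Ms)
      covered f p j = ∈-resp-↭ p (∈-allFin j)

      colouring : (f : Fin n × Fin n → Fin n) → allFin n ↭ map f (concat Ms) → Vec.Vec (Fin ℓ) n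
      colouring f p = Vec.tabulate λ j → fromℕ< (colour-< f Ms (covered f p j))

      class : (f : Fin n × Fin n → Fin n) → ℕ → List (Fin n)
      class f t = filter (λ j → colour f Ms j ≟ t) (allFin n)

      subsequence-class : ∀ f p τ i → subsequence τ (colouring f p) i ≡ map (value τ) (class f (toℕ i))
      subsequence-class f p τ i = cong (map (value τ)) (filter-≐ _ _
        ( (λ {j} eq → trans (sym (toℕ-colour j)) (cong toℕ eq))
        , (λ {j} eq → Finₚ.toℕ-injective (trans (toℕ-colour j) eq)) ) (allFin n))
        where
        toℕ-colour : ∀ j → toℕ (lookup (colouring f p) j) ≡ colour f Ms j
        toℕ-colour j = trans (cong toℕ (lookup∘tabulate (λ j → fromℕ< (colour-< f Ms (covered f p j))) j)) (Finₚ.toℕ-fromℕ< (colour-< f Ms (covered f p j)))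

      class⊆ : ∀ f (p : allFin n ↭ map f (concat Ms)) t {j} → j ∈ class f t → j ∈ map f (nth Ms t)
      class⊆ f p t {j} j∈ = subst (λ t → j ∈ map f (nth Ms t))
        (proj₂ (∈-filter⁻ (λ j → colour f Ms j ≟ t) {xs = allFin n} j∈)) (∈-colour f Ms (covered f p j))

      ⊆class : ∀ f (p : allFin n ↭ map f (concat Ms)) t {j} → j ∈ map f (nth Ms t) → j ∈ class f t
      ⊆class f p t {j} j∈ = ∈-filter⁺ (λ j → colour f Ms j ≟ t) (∈-allFin j)
        (colour-nth f Ms t (Unique-resp-↭ p (allFin⁺ n)) j∈)

      class-sorted : ∀ f t → AllPairs Fin._<_ (class f t)
      class-sorted f t = AllPairsₚ.filter⁺ (λ j → colour f Ms j ≟ t) (allFin-sorted n)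

      -- A subsequence lists its positions in increasing order, whereas a class is unordered.
      -- Reordering the class by the positions in `σ` also sorts the positions in `π`, since the
      -- pairs agree on positions; agreement on values then gives equal patterns.
      classes∼ : ∀ t → map (value σ) (class proj₁ t) ∼ map (value π) (class proj₂ t)
      classes∼ t = trans (cong (λ xs → patternOf (map (value σ) xs)) class₁≡) (trans
        (trans (cong patternOf (sym (map-∘ M′))) (trans (patternOf-map (value σ ∘ proj₁) (value π ∘ proj₂) M′ iff) (cong patternOf (map-∘ M′))))
        (cong (λ xs → patternOf (map (value π) xs)) (sym class₂≡)))
        where
        M = nth Ms t
        M-agree : AllPairs (Agree σ π) M
        M-agree = nth-All [] (agree m) t
        SameOrder-≢ : ∀ {i j : Fin n} {b b′} → SameOrder (toℕ i , b) (toℕ j , b′) → i ≡ j → ⊥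
        SameOrder-≢ (inj₁ (lt , _)) refl = <-irrefl refl lt
        SameOrder-≢ (inj₂ (lt , _)) refl = <-irrefl refl lt
        M!₁ : Unique (map proj₁ M)
        M!₁ = AllPairsₚ.map⁺ (AllPairs.map (λ (p , _) → SameOrder-≢ p) M-agree)
        reorder : ∃ λ M′ → class proj₁ t ≡ map proj₁ M′ × M ↭ M′
        reorder = ↭-map-inv proj₁ (unique⇒↭
          (AllPairs.map (λ lt eq → <-irrefl (cong toℕ eq) lt) (class-sorted proj₁ t)) M!₁
          (class⊆ proj₁ (left m) t) (⊆class proj₁ (left m) t))
        M′ = proj₁ reorder
        class₁≡ = proj₁ (proj₂ reorder)
        M↭M′ = proj₂ (proj₂ reorder)
        M′-agree : AllPairs (Agree σ π) M′
        M′-agree = AllPairs-resp-↭ (λ {x} {y} → Agree-sym {σ = σ} {π} {x} {y}) M↭M′ M-agree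
        sorted₂ : AllPairs Fin._<_ (map proj₂ M′)
        sorted₂ = AllPairsₚ.map⁺ (AllPairs.map follow
          (AllPairs.zip (M′-agree , AllPairsₚ.map⁻ (subst (AllPairs Fin._<_) class₁≡ (class-sorted proj₁ t)))))
          where
          follow : ∀ {a b : Fin n × Fin n} → Agree σ π a b × proj₁ a Fin.< proj₁ b → proj₂ a Fin.< proj₂ b
          follow ((inj₁ (_ , lt) , _) , _)  = lt
          follow ((inj₂ (gt , _) , _) , lt) = contradiction lt (<-asym gt)
        class₂≡ : class proj₂ t ≡ map proj₂ M′
        class₂≡ = <-sorted-≡ (class-sorted proj₂ t) sorted₂
          (λ j∈ → ∈-resp-↭ (Perm.map⁺ proj₂ M↭M′) (class⊆ proj₂ (right m) t j∈))
          (λ j∈ → ⊆class proj₂ (right m) t (∈-resp-↭ (Perm.map⁺ proj₂ (↭-sym M↭M′)) j∈))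
        iff : ∀ {a b} → a ∈ M′ → b ∈ M′ →
          (value σ (proj₁ a) ≤ value σ (proj₁ b) → value π (proj₂ a) ≤ value π (proj₂ b)) ×
          (value π (proj₂ a) ≤ value π (proj₂ b) → value σ (proj₁ a) ≤ value σ (proj₁ b))
        iff a∈ b∈ with AllPairs-lookup (λ {x} {y} → Agree-sym {σ = σ} {π} {x} {y}) M′-agree a∈ b∈
        ... | inj₁ refl = (λ _ → ≤-refl) , (λ _ → ≤-refl)
        ... | inj₂ (_ , inj₁ (lt , lt′)) = (λ _ → <⇒≤ lt′) , (λ _ → <⇒≤ lt)
        ... | inj₂ (_ , inj₂ (gt , gt′)) = (λ le → contradiction le (<⇒≱ gt)) , (λ le → contradiction le (<⇒≱ gt′))

    Matching⇒Similar : Similar ℓ σ π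
    Matching⇒Similar = colouring proj₁ (left m) , colouring proj₂ (right m) , λ i →
      trans (cong patternOf (subsequence-class proj₁ (left m) σ i)) (trans (classes∼ (toℕ i))
        (cong patternOf (sym (subsequence-class proj₂ (right m) π i))))

    U≤matching : U σ π ≤ k
    U≤matching = ≤-trans (proj₂ (proj₂ (least (λ ℓ → Similar? ℓ σ π) n (similar-n σ π))) ℓ Matching⇒Similar) (size m)

  U≤n : ∀ (σ π : Permutation′ n) → U σ π ≤ n
  U≤n {n} σ π = proj₂ (proj₂ (least (λ ℓ → Similar? ℓ σ π) n (similar-n σ π))) n (similar-n σ π)

-- Displacements between grid cells and the greedy choice of common patterns.

module Grids where
  open import Data.Bool.Base using (Bool; false; T; _∧_; _∨_)
  open import Data.Bool.Properties using (T-∧; T-∨)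
  open import Data.Fin.Base as Fin using (Fin; zero; suc; toℕ)
  open import Data.Fin.Permutation using (Permutation′; _⟨$⟩ʳ_)
  import Data.Fin.Properties as Finₚ
  open import Data.List.Base using (List; []; _∷_; map; length; filter; cartesianProduct; _++_)
  open import Data.List.Properties using (length-++; length-map)
  open import Data.List.Membership.Propositional using (_∈_)
  open import Data.List.Membership.Propositional.Properties
    using (∈-filter⁻; ∈-map⁻; ∈-++⁺ʳ; ∈-cartesianProduct⁻)
  open import Data.List.Relation.Binary.Permutation.Propositional using (_↭_; ↭-refl; ↭-sym; ↭-trans)
  open import Data.List.Relation.Binary.Permutation.Propositional.Properties as Perm using (∈-resp-↭; ↭-length)
  open import Data.List.Relation.Unary.All as All using (All; []; _∷_)
  open import Data.List.Relation.Unary.AllPairs as AllPairs using (AllPairs; []; _∷_)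
  import Data.List.Relation.Unary.AllPairs.Properties as AllPairsₚ
  open import Data.List.Relation.Unary.Any using (here; there)
  open import Data.List.Relation.Unary.Unique.Propositional using (Unique)
  import Data.List.Relation.Unary.Unique.Propositional.Properties as Uniqueₚ
  open import Data.Nat.Base
  open import Data.Nat.DivMod using (_/_; _%_; m<n*o⇒m/o<n; /-monoˡ-≤; m/n*n≤m; m≡m%n+[m/n]*n; m%n<n)
  open import Data.Nat.Properties
  open import Data.Nat.Tactic.RingSolver using (solve-∀)
  open import Data.Product.Base using (∃; ∃₂; _×_; _,_; proj₁; proj₂)
  open import Data.Sum.Base using (_⊎_; inj₁; inj₂; [_,_]′)
  open import Function.Base using (_∘_; flip)
  open import Function.Bundles using (Equivalence)
  open import Relation.Binary.Core using (Rel)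
  open import Relation.Binary.Definitions using (tri<; tri≈; tri>) renaming (Decidable to Decidable₂)
  open import Relation.Binary.PropositionalEquality
    using (_≡_; _≢_; refl; sym; trans; cong; cong₂; subst)
  open import Relation.Nullary using (¬_; yes; no; contradiction)
  open import Relation.Nullary.Decidable using (_×-dec_; _⊎-dec_)
  open import Relation.Unary using (Pred; Decidable)
  open import Level using (0ℓ)
  open import Defs using (length-cartesianProductWith)
  open Moments
  open Lists
  open CommonPatterns

  ∧⁺ : ∀ {a b} → T a → T b → T (a ∧ b)
  ∧⁺ p q = Equivalence.from T-∧ (p , q)

  anyFin : ∀ {n} → (Fin n → Bool) → Bool
  anyFin {zero}  P = false
  anyFin {suc n} P = P zero ∨ anyFin (P ∘ suc)

  anyFin⁺ : ∀ {n} (P : Fin n → Bool) i → T (P i) → T (anyFin P)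
  anyFin⁺ P zero    p = Equivalence.from (T-∨ {P zero}) (inj₁ p)
  anyFin⁺ P (suc i) p = Equivalence.from (T-∨ {P zero}) (inj₂ (anyFin⁺ (P ∘ suc) i p))

  quotient-window : ∀ w .{{_ : NonZero w}} s x → s ≤ x → s + (x ∸ s) / w * w ≤ x × x < s + (x ∸ s) / w * w + w
  quotient-window w s x s≤x = lower , upper
    where
    open ≤-Reasoning
    d = x ∸ s
    lower : s + d / w * w ≤ x
    lower = begin
      s + d / w * w             ≤⟨ +-monoʳ-≤ s (m/n*n≤m d w) ⟩
      s + d                     ≡⟨ m+[n∸m]≡n s≤x ⟩
      x                         ∎
    upper : x < s + d / w * w + w
    upper = begin-strict
      x                         ≡⟨ m+[n∸m]≡n s≤x ⟨
      s + d                     ≡⟨ cong (s +_) (m≡m%n+[m/n]*n d w) ⟩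
      s + (d % w + d / w * w)   <⟨ +-monoʳ-< s (+-monoˡ-< (d / w * w) (m%n<n d w)) ⟩
      s + (w + d / w * w)       ≡⟨ cong (s +_) (+-comm w (d / w * w)) ⟩
      s + (d / w * w + w)       ≡⟨ +-assoc s (d / w * w) w ⟨
      s + d / w * w + w         ∎

  -- A grid has m rows of w consecutive positions, counted from a starting point s, and m columns of
  -- b consecutive values.  p, h and K bound the cell multiplicities, the degrees and the indices.
  record Grid : Set where
    field
      w b m p h K : ℕ
      {{w≢0}} : NonZero w
      {{b≢0}} : NonZero b
      {{m≢0}} : NonZero m

  module GridSets {n : ℕ} (G : Grid) where
    open Grid G

    window : ℕ → ℕ → Fin n → Bool
    window s k i = (s ≤ᵇ toℕ i) ∧ (toℕ i <ᵇ s + k)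

    block : ℕ → Fin n → Bool
    block v u = toℕ u / b ≡ᵇ v

    -- A displacement from `q` to `r` is coded as the natural number `t` with `q + t = r + m`. For
    -- fixed `π` this is a fixed set of values, so the number of times a window of `σ` hits it is
    -- covered by the tail bounds.
    rowTarget : Permutation′ n → ℕ → ℕ → Fin n → Bool
    rowTarget π s′ t u = anyFin λ y → window s′ w y ∧ (toℕ u / b + t ≡ᵇ value π y / b + m)

    -- The counterpart of `rowTarget` with positions and values exchanged. A column meets all `m`
    -- rows, hence the window of length `w * m`.
    columnSource : Permutation′ n → ℕ → ℕ → ℕ → ℕ → Fin n → Bool
    columnSource π s s′ v′ t x = anyFin λ y →
      (window s′ (w * m) y ∧ block v′ (π ⟨$⟩ʳ y)) ∧ ((s ≤ᵇ toℕ x) ∧ ((toℕ x ∸ s) / w + t ≡ᵇ (toℕ y ∸ s′) / w + m))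

    rowTarget⁺ : ∀ π s′ t u y → T (window s′ w y) → toℕ u / b + t ≡ value π y / b + m → T (rowTarget π s′ t u)
    rowTarget⁺ π s′ t u y in-row eq =
      anyFin⁺ (λ y → window s′ w y ∧ (toℕ u / b + t ≡ᵇ value π y / b + m)) y
        (∧⁺ {window s′ w y} in-row (≡⇒≡ᵇ (toℕ u / b + t) (value π y / b + m) eq))

    columnSource⁺ : ∀ π s s′ v′ t x y → s ≤ toℕ x → s′ ≤ toℕ y × toℕ y < s′ + w * m → value π y / b ≡ v′ →
      (toℕ x ∸ s) / w + t ≡ (toℕ y ∸ s′) / w + m → T (columnSource π s s′ v′ t x)
    columnSource⁺ π s s′ v′ t x y s≤x (s′≤y , y<) eq-v eq-row =
      anyFin⁺ (λ y → (window s′ (w * m) y ∧ block v′ (π ⟨$⟩ʳ y)) ∧ ((s ≤ᵇ toℕ x) ∧ ((toℕ x ∸ s) / w + t ≡ᵇ (toℕ y ∸ s′) / w + m))) y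
        (∧⁺ {window s′ (w * m) y ∧ block v′ (π ⟨$⟩ʳ y)}
          (∧⁺ {window s′ (w * m) y} (∧⁺ {s′ ≤ᵇ toℕ y} (≤⇒≤ᵇ s′≤y) (<⇒<ᵇ y<)) (≡⇒≡ᵇ (value π y / b) v′ eq-v))
          (∧⁺ {s ≤ᵇ toℕ x} (≤⇒≤ᵇ s≤x) (≡⇒≡ᵇ ((toℕ x ∸ s) / w + t) ((toℕ y ∸ s′) / w + m) eq-row)))

    -- Given a displacement t, rows and columns bound the number of pairs of points x of σ and
    -- y of π with this displacement and with x in a given row or column.
    record Spread (σ π : Permutation′ n) : Set where
      field
        cells   : ∀ s v → s < K → v < K → hits (window s w) (block v) π < p
        rows    : ∀ s s′ t → s < K → s′ < K → t < K → hits (window s w) (rowTarget π s′ t) σ < h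
        columns : ∀ s s′ v v′ t → s < K → s′ < K → v < K → v′ < K → t < K →
                  hits (columnSource π s s′ v′ t) (block v) σ < h

  length-filter-⊎ : {A : Set} {P Q : Pred A 0ℓ} (P? : Decidable P) (Q? : Decidable Q) (xs : List A) →
    length (filter (λ x → P? x ⊎-dec Q? x) xs) ≤ length (filter P? xs) + length (filter Q? xs)
  length-filter-⊎ P? Q? []       = z≤n
  length-filter-⊎ P? Q? (x ∷ xs) with P? x | Q? x
  ... | yes _ | yes _ = s≤s (≤-trans (length-filter-⊎ P? Q? xs) (+-monoʳ-≤ _ (n≤1+n _)))
  ... | yes _ | no  _ = s≤s (length-filter-⊎ P? Q? xs)
  ... | no  _ | yes _ = ≤-trans (s≤s (length-filter-⊎ P? Q? xs)) (≤-reflexive (sym (+-suc _ _)))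
  ... | no  _ | no  _ = length-filter-⊎ P? Q? xs

  Unique-++⁻ʳ : {A : Set} (xs : List A) {ys : List A} → Unique (xs ++ ys) → Unique ys
  Unique-++⁻ʳ []       uniq       = uniq
  Unique-++⁻ʳ (x ∷ xs) (_ ∷ uniq) = Unique-++⁻ʳ xs uniq

  -- A common displacement makes `q < q′` equivalent to `r < r′`, so distinct indices order the two
  -- coordinates alike.
  sameOrder : ∀ {x y x′ y′ q r q′ r′ t m} → q + t ≡ r + m → q′ + t ≡ r′ + m → q ≢ q′ →
    (q < q′ → x < x′) → (q′ < q → x′ < x) → (r < r′ → y < y′) → (r′ < r → y′ < y) →
    SameOrder (x , y) (x′ , y′)
  sameOrder {q = q} {r} {q′} {r′} {t} {m} eq eq′ q≢q′ xs xs′ ys ys′ with <-cmp q q′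
  ... | tri< lt _ _ = inj₁ (xs lt , ys (+-cancelʳ-< m r r′ (≤-trans (≤-reflexive (cong suc (sym eq))) (≤-trans (+-monoˡ-< t lt) (≤-reflexive eq′)))))
  ... | tri≈ _ e _  = contradiction e q≢q′
  ... | tri> _ _ gt = inj₂ (xs′ gt , ys′ (+-cancelʳ-< m r′ r (≤-trans (≤-reflexive (cong suc (sym eq′))) (≤-trans (+-monoˡ-< t gt) (≤-reflexive eq)))))

  module GreedyStep {n : ℕ} (G : Grid) where
    open Grid G
    open GridSets {n} G

    Within : ℕ → List (Fin n) → Set
    Within s xs = ∀ {x} → x ∈ xs → s ≤ toℕ x × toℕ x < s + w * m

    module _ {σ π : Permutation′ n} (spread : Spread σ π) (n≤mb : n ≤ m * b) (n≤K : n ≤ K) (2m≤K : 2 * m ≤ K)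
             {s s′ : ℕ} where
      open Spread spread

      private
        row : ℕ → Fin n → ℕ
        row s x = (toℕ x ∸ s) / w

        column : Permutation′ n → Fin n → ℕ
        column τ x = value τ x / b

        row-< : ∀ {s x x′} → row s x < row s x′ → toℕ x < toℕ x′
        row-< {s} lt = ≰⇒> λ ge → <⇒≱ lt (/-monoˡ-≤ w (∸-monoˡ-≤ s ge))

        column-< : ∀ {τ x x′} → column τ x < column τ x′ → value τ x < value τ x′
        column-< lt = ≰⇒> λ ge → <⇒≱ lt (/-monoˡ-≤ b ge)

        row<m : ∀ {s x} → toℕ x < s + w * m → row s x < m
        row<m {s} {x} lt = m<n*o⇒m/o<n {n = m} {o = w}
          (m<n+o⇒m∸n<o (toℕ x) s {{m*n≢0 m w}} (≤-trans lt (≤-reflexive (cong (s +_) (*-comm w m)))))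

        column<m : ∀ τ x → column τ x < m
        column<m τ x = m<n*o⇒m/o<n {n = m} {o = b} (≤-trans (Finₚ.toℕ<n (τ ⟨$⟩ʳ x)) n≤mb)

        column<K : ∀ τ x → column τ x < K
        column<K τ x = ≤-trans (column<m τ x) (≤-trans (m≤m+n m _) 2m≤K)

        -- Every row of a grid with any starting point `s` is one of the windows that `Spread`
        -- controls; its start is at most `toℕ x`, hence below `K`.
        in-window : ∀ s (x : Fin n) → s ≤ toℕ x → T (window (s + row s x * w) w x) × s + row s x * w < K
        in-window s x s≤x =
          let (lower , upper) = quotient-window w s (toℕ x) s≤x
          in ∧⁺ {s + row s x * w ≤ᵇ toℕ x} (≤⇒≤ᵇ lower) (<⇒<ᵇ upper) , ≤-trans (s≤s lower) (≤-trans (Finₚ.toℕ<n x) n≤K)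

        SameCell : Rel (Fin n) 0ℓ
        SameCell y y′ = row s′ y ≡ row s′ y′ × column π y ≡ column π y′

        SameCell? : Decidable₂ SameCell
        SameCell? y y′ = (row s′ y ≟ row s′ y′) ×-dec (column π y ≟ column π y′)

        Pair = Fin n × Fin n

        -- Comparing the points of `σ` is enough: among pairs of equal displacement, the points of
        -- `π` share a row or column exactly when those of `σ` do.
        Conflict : Rel Pair 0ℓ
        Conflict (x , _) (x′ , _) = row s x ≡ row s x′ ⊎ column σ x ≡ column σ x′

        rowConflict? : Decidable₂ (λ (a a′ : Pair) → row s (proj₁ a) ≡ row s (proj₁ a′))
        rowConflict? (x , _) (x′ , _) = row s x ≟ row s x′

        columnConflict? : Decidable₂ (λ (a a′ : Pair) → column σ (proj₁ a) ≡ column σ (proj₁ a′))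
        columnConflict? (x , _) (x′ , _) = column σ x ≟ column σ x′

        Conflict? : Decidable₂ Conflict
        Conflict? a a′ = rowConflict? a a′ ⊎-dec columnConflict? a a′

      private
        common-pattern : ∀ {xs ys} → Unique xs → Unique ys → Within s xs → Within s′ ys →
          ∃ λ M → AllPairs (Agree σ π) M × (∀ {a} → a ∈ M → proj₁ a ∈ xs × proj₂ a ∈ ys) ×
                  length xs * length ys ≤ p * (2 * m * (2 * m * ((h + h) * length M)))
        common-pattern {xs} {ys} xs! ys! xs-in ys-in =
          M , M-agree , (λ a∈ → let (x∈ , y∈) = shifted⊆ (M⊆ a∈) in x∈ , reps⊆ y∈) , bound
          where
          cell-small : ∀ y → y ∈ ys → length (filter (SameCell? y) ys) ≤ p
          cell-small y y∈ = ≤-trans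
            (unique-length≤count (λ z → window (s′ + row s′ y * w) w z ∧ block (column π y) (π ⟨$⟩ʳ z))
              (Uniqueₚ.filter⁺ (SameCell? y) ys!) λ {z} z∈ →
                let (z∈ys , (same-row , same-column)) = ∈-filter⁻ (SameCell? y) {xs = ys} z∈
                in ∧⁺ (subst (λ r → T (window (s′ + r * w) w z)) (sym same-row) (proj₁ (in-window s′ z (proj₁ (ys-in z∈ys)))))
                      (≡⇒≡ᵇ (column π z) (column π y) (sym same-column)))
            (<⇒≤ (cells (s′ + row s′ y * w) (column π y) (proj₂ (in-window s′ y (proj₁ (ys-in y∈)))) (column<K π y)))

          -- Keeping one point of `ys` per cell costs a factor `p`. Afterwards `x` and the
          -- displacement determine `y`, so conflicts can be counted by the points `x` of `σ` alone.
          distinct = greedy-independent SameCell? (λ _ → refl , refl) p ys cell-small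
          reps = proj₁ distinct
          reps⊆ = λ {y} → proj₁ (proj₂ distinct) {y}
          reps-cells : AllPairs (λ y y′ → ¬ SameCell y y′) reps
          reps-cells = proj₁ (proj₂ (proj₂ distinct))
          reps! : Unique reps
          reps! = AllPairs.map (λ ¬same → λ { refl → ¬same (refl , refl) }) reps-cells

          key₁ key₂ : Pair → ℕ
          key₁ (x , y) = row s′ y + m ∸ row s x
          key₂ (x , y) = column π y + m ∸ column σ x

          key-< : ∀ {q r} → r < m → r + m ∸ q < 2 * m
          key-< {q} {r} r<m = begin-strict
            r + m ∸ q    ≤⟨ m∸n≤m (r + m) q ⟩
            r + m        <⟨ +-monoˡ-< m r<m ⟩
            m + m        ≡⟨ cong (m +_) (sym (+-identityʳ m)) ⟩
            2 * m        ∎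
            where open ≤-Reasoning

          displacement : ∀ {q r t} → q < m → r + m ∸ q ≡ t → q + t ≡ r + m
          displacement {q} {r} q<m refl = m+[n∸m]≡n (≤-trans (<⇒≤ q<m) (m≤n+m m r))

          pairs = cartesianProduct xs reps
          instance 2m≢0 = m*n≢0 2 m
          popular₁ = pigeonhole key₁ (2 * m) pairs λ {a} a∈ →
            key-< {row s (proj₁ a)} (row<m {s′} (proj₂ (ys-in (reps⊆ (proj₂ (∈-cartesianProduct⁻ xs reps a∈))))))
          t₁ = proj₁ popular₁
          pairs₁ = filter (λ a → key₁ a ≟ t₁) pairs
          popular₂ = pigeonhole key₂ (2 * m) pairs₁ λ {a} _ → key-< {column σ (proj₁ a)} (column<m π (proj₂ a))
          t₂ = proj₁ popular₂
          shifted = filter (λ a → key₂ a ≟ t₂) pairs₁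

          shifted! : Unique shifted
          shifted! = Uniqueₚ.filter⁺ (λ a → key₂ a ≟ t₂) (Uniqueₚ.filter⁺ (λ a → key₁ a ≟ t₁) (Uniqueₚ.cartesianProduct⁺ xs! reps!))

          shifted⊆ : ∀ {a} → a ∈ shifted → proj₁ a ∈ xs × proj₂ a ∈ reps
          shifted⊆ a∈ = ∈-cartesianProduct⁻ xs reps (proj₁ (∈-filter⁻ (λ a → key₁ a ≟ t₁) {xs = pairs}
            (proj₁ (∈-filter⁻ (λ a → key₂ a ≟ t₂) {xs = pairs₁} a∈))))

          row-shift : ∀ {a} → a ∈ shifted → row s (proj₁ a) + t₁ ≡ row s′ (proj₂ a) + m
          row-shift {a} a∈ = displacement (row<m {s} (proj₂ (xs-in (proj₁ (shifted⊆ a∈)))))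
            (proj₂ (∈-filter⁻ (λ a → key₁ a ≟ t₁) {xs = pairs} (proj₁ (∈-filter⁻ (λ a → key₂ a ≟ t₂) {xs = pairs₁} a∈))))

          column-shift : ∀ {a} → a ∈ shifted → column σ (proj₁ a) + t₂ ≡ column π (proj₂ a) + m
          column-shift {a} a∈ = displacement (column<m σ (proj₁ a)) (proj₂ (∈-filter⁻ (λ a → key₂ a ≟ t₂) {xs = pairs₁} a∈))

          shifted-injective : ∀ {a a′} → a ∈ shifted → a′ ∈ shifted → proj₁ a ≡ proj₁ a′ → a ≡ a′
          shifted-injective {x , y} {x′ , y′} a∈ a′∈ eq = cong₂ _,_ eq
            ([ (λ y≡ → y≡) , (λ ¬same → contradiction (same-row , same-column) ¬same) ]′
              (AllPairs-lookup (λ ¬same (r , c) → ¬same (sym r , sym c)) reps-cells (proj₂ (shifted⊆ a∈)) (proj₂ (shifted⊆ a′∈))))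
            where
            same-row : row s′ y ≡ row s′ y′
            same-row = +-cancelʳ-≡ m _ _ (trans (sym (row-shift a∈)) (trans (cong (λ x → row s x + t₁) eq) (row-shift a′∈)))
            same-column : column π y ≡ column π y′
            same-column = +-cancelʳ-≡ m _ _ (trans (sym (column-shift a∈)) (trans (cong (λ x → column σ x + t₂) eq) (column-shift a′∈)))

          conflicts≤count : {R : Pred Pair 0ℓ} (R? : Decidable R) (E Z : Fin n → Bool) →
            (∀ {a} → a ∈ shifted → R a → T (E (proj₁ a)) × T (Z (σ ⟨$⟩ʳ proj₁ a))) →
            length (filter R? shifted) ≤ hits E Z σ
          conflicts≤count R? E Z inside = ≤-trans (≤-reflexive (sym (length-map proj₁ (filter R? shifted))))
            (unique-length≤count _
              (unique-map proj₁ (Uniqueₚ.filter⁺ R? shifted!) λ a∈ a′∈ →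
                shifted-injective (proj₁ (∈-filter⁻ R? {xs = shifted} a∈)) (proj₁ (∈-filter⁻ R? {xs = shifted} a′∈)))
              λ x∈ → let (a , a∈ , eq) = ∈-map⁻ proj₁ x∈
                         (a∈shifted , Ra) = ∈-filter⁻ R? {xs = shifted} a∈
                         (e , z) = inside a∈shifted Ra
                     in subst (λ x → T (E x ∧ Z (σ ⟨$⟩ʳ x))) (sym eq) (∧⁺ e z))

          -- Pairs in the row of `x₀` have, by their common displacement, their second points in the
          -- row of `y₀`. Their first points thus lie in one window with values in one `rowTarget`.
          row-degree : ∀ a → a ∈ shifted → length (filter (rowConflict? a) shifted) ≤ h
          row-degree (x₀ , y₀) a₀∈ = ≤-trans
            (conflicts≤count (rowConflict? (x₀ , y₀)) (window S w) (rowTarget π S′ t₂) inside)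
            (<⇒≤ (rows S S′ t₂ (proj₂ (in-window s x₀ s≤x₀)) (proj₂ (in-window s′ y₀ s′≤y₀))
              (≤-trans (proj₁ (proj₂ popular₂)) 2m≤K)))
            where
            s≤x₀ = proj₁ (xs-in (proj₁ (shifted⊆ a₀∈)))
            s′≤y₀ = proj₁ (ys-in (reps⊆ (proj₂ (shifted⊆ a₀∈))))
            S = s + row s x₀ * w
            S′ = s′ + row s′ y₀ * w
            inside : ∀ {a} → a ∈ shifted → row s x₀ ≡ row s (proj₁ a) →
              T (window S w (proj₁ a)) × T (rowTarget π S′ t₂ (σ ⟨$⟩ʳ proj₁ a))
            inside {x , y} a∈ eq =
              subst (λ r → T (window (s + r * w) w x)) (sym eq) (proj₁ (in-window s x (proj₁ (xs-in (proj₁ (shifted⊆ a∈)))))) ,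
              rowTarget⁺ π S′ t₂ (σ ⟨$⟩ʳ x) y
                (subst (λ r → T (window (s′ + r * w) w y)) (sym eq′) (proj₁ (in-window s′ y (proj₁ (ys-in (reps⊆ (proj₂ (shifted⊆ a∈))))))))
                (column-shift a∈)
              where
              eq′ : row s′ y₀ ≡ row s′ y
              eq′ = +-cancelʳ-≡ m _ _ (trans (sym (row-shift a₀∈)) (trans (cong (_+ t₁) eq) (row-shift a∈)))

          -- Pairs in the column of `x₀` have their second points in the column of `y₀`, though in
          -- any of the `m` rows.
          column-degree : ∀ a → a ∈ shifted → length (filter (columnConflict? a) shifted) ≤ h
          column-degree (x₀ , y₀) a₀∈ = ≤-trans
            (conflicts≤count (columnConflict? (x₀ , y₀)) (columnSource π s s′ V′ t₁) (block V) inside)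
            (<⇒≤ (columns s s′ V V′ t₁ (below s≤x₀) (below s′≤y₀) (column<K σ x₀) (column<K π y₀)
              (≤-trans (proj₁ (proj₂ popular₁)) 2m≤K)))
            where
            s≤x₀ = proj₁ (xs-in (proj₁ (shifted⊆ a₀∈)))
            s′≤y₀ = proj₁ (ys-in (reps⊆ (proj₂ (shifted⊆ a₀∈))))
            below : ∀ {s} {x : Fin n} → s ≤ toℕ x → s < K
            below {x = x} s≤x = ≤-trans (s≤s s≤x) (≤-trans (Finₚ.toℕ<n x) n≤K)
            V = column σ x₀
            V′ = column π y₀
            inside : ∀ {a} → a ∈ shifted → column σ x₀ ≡ column σ (proj₁ a) →
              T (columnSource π s s′ V′ t₁ (proj₁ a)) × T (block V (σ ⟨$⟩ʳ proj₁ a))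
            inside {x , y} a∈ eq =
              columnSource⁺ π s s′ V′ t₁ x y (proj₁ (xs-in (proj₁ (shifted⊆ a∈))))
                (ys-in (reps⊆ (proj₂ (shifted⊆ a∈)))) (sym eq′) (row-shift a∈) ,
              ≡⇒≡ᵇ (column σ x) V (sym eq)
              where
              eq′ : column π y₀ ≡ column π y
              eq′ = +-cancelʳ-≡ m _ _ (trans (sym (column-shift a₀∈)) (trans (cong (_+ t₂) eq) (column-shift a∈)))

          independent = greedy-independent Conflict? (λ _ → inj₁ refl) (h + h) shifted λ a a∈ →
            ≤-trans (length-filter-⊎ (rowConflict? a) (columnConflict? a) shifted)
                    (+-mono-≤ (row-degree a a∈) (column-degree a a∈))
          M = proj₁ independent
          M⊆ = λ {a} → proj₁ (proj₂ independent) {a}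

          agreeing : ∀ {a a′} → a ∈ shifted → a′ ∈ shifted → ¬ Conflict a a′ → Agree σ π a a′
          agreeing {x , y} {x′ , y′} a∈ a′∈ free =
            sameOrder (row-shift a∈) (row-shift a′∈) (free ∘ inj₁) (row-< {s} {x} {x′}) (row-< {s} {x′} {x}) (row-< {s′} {y} {y′}) (row-< {s′} {y′} {y}) ,
            sameOrder (column-shift a∈) (column-shift a′∈) (free ∘ inj₂) (column-< {σ} {x} {x′}) (column-< {σ} {x′} {x}) (column-< {π} {y} {y′}) (column-< {π} {y′} {y})

          M-agree : AllPairs (Agree σ π) M
          M-agree = go (λ a∈ → M⊆ a∈) (proj₁ (proj₂ (proj₂ independent)))
            where
            go : ∀ {N} → (∀ {a} → a ∈ N → a ∈ shifted) → AllPairs (λ a a′ → ¬ Conflict a a′) N → AllPairs (Agree σ π) N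
            go N⊆ []            = []
            go N⊆ (free ∷ rest) = All.tabulate (λ a′∈ → agreeing (N⊆ (here refl)) (N⊆ (there a′∈)) (All.lookup free a′∈)) ∷ go (N⊆ ∘ there) rest

          open ≤-Reasoning
          bound : length xs * length ys ≤ p * (2 * m * (2 * m * ((h + h) * length M)))
          bound = begin
            length xs * length ys                             ≤⟨ *-monoʳ-≤ (length xs) (proj₂ (proj₂ (proj₂ distinct))) ⟩
            length xs * (p * length reps)                     ≡⟨ move (length xs) p (length reps) ⟩
            p * (length xs * length reps)                     ≡⟨ cong (p *_) (length-cartesianProductWith _,_ xs reps) ⟨
            p * length pairs                                  ≤⟨ *-monoʳ-≤ p (proj₂ (proj₂ popular₁)) ⟩
            p * (2 * m * length pairs₁)                       ≤⟨ *-monoʳ-≤ p (*-monoʳ-≤ (2 * m) (proj₂ (proj₂ popular₂))) ⟩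
            p * (2 * m * (2 * m * length shifted))            ≤⟨ *-monoʳ-≤ p (*-monoʳ-≤ (2 * m) (*-monoʳ-≤ (2 * m) (proj₂ (proj₂ (proj₂ independent))))) ⟩
            p * (2 * m * (2 * m * ((h + h) * length M)))      ∎
            where
            move : ∀ a b c → a * (b * c) ≡ b * (a * c)
            move = solve-∀

      -- Every pair of points has one of (2m)² displacements; a maximal set of
      -- pairs with the most popular displacement and with distinct rows and
      -- columns is a common pattern.
      abstract
        large-common-pattern : ∀ {xs ys} → Unique xs → Unique ys → Within s xs → Within s′ ys →
          ∃ λ M → AllPairs (Agree σ π) M × (∀ {a} → a ∈ M → proj₁ a ∈ xs × proj₂ a ∈ ys) ×
                  length xs * length ys ≤ p * (2 * m * (2 * m * ((h + h) * length M)))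
        large-common-pattern = common-pattern

      module _ (τ y₀ : ℕ) {{τ≢0 : NonZero τ}} {{y₀≢0 : NonZero y₀}} (cost : p * (2 * m * (2 * m * (h + h))) ≤ τ * y₀) where

        -- An integer version of exponential decay. Each pattern removes at least `1/τ` of `xs` and
        -- costs one unit of `f`; while `length xs ≥ 2 ^ g` it lowers `length xs * τ` by at least
        -- `2 ^ g`. When `f` is spent, `length xs ≤ 2 ^ g`, and trading one unit of `g` for `τ`
        -- units of `f` preserves the invariant. So a halving takes `τ` patterns.
        exhaust : ∀ g f {xs ys} → Unique xs → Unique ys → Within s xs → Within s′ ys →
          length ys ≡ length xs + y₀ → length xs * τ ≤ 2 ^ g * (τ + f) →
          ∃₂ λ ys₁ ys₂ → ys ↭ ys₁ ++ ys₂ × Matching σ π xs ys₁ (suc (g * τ + f)) × length ys₂ ≡ y₀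
        exhaust g       f       {[]}         {ys}     _ _ _ _ len _ = [] , ys , ↭-refl , Matching-[] , len
        -- With `g = f = 0` the invariant leaves at most one point, which accounts for the extra
        -- `suc` in the number of patterns.
        exhaust zero    zero    {x ∷ []}     {y ∷ ys} _ _ _ _ len _ =
          y ∷ [] , ys , ↭-refl , Matching-trivial (x ∷ []) (y ∷ []) refl , cong pred len
        exhaust zero    zero    {x ∷ x′ ∷ xs} {ys} _ _ _ _ len small =
          contradiction small (<⇒≱ (*-monoˡ-< τ {1} (s≤s (s≤s (z≤n {length xs})))) ∘ flip ≤-trans (≤-reflexive (cong (_+ 0) (+-identityʳ τ))))
        exhaust (suc g) zero    {xs@(_ ∷ _)} {ys}  xs! ys! xs-in ys-in len small =
          let (ys₁ , ys₂ , p , M , len₂) = exhaust g τ xs! ys! xs-in ys-in len (≤-trans small (≤-reflexive double))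
          in ys₁ , ys₂ , p , Matching-resp ↭-refl ↭-refl (s≤s (≤-reflexive count≡)) M , len₂
          where
          double : 2 ^ suc g * (τ + 0) ≡ 2 ^ g * (τ + τ)
          double = regroup (2 ^ g) τ
            where
            regroup : ∀ a b → 2 * a * (b + 0) ≡ a * (b + b)
            regroup = solve-∀
          count≡ : g * τ + τ ≡ suc g * τ + 0
          count≡ = trans (+-comm (g * τ) τ) (sym (+-identityʳ _))
        exhaust g       (suc f) {xs@(_ ∷ _)} {ys}  xs! ys! xs-in ys-in len small =
          let (ys₁ , ys₂ , q , N , len₂) = exhaust g f xs′! ys′! (xs-in ∘ xs′⊆) (ys-in ∘ ys′⊆) len′ small′
          in map proj₂ M ++ ys₁ , ys₂ ,
             ↭-trans ys↭ (↭-trans (Perm.++⁺ˡ (map proj₂ M) q) (↭-sym (Perm.++-assoc (map proj₂ M) ys₁ ys₂))) ,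
             Matching-resp xs↭ ↭-refl (s≤s (≤-reflexive (sym (+-suc (g * τ) f)))) (Matching-++ (Matching-class M M-agree) N) ,
             len₂
          where
          found = large-common-pattern xs! ys! xs-in ys-in
          M = proj₁ found
          M-agree = proj₁ (proj₂ found)
          M-in = λ {a} → proj₁ (proj₂ (proj₂ found)) {a}
          ≢-of : ∀ {i j : Fin n} {b b′} → SameOrder (toℕ i , b) (toℕ j , b′) → i ≢ j
          ≢-of (inj₁ (lt , _)) refl = <-irrefl refl lt
          ≢-of (inj₂ (lt , _)) refl = <-irrefl refl lt
          M!₁ : Unique (map proj₁ M)
          M!₁ = AllPairsₚ.map⁺ (AllPairs.map (λ (p , _) → ≢-of p) M-agree)
          M!₂ : Unique (map proj₂ M)
          M!₂ = AllPairsₚ.map⁺ (AllPairs.map (λ (p , _) → ≢-of (SameOrder-swap p)) M-agree)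
          rest₁ = extract M!₁ λ x∈ → let (a , a∈ , eq) = ∈-map⁻ proj₁ x∈ in subst (_∈ xs) (sym eq) (proj₁ (M-in a∈))
          rest₂ = extract M!₂ λ y∈ → let (a , a∈ , eq) = ∈-map⁻ proj₂ y∈ in subst (_∈ ys) (sym eq) (proj₂ (M-in a∈))
          xs′ = proj₁ rest₁
          ys′ = proj₁ rest₂
          xs↭ = proj₂ rest₁
          ys↭ = proj₂ rest₂
          xs′! = Unique-++⁻ʳ (map proj₁ M) (Unique-resp-↭ xs↭ xs!)
          ys′! = Unique-++⁻ʳ (map proj₂ M) (Unique-resp-↭ ys↭ ys!)
          xs′⊆ : ∀ {x} → x ∈ xs′ → x ∈ xs
          xs′⊆ x∈ = ∈-resp-↭ (↭-sym xs↭) (∈-++⁺ʳ (map proj₁ M) x∈)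
          ys′⊆ : ∀ {y} → y ∈ ys′ → y ∈ ys
          ys′⊆ y∈ = ∈-resp-↭ (↭-sym ys↭) (∈-++⁺ʳ (map proj₂ M) y∈)
          |xs| : length xs ≡ length M + length xs′
          |xs| = trans (↭-length xs↭) (trans (length-++ (map proj₁ M)) (cong (_+ length xs′) (length-map proj₁ M)))
          |ys| : length ys ≡ length M + length ys′
          |ys| = trans (↭-length ys↭) (trans (length-++ (map proj₂ M)) (cong (_+ length ys′) (length-map proj₂ M)))
          len′ : length ys′ ≡ length xs′ + y₀
          len′ = +-cancelˡ-≡ (length M) _ _ (trans (sym |ys|) (trans len (trans (cong (_+ y₀) |xs|) (+-assoc (length M) _ y₀))))
          open ≤-Reasoning
          progress : length xs ≤ τ * length M
          -- The surplus `y₀` never shrinks, so `ys` still has at least `y₀` points however few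
          -- remain in `xs`; this keeps the removed fraction at `1/τ`.
          progress = *-cancelʳ-≤ _ _ y₀ (begin
            length xs * y₀                                    ≤⟨ *-monoʳ-≤ (length xs) (≤-trans (m≤n+m y₀ (length xs)) (≤-reflexive (sym len))) ⟩
            length xs * length ys                             ≤⟨ proj₂ (proj₂ (proj₂ found)) ⟩
            p * (2 * m * (2 * m * ((h + h) * length M)))      ≡⟨ regroup p (2 * m) (h + h) (length M) ⟩
            p * (2 * m * (2 * m * (h + h))) * length M        ≤⟨ *-monoˡ-≤ (length M) cost ⟩
            τ * y₀ * length M                                 ≡⟨ swap-right τ y₀ (length M) ⟩
            τ * length M * y₀                                 ∎)
            where
            regroup : ∀ a b c d → a * (b * (b * (c * d))) ≡ a * (b * (b * c)) * d
            regroup = solve-∀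
            swap-right : ∀ a b c → a * b * c ≡ a * c * b
            swap-right = solve-∀
          small′ : length xs′ * τ ≤ 2 ^ g * (τ + f)
          small′ with ≤-<-connex (2 ^ g) (length xs)
          ... | inj₁ big = +-cancelˡ-≤ (2 ^ g) _ _ (begin
            2 ^ g + length xs′ * τ                  ≤⟨ +-monoˡ-≤ _ (≤-trans big progress) ⟩
            τ * length M + length xs′ * τ           ≡⟨ factor τ (length M) (length xs′) ⟩
            (length M + length xs′) * τ             ≡⟨ cong (_* τ) |xs| ⟨
            length xs * τ                           ≤⟨ small ⟩
            2 ^ g * (τ + suc f)                     ≡⟨ peel (2 ^ g) τ f ⟩
            2 ^ g + 2 ^ g * (τ + f)                 ∎)
            where
            factor : ∀ a b c → a * b + c * a ≡ (b + c) * a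
            factor = solve-∀
            peel : ∀ a b c → a * (b + (1 + c)) ≡ a + a * (b + c)
            peel = solve-∀
          ... | inj₂ few = begin
            length xs′ * τ                          ≤⟨ *-monoˡ-≤ τ (≤-trans (m≤n+m (length xs′) (length M)) (≤-reflexive (sym |xs|))) ⟩
            length xs * τ                           ≤⟨ *-monoˡ-≤ τ (<⇒≤ few) ⟩
            2 ^ g * τ                               ≤⟨ *-monoʳ-≤ (2 ^ g) (m≤m+n τ f) ⟩
            2 ^ g * (τ + f)                         ∎

-- The union bound over all windows, blocks and displacements.

module RareEvents where
  open import Data.Bool.Base using (Bool; true; false; T; _∧_; _∨_; if_then_else_)
  open import Data.Bool.Properties using (T-∧)
  open import Data.Fin.Base as Fin using (Fin; zero; suc; toℕ)
  open import Data.Fin.Permutation using (Permutation′; _⟨$⟩ʳ_)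
  open import Data.List.Base using (List; []; _∷_; length; upTo)
  open import Data.List.Properties using (length-upTo)
  open import Data.List.Membership.Propositional using (_∈_)
  open import Data.List.Membership.Propositional.Properties using (∈-upTo⁺)
  open import Data.List.Relation.Unary.Any using (here; there)
  open import Data.Nat.Base
  open import Data.Nat.DivMod using (_/_)
  open import Data.Nat.Properties
  open import Data.Product.Base using (_×_; _,_)
  open import Function.Base using (_∘_; flip)
  open import Function.Bundles using (Equivalence)
  open import Relation.Binary.PropositionalEquality using (_≡_; refl; sym; trans; cong; subst)
  open import Relation.Nullary using (contradiction)
  open import Defs using (permutations; length-permutations)
  open Moments
  open CommonPatterns using (value)
  open Grids

  count-mono : ∀ {n} {P Q : Fin n → Bool} → (∀ i → T (P i) → T (Q i)) → count P ≤ count Q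
  count-mono {zero}          imp = z≤n
  count-mono {suc n} {P} {Q} imp = +-mono-≤ (⟦⟧-mono (P zero) (Q zero) (imp zero)) (count-mono (imp ∘ suc))
    where
    ⟦⟧-mono : ∀ a b → (T a → T b) → ⟦ a ⟧ ≤ ⟦ b ⟧
    ⟦⟧-mono false b     _ = z≤n
    ⟦⟧-mono true  true  _ = ≤-refl
    ⟦⟧-mono true  false f = contradiction (f _) λ ()

  count-∨ : ∀ {n} (P Q : Fin n → Bool) → count (λ i → P i ∨ Q i) ≤ count P + count Q
  count-∨ {zero}  P Q = z≤n
  count-∨ {suc n} P Q = ≤-trans (+-mono-≤ (⟦⟧-∨ (P zero) (Q zero)) (count-∨ (P ∘ suc) (Q ∘ suc)))
    (≤-reflexive (+-interchange ⟦ P zero ⟧ ⟦ Q zero ⟧ _ _))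
    where
    ⟦⟧-∨ : ∀ a b → ⟦ a ∨ b ⟧ ≤ ⟦ a ⟧ + ⟦ b ⟧
    ⟦⟧-∨ false b = ≤-refl
    ⟦⟧-∨ true  b = s≤s z≤n
    open import Data.Nat.Tactic.RingSolver using (solve-∀)
    +-interchange : ∀ a b c d → a + b + (c + d) ≡ a + c + (b + d)
    +-interchange = solve-∀

  count-false : ∀ n → count {n} (λ _ → false) ≡ 0
  count-false zero    = refl
  count-false (suc n) = count-false n

  -- The union bound for cardinalities, over the indices `y` with `Q y`.
  count-anyFin : ∀ {n k} (Q : Fin n → Bool) (F : Fin n → Fin k → Bool) c → (∀ y → count (F y) ≤ c) →
    count (λ x → anyFin (λ y → Q y ∧ F y x)) ≤ count Q * c
  count-anyFin {zero}  {k} Q F c F≤c = ≤-reflexive (count-false k)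
  count-anyFin {suc n} {k} Q F c F≤c = begin
    count (λ x → (Q zero ∧ F zero x) ∨ anyFin (λ y → Q (suc y) ∧ F (suc y) x))
      ≤⟨ count-∨ (λ x → Q zero ∧ F zero x) (λ x → anyFin (λ y → Q (suc y) ∧ F (suc y) x)) ⟩
    count (λ x → Q zero ∧ F zero x) + count (λ x → anyFin (λ y → Q (suc y) ∧ F (suc y) x))
      ≤⟨ +-mono-≤ (first (Q zero)) (count-anyFin (Q ∘ suc) (F ∘ suc) c (F≤c ∘ suc)) ⟩
    ⟦ Q zero ⟧ * c + count (Q ∘ suc) * c
      ≡⟨ *-distribʳ-+ c ⟦ Q zero ⟧ (count (Q ∘ suc)) ⟨
    (⟦ Q zero ⟧ + count (Q ∘ suc)) * c ∎
    where
    open ≤-Reasoning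
    first : ∀ q → count (λ x → q ∧ F zero x) ≤ ⟦ q ⟧ * c
    first false = ≤-reflexive (count-false k)
    first true  = ≤-trans (F≤c zero) (≤-reflexive (sym (+-identityʳ c)))

  count-interval : ∀ n s k → count {n} (λ i → (s ≤ᵇ toℕ i) ∧ (toℕ i <ᵇ s + k)) ≤ k
  count-interval zero    s       k       = z≤n
  count-interval (suc n) zero    zero    = ≤-reflexive (count-false n)
  count-interval (suc n) zero    (suc k) = s≤s (count-interval n zero k)
  count-interval (suc n) (suc s) k       = ≤-trans
    (≤-reflexive (count-cong {n} λ i → cong (_∧ (toℕ i <ᵇ s + k)) (shift s (toℕ i))))
    (count-interval n s k)
    where
    shift : ∀ s i → (s <ᵇ suc i) ≡ (s ≤ᵇ i)
    shift zero    i = refl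
    shift (suc s) i = refl

  module _ {n : ℕ} (G : Grid) where
    open Grid G
    open GridSets {n} G

    count-window : ∀ s k → count (window s k) ≤ k
    count-window = count-interval n

    -- The fibre lies in the window of length `k` that starts at `s + (c ∸ t) * k`; any element of
    -- the fibre forces `t ≤ c`, so the truncated difference is exact.
    count-fibre : ∀ k .{{_ : NonZero k}} s t c →
      count {n} (λ x → (s ≤ᵇ toℕ x) ∧ ((toℕ x ∸ s) / k + t ≡ᵇ c)) ≤ k
    count-fibre k s t c = ≤-trans (count-mono inside) (count-window (s + (c ∸ t) * k) k)
      where
      inside : ∀ x → T ((s ≤ᵇ toℕ x) ∧ ((toℕ x ∸ s) / k + t ≡ᵇ c)) → T (window (s + (c ∸ t) * k) k x)
      inside x hyp =
        let (s≤x , eq) = Equivalence.to (T-∧ {s ≤ᵇ toℕ x}) hyp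
            q≡ = trans (sym (m+n∸n≡m _ t)) (cong (_∸ t) (≡ᵇ⇒≡ ((toℕ x ∸ s) / k + t) c eq))
            (lower , upper) = subst (λ q → s + q * k ≤ toℕ x × toℕ x < s + q * k + k) q≡
                                (quotient-window k s (toℕ x) (≤ᵇ⇒≤ s (toℕ x) s≤x))
        in ∧⁺ {s + (c ∸ t) * k ≤ᵇ toℕ x} (≤⇒≤ᵇ lower) (<⇒<ᵇ upper)

    count-column : ∀ t c → count {n} (λ u → toℕ u / b + t ≡ᵇ c) ≤ b
    count-column t c = count-fibre b 0 t c

    count-block : ∀ v → count (block v) ≤ b
    count-block v = ≤-trans (≤-reflexive (count-cong {n} λ u → cong (_≡ᵇ v) (sym (+-identityʳ (toℕ u / b))))) (count-column 0 v)

    count-rowTarget : ∀ π s′ t → count (rowTarget π s′ t) ≤ w * b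
    count-rowTarget π s′ t = ≤-trans
      (count-anyFin {n} {n} (window s′ w) (λ y u → toℕ u / b + t ≡ᵇ value π y / b + m) b λ y → count-column t (value π y / b + m))
      (*-monoˡ-≤ b (count-window s′ w))

    -- The size of this set depends on how many points of `π` lie in the strip, which is why strips
    -- need an event of their own.
    count-columnSource : ∀ π s s′ v′ t → count (columnSource π s s′ v′ t) ≤ hits (window s′ (w * m)) (block v′) π * w
    count-columnSource π s s′ v′ t = count-anyFin {n} {n} (λ y → window s′ (w * m) y ∧ block v′ (π ⟨$⟩ʳ y))
      (λ y x → (s ≤ᵇ toℕ x) ∧ ((toℕ x ∸ s) / w + t ≡ᵇ (toℕ y ∸ s′) / w + m)) w λ y → count-fibre w s t ((toℕ y ∸ s′) / w + m)

  ∑∑ : ∀ n → (Permutation′ n → Permutation′ n → ℕ) → ℕ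
  ∑∑ n X = ∑ (permutations n) λ σ → ∑ (permutations n) (X σ)

  -- 𝔼 X ≤ c / A, without the division.
  record Rare {n : ℕ} (A : ℕ) (X : Permutation′ n → Permutation′ n → ℕ) (c : ℕ) : Set where
    constructor rare
    field bound : ∑∑ n X * A ≤ c * (n ! * n !)
  open Rare public

  module _ {n A : ℕ} where

    Rare-+ : ∀ {X Y : Permutation′ n → Permutation′ n → ℕ} {c d} → Rare A X c → Rare A Y d → Rare A (λ σ π → X σ π + Y σ π) (c + d)
    Rare-+ {X} {Y} {c} {d} (rare rx) (rare ry) = rare (begin
      ∑∑ n (λ σ π → X σ π + Y σ π) * A     ≡⟨ cong (_* A) split ⟩
      (∑∑ n X + ∑∑ n Y) * A                ≡⟨ *-distribʳ-+ A (∑∑ n X) (∑∑ n Y) ⟩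
      ∑∑ n X * A + ∑∑ n Y * A              ≤⟨ +-mono-≤ rx ry ⟩
      c * (n ! * n !) + d * (n ! * n !)    ≡⟨ *-distribʳ-+ (n ! * n !) c d ⟨
      (c + d) * (n ! * n !)                ∎)
      where
      open ≤-Reasoning
      split : ∑∑ n (λ σ π → X σ π + Y σ π) ≡ ∑∑ n X + ∑∑ n Y
      split = trans (∑-cong (λ σ → ∑-+ (X σ) (Y σ) (permutations n)) (permutations n))
        (∑-+ (λ σ → ∑ (permutations n) (X σ)) (λ σ → ∑ (permutations n) (Y σ)) (permutations n))

    Rare-0 : Rare {n} A (λ _ _ → 0) 0
    Rare-0 = rare (≤-reflexive (cong (_* A) (trans (∑-cong (λ _ → zeros) (permutations n)) zeros)))
      where
      zeros : ∑ (permutations n) (λ _ → 0) ≡ 0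
      zeros = trans (∑-const 0 (permutations n)) (*-zeroʳ (length (permutations n)))

    Rare-∑ : ∀ {I : Set} {X : I → Permutation′ n → Permutation′ n → ℕ} {c} (is : List I) → (∀ i → i ∈ is → Rare A (X i) c) →
      Rare A (λ σ π → ∑ is (λ i → X i σ π)) (length is * c)
    Rare-∑ []       rareᵢ = Rare-0
    Rare-∑ (i ∷ is) rareᵢ = Rare-+ (rareᵢ i (here refl)) (Rare-∑ is λ j j∈ → rareᵢ j (there j∈))

    Rare-below : ∀ {X : ℕ → Permutation′ n → Permutation′ n → ℕ} {c} K → (∀ i → Rare A (X i) c) →
      Rare A (λ σ π → ∑ (upTo K) (λ i → X i σ π)) (K * c)
    Rare-below {X} {c} K rareᵢ = subst (λ k → Rare A (λ σ π → ∑ (upTo K) (λ i → X i σ π)) (k * c)) (length-upTo K) (Rare-∑ {X = X} (upTo K) λ i _ → rareᵢ i)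

    -- A bound on the average over `π` that holds for every fixed `σ` holds for the average over
    -- pairs: this is the use made of independence.
    Rare-given-left : ∀ {X : Permutation′ n → Permutation′ n → ℕ} → (∀ σ → ∑ (permutations n) (X σ) * A ≤ n !) → Rare A X 1
    Rare-given-left {X} small = rare (begin
      ∑∑ n X * A                                                   ≡⟨ ∑-*ʳ (λ σ → ∑ (permutations n) (X σ)) A (permutations n) ⟨
      ∑ (permutations n) (λ σ → ∑ (permutations n) (X σ) * A)      ≤⟨ ∑-mono small (permutations n) ⟩
      ∑ (permutations n) (λ _ → n !)                               ≡⟨ ∑-const (n !) (permutations n) ⟩
      length (permutations n) * n !                                ≡⟨ cong (_* n !) (length-permutations n) ⟩
      n ! * n !                                                    ≡⟨ +-identityʳ (n ! * n !) ⟨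
      1 * (n ! * n !)                                              ∎)
      where open ≤-Reasoning

    Rare-flip : ∀ {X : Permutation′ n → Permutation′ n → ℕ} {c} → Rare A X c → Rare A (flip X) c
    Rare-flip {X} {c} (rare r) = rare (subst (λ S → S * A ≤ c * (n ! * n !)) (∑-swap X (permutations n) (permutations n)) r)

    Rare-given-right : ∀ {X : Permutation′ n → Permutation′ n → ℕ} → (∀ π → ∑ (permutations n) (λ σ → X σ π) * A ≤ n !) → Rare A X 1
    Rare-given-right {X} small = Rare-flip {flip X} (Rare-given-left small)

  exceeds≡0 : ∀ {h k} → exceeds h k ≡ 0 → k < h
  exceeds≡0 {h} {k} eq with h ≤ᵇ k | ≤⇒≤ᵇ {h} {k}
  ... | false | ¬le = ≰⇒> ¬le

  ∑≡0 : ∀ {A : Set} (f : A → ℕ) xs → ∑ xs f ≡ 0 → ∀ {x} → x ∈ xs → f x ≡ 0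
  ∑≡0 f (x ∷ xs) eq (here refl) = m+n≡0⇒m≡0 (f x) eq
  ∑≡0 f (x ∷ xs) eq (there x∈)  = ∑≡0 f xs (m+n≡0⇒n≡0 (f x) eq) x∈

  ∑-upTo≡0 : ∀ (f : ℕ → ℕ) K → ∑ (upTo K) f ≡ 0 → ∀ i → i < K → f i ≡ 0
  ∑-upTo≡0 f K eq i i<K = ∑≡0 f (upTo K) eq (∈-upTo⁺ i<K)

  module BadEvents {n : ℕ} (G : Grid) (hₛ : ℕ) where
    open Grid G
    open GridSets {n} G

    cellEvent : ℕ → ℕ → Permutation′ n → Permutation′ n → ℕ
    cellEvent s v σ π = exceeds p (hits (window s w) (block v) π)

    strip : ℕ → ℕ → Permutation′ n → ℕ
    strip s′ v′ = hits (window s′ (w * m)) (block v′)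

    stripEvent : ℕ → ℕ → Permutation′ n → Permutation′ n → ℕ
    stripEvent s′ v′ σ π = exceeds hₛ (strip s′ v′ π)

    rowEvent : ℕ → ℕ → ℕ → Permutation′ n → Permutation′ n → ℕ
    rowEvent s s′ t σ π = exceeds h (hits (window s w) (rowTarget π s′ t) σ)

    -- The guard removes those `π` for which `columnSource` may be too large for the tail bound;
    -- they are charged to `stripEvent` instead.
    columnEvent : ℕ → ℕ → ℕ → ℕ → ℕ → Permutation′ n → Permutation′ n → ℕ
    columnEvent s s′ v v′ t σ π =
      if strip s′ v′ π <ᵇ hₛ then exceeds h (hits (columnSource π s s′ v′ t) (block v) σ) else 0

    ∑K : (ℕ → ℕ) → ℕ
    ∑K = ∑ (upTo K)

    cellBad stripBad rowBad columnBad bad : Permutation′ n → Permutation′ n → ℕ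
    cellBad   σ π = ∑K λ s → ∑K λ v → cellEvent s v σ π
    stripBad  σ π = ∑K λ s → ∑K λ v → stripEvent s v σ π
    rowBad    σ π = ∑K λ s → ∑K λ s′ → ∑K λ t → rowEvent s s′ t σ π
    columnBad σ π = ∑K λ s → ∑K λ s′ → ∑K λ v → ∑K λ v′ → ∑K λ t → columnEvent s s′ v v′ t σ π
    bad       σ π = cellBad σ π + stripBad σ π + (rowBad σ π + columnBad σ π)

    bad≡0⇒Spread : ∀ σ π → bad σ π ≡ 0 → Spread σ π
    bad≡0⇒Spread σ π none = record
      { cells   = λ s v s< v< → exceeds≡0 (at (at cell≡0 s s<) v v<)
      ; rows    = λ s s′ t s< s′< t< → exceeds≡0 (at (at (at row≡0 s s<) s′ s′<) t t<)
      ; columns = λ s s′ v v′ t s< s′< v< v′< t< → exceeds≡0 (unguard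
          (exceeds≡0 (at (at strip≡0 s′ s′<) v′ v′<))
          (at (at (at (at (at column≡0 s s<) s′ s′<) v v<) v′ v′<) t t<))
      }
      where
      at : ∀ {f : ℕ → ℕ} → ∑K f ≡ 0 → ∀ i → i < K → f i ≡ 0
      at {f} eq i i<K = ∑-upTo≡0 f K eq i i<K
      first≡0 = m+n≡0⇒m≡0 (cellBad σ π + stripBad σ π) none
      second≡0 = m+n≡0⇒n≡0 (cellBad σ π + stripBad σ π) none
      cell≡0 : cellBad σ π ≡ 0
      cell≡0 = m+n≡0⇒m≡0 (cellBad σ π) first≡0
      strip≡0 : stripBad σ π ≡ 0
      strip≡0 = m+n≡0⇒n≡0 (cellBad σ π) first≡0
      row≡0 : rowBad σ π ≡ 0
      row≡0 = m+n≡0⇒m≡0 (rowBad σ π) second≡0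
      column≡0 : columnBad σ π ≡ 0
      column≡0 = m+n≡0⇒n≡0 (rowBad σ π) second≡0
      unguard : ∀ {k x} → k < hₛ → (if k <ᵇ hₛ then x else 0) ≡ 0 → x ≡ 0
      unguard {k} k<hₛ eq with k <ᵇ hₛ | <⇒<ᵇ k<hₛ
      ... | true | _ = eq

    module _ (A B : ℕ) .{{_ : NonZero n}}
             (few : w * b * B ≤ n) (A≤Bᵖ : A ≤ B ^ p)
             (8wmb≤ : 8 * (w * m * b) ≤ hₛ * n) (A≤2^hₛ : A ≤ 2 ^ hₛ)
             (8wwb≤ : 8 * (w * (w * b)) ≤ h * n) (8hwb≤ : 8 * (hₛ * w * b) ≤ h * n) (A≤2^h : A ≤ 2 ^ h) where

      -- The terms count the parameters of the four kinds of events. Cells and strips concern only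
      -- `π`; rows and columns are estimated over `σ` with `π` fixed. Cells use the sparse tail
      -- bound, all others the one for thresholds above eight times the mean.
      Rare-bad : Rare A bad (K * (K * 1) + K * (K * 1) + (K * (K * (K * 1)) + K * (K * (K * (K * (K * 1))))))
      Rare-bad = Rare-+
        (Rare-+
          (Rare-below K λ s → Rare-below K λ v → Rare-given-left λ _ → ≤-trans (*-monoʳ-≤ (∑ (permutations n) (exceeds p ∘ hits (window s w) (block v))) A≤Bᵖ)
            (tail-few (window s w) (block v) p w b B (count-window {n} G s w) (count-block {n} G v) few))
          (Rare-below K λ s → Rare-below K λ v → Rare-given-left λ _ → ≤-trans (*-monoʳ-≤ (∑ (permutations n) (exceeds hₛ ∘ strip s v)) A≤2^hₛ)
            (tail-many (window s (w * m)) (block v) hₛ (w * m) b (count-window {n} G s (w * m)) (count-block {n} G v) 8wmb≤)))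
        (Rare-+
          (Rare-below K λ s → Rare-below K λ s′ → Rare-below K λ t → Rare-given-right λ π → ≤-trans (*-monoʳ-≤ (∑ (permutations n) (exceeds h ∘ hits (window s w) (rowTarget π s′ t))) A≤2^h)
            (tail-many (window s w) (rowTarget π s′ t) h w (w * b) (count-window {n} G s w) (count-rowTarget {n} G π s′ t) 8wwb≤))
          (Rare-below K λ s → Rare-below K λ s′ → Rare-below K λ v → Rare-below K λ v′ → Rare-below K λ t →
            Rare-given-right λ π → guarded s s′ v v′ t π))
        where
        guarded : ∀ s s′ v v′ t π → ∑ (permutations n) (λ σ → columnEvent s s′ v v′ t σ π) * A ≤ n !
        guarded s s′ v v′ t π with strip s′ v′ π <ᵇ hₛ | <ᵇ⇒< (strip s′ v′ π) hₛ
        ... | false | _  = ≤-trans (≤-reflexive (cong (_* A) (trans (∑-const 0 (permutations n)) (*-zeroʳ (length (permutations n)))))) z≤n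
        ... | true  | lt = ≤-trans (*-monoʳ-≤ (∑ (permutations n) (exceeds h ∘ hits (columnSource π s s′ v′ t) (block v))) A≤2^h)
          (tail-many (columnSource π s s′ v′ t) (block v) h (hₛ * w) b
            (≤-trans (count-columnSource {n} G π s s′ v′ t) (*-monoˡ-≤ w (<⇒≤ (lt _)))) (count-block {n} G v) 8hwb≤)

-- The parameters at each scale and the inequalities between them.

module Scales where
  open import Data.Nat.Base
  open import Data.Nat.Properties
  open import Data.Nat.Tactic.RingSolver using (solve-∀)
  open import Relation.Binary.PropositionalEquality using (_≡_; sym; trans; cong)
  open Arithmetic
  open Grids using (Grid)

  -- q² ~ log n; at level i ≤ a + (a + a) the untouched suffix of one of the two permutations has
  -- size q * 8 ^ i.
  record Scale (n : ℕ) : Set where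
    field
      μ q a : ℕ
      {{q≢0}} : NonZero q
      8≤μ     : 8 ≤ μ
      n≤      : n ≤ 2 ^ (q * q)
      lower   : q * 8 ^ (a + (a + a)) ≤ n
      upper   : n ≤ μ * (q * 8 ^ (a + (a + a)))
      a-large : 8 * (8 * μ) * μ * q * (2 ^ q) ^ 16 ≤ 2 ^ a

  private
    8^≡2^*4^ : ∀ i → 8 ^ i ≡ 2 ^ i * 4 ^ i
    8^≡2^*4^ i = [m*n]^k≡m^k*n^k 2 4 i

    4^≡2^*2^ : ∀ i → 4 ^ i ≡ 2 ^ i * 2 ^ i
    4^≡2^*2^ i = [m*n]^k≡m^k*n^k 2 2 i

  module Levels {n : ℕ} (S : Scale n) where
    open Scale S public

    -- `X` bounds `n`, and `1/A` bounds the probability of a single bad event. The exponent 16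
    -- leaves room for `K⁵ = X¹⁰` events, for the levels and for the factor `n` lost on failure; `B`
    -- is chosen with `B ^ q = A`. The carried points lie in a slice of size `8 μ u (i+1) = κ u i`,
    -- whence `κ = 64 μ`. Finally `h` is eight times the bound for the mean in a column,
    -- `8 μ · μ (κ q)²`.
    J X A B κ h : ℕ
    J = a + (a + a)
    X = 2 ^ (q * q)
    A = X ^ 16
    B = (2 ^ q) ^ 16
    κ = 8 * (8 * μ)
    h = (8 * (μ * (κ * q))) * (8 * (μ * (κ * q)))

    -- With `m = 4 ^ i`, the `m` windows cover `κ u i` positions and the `m` blocks cover
    -- `μ u J ≥ n` values. `hₛ` is eight times the bound `μ w` for the mean of a strip.
    u w b hₛ τ : ℕ → ℕ
    u i = q * 8 ^ i
    w i = κ * q * 2 ^ i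
    b i = μ * (q * (2 ^ J * 4 ^ (J ∸ i)))
    hₛ i = 8 * (μ * w i)
    τ i = 8 * (h * 2 ^ i)

    instance
      μ≢0 : NonZero μ
      μ≢0 = >-nonZero (≤-trans (s≤s z≤n) 8≤μ)
      κ≢0 : NonZero κ
      κ≢0 = m*n≢0 8 _ {{_}} {{m*n≢0 8 μ}}
      κq≢0 : NonZero (κ * q)
      κq≢0 = m*n≢0 κ q
      h≢0 : NonZero h
      h≢0 = m*n≢0 (8 * (μ * (κ * q))) _ {{H≢0}} {{H≢0}}
        where
        H≢0 : NonZero (8 * (μ * (κ * q)))
        H≢0 = m*n≢0 8 _ {{_}} {{m*n≢0 μ (κ * q)}}

    2^≢0 : ∀ i → NonZero (2 ^ i)
    2^≢0 i = m^n≢0 2 i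

    u≢0 : ∀ i → NonZero (u i)
    u≢0 i = m*n≢0 q (8 ^ i) {{q≢0}} {{m^n≢0 8 i}}

    τ≢0 : ∀ i → NonZero (τ i)
    τ≢0 i = m*n≢0 8 _ {{_}} {{m*n≢0 h (2 ^ i) {{h≢0}} {{2^≢0 i}}}}

    n≢0 : NonZero n
    n≢0 = >-nonZero (≤-trans (>-nonZero⁻¹ (u J) {{u≢0 J}}) lower)

    u-suc : ∀ i → u (suc i) ≡ 8 * u i
    u-suc i = move q (8 ^ i)
      where
      move : ∀ q e → q * (8 * e) ≡ 8 * (q * e)
      move = solve-∀

    grid : ℕ → Grid
    grid i = record
      { w = w i ; b = b i ; m = 4 ^ i ; p = q ; h = h ; K = X * X
      ; w≢0 = m*n≢0 (κ * q) (2 ^ i) {{κq≢0}} {{2^≢0 i}}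
      ; b≢0 = m*n≢0 μ _ {{μ≢0}} {{m*n≢0 q _ {{q≢0}} {{m*n≢0 (2 ^ J) _ {{2^≢0 J}} {{m^n≢0 4 (J ∸ i)}}}}}}
      ; m≢0 = m^n≢0 4 i
      }

    q≤2^ : ∀ i → a ≤ i → q ≤ 2 ^ i
    q≤2^ i a≤i = begin
      q                                        ≤⟨ m≤n*m q (8 * (8 * μ) * μ) {{m*n≢0 κ μ}} ⟩
      8 * (8 * μ) * μ * q                      ≤⟨ m≤m*n (8 * (8 * μ) * μ * q) B {{m^n≢0 (2 ^ q) 16 {{2^≢0 q}}}} ⟩
      8 * (8 * μ) * μ * q * (2 ^ q) ^ 16       ≤⟨ a-large ⟩
      2 ^ a                                    ≤⟨ ^-monoʳ-≤ 2 a≤i ⟩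
      2 ^ i                                    ∎
      where open ≤-Reasoning

    module _ {i : ℕ} (i≤J : i ≤ J) where
      private
        E F M : ℕ
        E = 2 ^ i
        F = 4 ^ i
        M = μ * u J

      bF≡M : b i * F ≡ M
      bF≡M = trans (move μ q (2 ^ J) (4 ^ (J ∸ i)) F) (cong (λ x → μ * (q * x))
        (trans (cong (2 ^ J *_) (trans (sym (^-distribˡ-+-* 4 (J ∸ i) i)) (cong (4 ^_) (m∸n+n≡m i≤J))))
               (sym (8^≡2^*4^ J))))
        where
        move : ∀ a b c d e → a * (b * (c * d)) * e ≡ a * (b * (c * (d * e)))
        move = solve-∀

      n≤mb : n ≤ 4 ^ i * b i
      n≤mb = ≤-trans upper (≤-reflexive (trans (sym bF≡M) (*-comm (b i) F)))

      M≤μn : M ≤ μ * n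
      M≤μn = *-monoʳ-≤ μ lower

      wm≡ : w i * 4 ^ i ≡ κ * u i
      wm≡ = trans (*-assoc (κ * q) E F) (trans (*-assoc κ q (E * F)) (cong (λ x → κ * (q * x)) (sym (8^≡2^*4^ i))))

      strip-tail : 8 * (w i * 4 ^ i * b i) ≤ hₛ i * n
      strip-tail = begin
        8 * (w i * F * b i)           ≡⟨ cong (8 *_) (trans (*-assoc (w i) F (b i)) (cong (w i *_) (trans (*-comm F (b i)) bF≡M))) ⟩
        8 * (w i * M)                 ≤⟨ *-monoʳ-≤ 8 (*-monoʳ-≤ (w i) M≤μn) ⟩
        8 * (w i * (μ * n))           ≡⟨ move (w i) μ n ⟩
        8 * (μ * w i) * n             ∎
        where
        open ≤-Reasoning
        move : ∀ a b c → 8 * (a * (b * c)) ≡ 8 * (b * a) * c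
        move = solve-∀

      -- The two factors `2 ^ i` from the windows cancel against `m = 4 ^ i` in the width of the
      -- blocks, so the bound does not depend on the level. This balance is what permits the same
      -- degree bound `h` at every scale.
      wwb≤ : w i * (w i * b i) ≤ μ * ((κ * q) * (κ * q)) * n
      wwb≤ = begin
        w i * (w i * b i)                    ≡⟨ move (κ * q) E (b i) ⟩
        (κ * q) * (κ * q) * (b i * (E * E))  ≡⟨ cong (λ x → (κ * q) * (κ * q) * (b i * x)) (4^≡2^*2^ i) ⟨
        (κ * q) * (κ * q) * (b i * F)        ≡⟨ cong ((κ * q) * (κ * q) *_) bF≡M ⟩
        (κ * q) * (κ * q) * M                ≤⟨ *-monoʳ-≤ ((κ * q) * (κ * q)) M≤μn ⟩
        (κ * q) * (κ * q) * (μ * n)          ≡⟨ move′ ((κ * q) * (κ * q)) μ n ⟩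
        μ * ((κ * q) * (κ * q)) * n          ∎
        where
        open ≤-Reasoning
        move : ∀ c e b → c * e * (c * e * b) ≡ c * c * (b * (e * e))
        move = solve-∀
        move′ : ∀ a b c → a * (b * c) ≡ b * a * c
        move′ = solve-∀

      -- Two factors 8 meet here: one in `hₛ`, bounding the strip of `π`, and one for the tail over
      -- `σ`.
      column-tail : 8 * (hₛ i * w i * b i) ≤ h * n
      column-tail = begin
        8 * (8 * (μ * w i) * w i * b i)                 ≡⟨ move μ (w i) (b i) ⟩
        8 * (8 * (μ * (w i * (w i * b i))))             ≤⟨ *-monoʳ-≤ 8 (*-monoʳ-≤ 8 (*-monoʳ-≤ μ wwb≤)) ⟩
        8 * (8 * (μ * (μ * ((κ * q) * (κ * q)) * n)))   ≡⟨ move′ μ (κ * q) n ⟩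
        h * n                                           ∎
        where
        open ≤-Reasoning
        move : ∀ m w b → 8 * (8 * (m * w) * w * b) ≡ 8 * (8 * (m * (w * (w * b))))
        move = solve-∀
        move′ : ∀ m c n → 8 * (8 * (m * (m * (c * c) * n))) ≡ (8 * (m * c)) * (8 * (m * c)) * n
        move′ = solve-∀

      row-tail : 8 * (w i * (w i * b i)) ≤ h * n
      row-tail = ≤-trans (*-monoʳ-≤ 8 (begin
        w i * (w i * b i)        ≡⟨ *-assoc (w i) (w i) (b i) ⟨
        w i * w i * b i          ≤⟨ *-monoˡ-≤ (b i) (*-monoˡ-≤ (w i) (≤-trans (m≤n*m (w i) μ) (m≤n*m (μ * w i) 8))) ⟩
        hₛ i * w i * b i         ∎)) column-tail
        where open ≤-Reasoning

      module _ (a≤i : a ≤ i) where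

        -- The mean of a cell is at most `κ μ q / 2 ^ i`. Bringing it below `1/B` takes the
        -- hypothesis `a-large`, and is the reason for using only levels from `a` on.
        few : w i * b i * B ≤ n
        few = *-cancelˡ-≤ (κ * μ * q) {{m*n≢0 (κ * μ) q {{m*n≢0 κ μ}}}} (begin
          κ * μ * q * (w i * b i * B)          ≡⟨ move (κ * μ * q) (w i * b i) B ⟩
          w i * b i * (κ * μ * q * B)          ≤⟨ *-monoʳ-≤ (w i * b i) (≤-trans a-large (^-monoʳ-≤ 2 a≤i)) ⟩
          w i * b i * E                        ≡⟨ move′ (κ * q) E (b i) ⟩
          κ * q * (b i * (E * E))              ≡⟨ cong (λ x → κ * q * (b i * x)) (4^≡2^*2^ i) ⟨
          κ * q * (b i * F)                    ≡⟨ cong (κ * q *_) bF≡M ⟩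
          κ * q * M                            ≤⟨ *-monoʳ-≤ (κ * q) M≤μn ⟩
          κ * q * (μ * n)                      ≡⟨ move″ κ q μ n ⟩
          κ * μ * q * n                        ∎)
          where
          open ≤-Reasoning
          move : ∀ a b c → a * (b * c) ≡ b * (a * c)
          move = solve-∀
          move′ : ∀ c e b → c * e * b * e ≡ c * (b * (e * e))
          move′ = solve-∀
          move″ : ∀ a b c d → a * b * (c * d) ≡ a * c * b * d
          move″ = solve-∀

        A≤2^hₛ : A ≤ 2 ^ hₛ i
        A≤2^hₛ = ≤-trans (≤-reflexive (^-*-assoc 2 (q * q) 16)) (^-monoʳ-≤ 2 (begin
          q * q * 16                     ≡⟨ move q ⟩
          8 * (2 * 1 * q * q)            ≤⟨ *-monoʳ-≤ 8 (*-mono-≤ (*-monoˡ-≤ q (*-mono-≤ 2≤μ (>-nonZero⁻¹ κ))) (q≤2^ i a≤i)) ⟩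
          8 * (μ * κ * q * E)            ≡⟨ move′ μ κ q E ⟩
          8 * (μ * (κ * q * E))          ∎))
          where
          open ≤-Reasoning
          2≤μ : 2 ≤ μ
          2≤μ = ≤-trans (s≤s (s≤s z≤n)) 8≤μ
          move : ∀ q → q * q * 16 ≡ 8 * (2 * 1 * q * q)
          move = solve-∀
          move′ : ∀ a b c d → 8 * (a * b * c * d) ≡ 8 * (a * (b * c * d))
          move′ = solve-∀

    A≤B^q : A ≤ B ^ q
    A≤B^q = ≤-reflexive (trans (cong (_^ 16) (sym (^-*-assoc 2 q q)))
      (trans (^-*-assoc (2 ^ q) q 16) (trans (cong ((2 ^ q) ^_) (*-comm q 16)) (sym (^-*-assoc (2 ^ q) 16 q)))))

    A≤2^h : A ≤ 2 ^ h
    A≤2^h = ≤-trans (≤-reflexive (^-*-assoc 2 (q * q) 16)) (^-monoʳ-≤ 2 (begin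
      q * q * 16                              ≤⟨ *-monoʳ-≤ (q * q) (m≤m+n 16 48) ⟩
      q * q * 64                              ≡⟨ move q ⟩
      8 * (1 * (1 * q)) * (8 * (1 * (1 * q))) ≤⟨ *-mono-≤ mono mono ⟩
      h                                       ∎))
      where
      open ≤-Reasoning
      move : ∀ q → q * q * 64 ≡ 8 * (1 * (1 * q)) * (8 * (1 * (1 * q)))
      move = solve-∀
      mono : 8 * (1 * (1 * q)) ≤ 8 * (μ * (κ * q))
      mono = *-monoʳ-≤ 8 (*-mono-≤ (>-nonZero⁻¹ μ) (*-monoˡ-≤ q (>-nonZero⁻¹ κ)))

    2≤X : 2 ≤ X
    2≤X = ^-monoʳ-≤ 2 {1} (*-mono-≤ (>-nonZero⁻¹ q) (>-nonZero⁻¹ q))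

    X≤XX : X ≤ X * X
    X≤XX = m≤m*n X X {{>-nonZero (≤-trans (s≤s z≤n) 2≤X)}}

    n≤K : n ≤ X * X
    n≤K = ≤-trans n≤ X≤XX

    2m≤K : ∀ {i} → i ≤ J → 2 * 4 ^ i ≤ X * X
    2m≤K {i} i≤J = *-mono-≤ 2≤X (begin
      4 ^ i            ≤⟨ ^-monoˡ-≤ i (m≤m+n 4 4) ⟩
      8 ^ i            ≤⟨ ^-monoʳ-≤ 8 i≤J ⟩
      8 ^ J            ≤⟨ m≤n*m (8 ^ J) q ⟩
      u J              ≤⟨ ≤-trans lower n≤ ⟩
      X                ∎)
      where open ≤-Reasoning

    -- The number of patterns per halving is about `p m² h / y₀`; here `m² = 16 ^ i` and
    -- `y₀ = 7 u i`, so `p = q` cancels against the `q` in `u` and `h 2 ^ i` remains up to a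
    -- constant.
    step-cost : ∀ i → q * (2 * 4 ^ i * (2 * 4 ^ i * (h + h))) ≤ τ i * (7 * u i)
    step-cost i = begin
      q * (2 * 4 ^ i * (2 * 4 ^ i * (h + h)))       ≡⟨ move q (4 ^ i) h ⟩
      1 * (8 * h * (4 ^ i * (q * 4 ^ i)))           ≤⟨ *-monoˡ-≤ (8 * h * (4 ^ i * (q * 4 ^ i))) (s≤s (z≤n {6})) ⟩
      7 * (8 * h * (4 ^ i * (q * 4 ^ i)))           ≡⟨ cong (λ x → 7 * (8 * h * (x * (q * 4 ^ i)))) (4^≡2^*2^ i) ⟩
      7 * (8 * h * (2 ^ i * 2 ^ i * (q * 4 ^ i)))   ≡⟨ move′ h (2 ^ i) q (4 ^ i) ⟩
      8 * (h * 2 ^ i) * (7 * (q * (2 ^ i * 4 ^ i))) ≡⟨ cong (λ x → τ i * (7 * (q * x))) (8^≡2^*4^ i) ⟨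
      τ i * (7 * u i)                               ∎
      where
      open ≤-Reasoning
      move : ∀ q f h → q * (2 * f * (2 * f * (h + h))) ≡ 1 * (8 * h * (f * (q * f)))
      move = solve-∀
      move′ : ∀ h e q f → 7 * (8 * h * (e * e * (q * f))) ≡ 8 * (h * e) * (7 * (q * (e * f)))
      move′ = solve-∀

-- The descent through the scales and the bound for the sum of `U` over all pairs.

module Stages where
  open import Data.Fin.Base as Fin using (Fin; zero; suc; toℕ)
  open import Data.Fin.Permutation using (Permutation′)
  open import Data.List.Base using (List; length; take; drop; tabulate; allFin; upTo; _++_)
  open import Data.List.Properties using (length-++; length-take; length-drop; drop-drop; take++drop≡id; length-tabulate)
  open import Data.List.Membership.Propositional using (_∈_)
  open import Data.List.Membership.Propositional.Properties using (∈-++⁺ʳ)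
  open import Data.List.Relation.Binary.Permutation.Propositional using (_↭_; ↭-refl; ↭-sym; ↭-trans; ↭-reflexive)
  open import Data.List.Relation.Binary.Permutation.Propositional.Properties as Perm using (∈-resp-↭)
  open import Data.List.Relation.Unary.Any using (here; there)
  open import Data.List.Relation.Unary.Unique.Propositional using (Unique)
  import Data.List.Relation.Unary.Unique.Propositional.Properties as Uniqueₚ
  open import Data.Nat.Base
  open import Data.Nat.Properties
  open import Data.Nat.Tactic.RingSolver using (solve-∀)
  open import Data.Product.Base using (_×_; _,_; proj₁; proj₂; swap)
  open import Function.Base using (_∘_)
  open import Relation.Binary.PropositionalEquality using (_≡_; refl; sym; trans; cong; cong₂; subst)
  open import Defs using (permutations; length-permutations; U)
  open Arithmetic
  open Moments
  open Lists
  open CommonPatterns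
  open Grids
  open RareEvents
  open Scales

  ∈-take-drop : ∀ {n} m (f : Fin m → Fin n) k → (∀ i → toℕ (f i) ≡ k + toℕ i) → ∀ s c {x} →
    x ∈ take c (drop s (tabulate f)) → k + s ≤ toℕ x × toℕ x < k + s + c
  ∈-take-drop zero    f k eq zero    zero    ()
  ∈-take-drop zero    f k eq zero    (suc c) ()
  ∈-take-drop zero    f k eq (suc s) zero    ()
  ∈-take-drop zero    f k eq (suc s) (suc c) ()
  ∈-take-drop (suc m) f k eq zero    zero    ()
  ∈-take-drop (suc m) f k eq zero    (suc c) (here refl) rewrite eq zero = ≤-refl , m<m+n (k + 0) z<s
  ∈-take-drop (suc m) f k eq zero    (suc c) (there x∈) =
    let (lo , hi) = ∈-take-drop m (f ∘ suc) (suc k) (λ i → trans (eq (suc i)) (+-suc k (toℕ i))) zero c x∈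
    in ≤-trans (n≤1+n _) lo , ≤-trans hi (≤-reflexive (sym (+-suc (k + 0) c)))
  ∈-take-drop (suc m) f k eq (suc s) c x∈ =
    let (lo , hi) = ∈-take-drop m (f ∘ suc) (suc k) (λ i → trans (eq (suc i)) (+-suc k (toℕ i))) s c x∈
    in ≤-trans (≤-reflexive (+-suc k s)) lo , ≤-trans hi (≤-reflexive (cong (_+ c) (sym (+-suc k s))))

  module _ {n : ℕ} where

    suffix : ℕ → List (Fin n)
    suffix s = drop s (allFin n)

    slice : ℕ → ℕ → List (Fin n)
    slice s c = take c (suffix s)

    slice-++ : ∀ s c → slice s c ++ suffix (s + c) ≡ suffix s
    slice-++ s c = trans (cong (slice s c ++_) (sym (drop-drop s c (allFin n)))) (take++drop≡id c (suffix s))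

    ∈-slice : ∀ s c {x} → x ∈ slice s c → s ≤ toℕ x × toℕ x < s + c
    ∈-slice s c = ∈-take-drop n (λ i → i) 0 (λ _ → refl) s c

    slice! : ∀ s c → Unique (slice s c)
    slice! s c = Uniqueₚ.take⁺ c (Uniqueₚ.drop⁺ s (Uniqueₚ.allFin⁺ n))

    length-suffix : ∀ {s c} → s + c ≡ n → length (suffix s) ≡ c
    length-suffix {s} {c} refl = trans (length-drop s (allFin n)) (trans (cong (_∸ s) (length-tabulate {n = n} (λ i → i))) (m+n∸m≡n s c))

    length-slice : ∀ {s c d} → s + (c + d) ≡ n → length (slice s c) ≡ c
    length-slice {s} {c} {d} eq = trans (length-take c (suffix s)) (m≤n⇒m⊓n≡m (≤-trans (m≤m+n c d) (≤-reflexive (sym (length-suffix {s = s} {c = c + d} eq)))))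

  module Bound {n : ℕ} (S : Scale n) where
    open Levels S

    Good : Permutation′ n → Permutation′ n → Set
    Good σ π = ∀ d → d < a + a → GridSets.Spread (grid (a + d)) σ π × GridSets.Spread (grid (a + d)) π σ

    -- A geometric series in closed form: one more level `i` adds `16 q² h 2 ^ i`, twice `q² τ i`,
    -- the spare half absorbing an additive 1. The last summand pays for the lowest level.
    cost : ℕ → ℕ
    cost d = 16 * (q * q * (h * 2 ^ (a + d))) + μ * u a

    stage : ∀ d {σ π : Permutation′ n} → d ≤ a + a → Good σ π → ∀ xs s₀ s s′ → Unique xs →
      (∀ {x} → x ∈ xs → s₀ ≤ toℕ x × toℕ x < s₀ + 8 * (μ * u (a + d))) →
      length xs + u (a + d) ≤ μ * u (a + d) → s + u (a + d) ≡ n → s′ + (length xs + u (a + d)) ≡ n →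
      Matching σ π (xs ++ suffix s) (suffix s′) (cost d)
    -- At level `a` the points are paired off singly, one class per pair; there are at most `μ u a`
    -- of them.
    stage zero _ _ xs s₀ s s′ _ _ z≤ s≡ s′≡ = Matching-resp ↭-refl ↭-refl size≤
      (Matching-trivial (xs ++ suffix s) (suffix s′) (trans length≡ (sym (length-suffix {s = s′} s′≡))))
      where
      length≡ : length (xs ++ suffix s) ≡ length xs + u (a + 0)
      length≡ = trans (length-++ xs) (cong (length xs +_) (length-suffix s≡))
      size≤ : length (xs ++ suffix s) ≤ cost 0
      size≤ = ≤-trans (≤-reflexive length≡) (≤-trans z≤ (≤-trans (≤-reflexive (cong (λ i → μ * u i) (+-identityʳ a))) (m≤n+m (μ * u a) _)))
    stage (suc d) {σ} {π} d<2a good xs s₀ s s′ xs! xs-in z≤ s≡ s′≡ =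
      Matching-resp ↭-refl (↭-trans (↭-reflexive (sym (slice-++ s′ c))) (↭-trans (Perm.++⁺ʳ (suffix (s′ + c)) ys↭) (Perm.++-assoc ys₁ ys₂ (suffix (s′ + c)))))
        cost≤ (Matching-++ matched (Matching-swap rest))
      where
      i = a + d
      z = length xs
      c = z + 7 * u i
      ys : List (Fin n)
      ys = slice s′ c
      open ≤-Reasoning

      u-step : u (a + suc d) ≡ 8 * u i
      u-step = trans (cong u (+-suc a d)) (u-suc i)

      i≤J : i ≤ J
      i≤J = +-monoʳ-≤ a (<⇒≤ d<2a)

      z≤′ : z + 8 * u i ≤ 8 * (μ * u i)
      z≤′ = begin
        z + 8 * u i              ≡⟨ cong (z +_) u-step ⟨
        z + u (a + suc d)        ≤⟨ z≤ ⟩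
        μ * u (a + suc d)        ≡⟨ cong (μ *_) u-step ⟩
        μ * (8 * u i)            ≡⟨ move μ (u i) ⟩
        8 * (μ * u i)            ∎
        where
        move : ∀ a b → a * (8 * b) ≡ 8 * (a * b)
        move = solve-∀

      s′≡′ : s′ + (c + u i) ≡ n
      s′≡′ = trans (cong (s′ +_) (trans (regroup z (u i)) (cong (z +_) (sym u-step)))) s′≡
        where
        regroup : ∀ z u → z + 7 * u + u ≡ z + 8 * u
        regroup = solve-∀

      c≤ : c ≤ 8 * (μ * u i)
      c≤ = ≤-trans (+-monoʳ-≤ z (*-monoˡ-≤ (u i) (n≤1+n 7))) z≤′

      wm≡′ : w i * 4 ^ i ≡ 8 * (8 * (μ * u i))
      wm≡′ = trans (wm≡ i≤J) (regroup μ (u i))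
        where
        regroup : ∀ m u → 8 * (8 * m) * u ≡ 8 * (8 * (m * u))
        regroup = solve-∀

      xs-in′ : ∀ {x} → x ∈ xs → s₀ ≤ toℕ x × toℕ x < s₀ + w i * 4 ^ i
      xs-in′ x∈ = let (lo , hi) = xs-in x∈ in lo , ≤-trans hi (+-monoʳ-≤ s₀ (≤-reflexive (trans
        (cong (λ x → 8 * (μ * x)) u-step) (trans (regroup μ (u i)) (sym wm≡′)))))
        where
        regroup : ∀ m u → 8 * (m * (8 * u)) ≡ 8 * (8 * (m * u))
        regroup = solve-∀

      ys-in : ∀ {y} → y ∈ ys → s′ ≤ toℕ y × toℕ y < s′ + 8 * (μ * u i)
      ys-in y∈ = let (lo , hi) = ∈-slice s′ c y∈ in lo , ≤-trans hi (+-monoʳ-≤ s′ c≤)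

      ys-in′ : ∀ {y} → y ∈ ys → s′ ≤ toℕ y × toℕ y < s′ + w i * 4 ^ i
      ys-in′ y∈ = let (lo , hi) = ys-in y∈ in lo , ≤-trans hi (+-monoʳ-≤ s′
        (≤-trans (m≤n*m (8 * (μ * u i)) 8) (≤-reflexive (sym wm≡′))))

      z≤n′ : z ≤ 2 ^ (q * q)
      z≤n′ = ≤-trans (≤-trans (m≤m+n z _) (≤-trans (m≤n+m _ s′) (≤-reflexive s′≡))) n≤

      -- `q * q` halvings suffice since `length xs ≤ n ≤ 2 ^ (q * q)`.
      exhausted = GreedyStep.exhaust (grid i) (proj₁ (good d d<2a)) (n≤mb i≤J) n≤K (2m≤K i≤J) {s₀} {s′}
        (τ i) (7 * u i) {{τ≢0 i}} {{m*n≢0 7 (u i) {{_}} {{u≢0 i}}}} (step-cost i) (q * q) 0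
        xs! (slice! s′ c) xs-in′ ys-in′ (length-slice {s = s′} {c = c} {d = u i} s′≡′)
        (≤-trans (*-monoˡ-≤ (τ i) z≤n′) (≤-reflexive (cong (2 ^ (q * q) *_) (sym (+-identityʳ (τ i))))))
      ys₁ = proj₁ exhausted
      ys₂ = proj₁ (proj₂ exhausted)
      ys↭ : ys ↭ ys₁ ++ ys₂
      ys↭ = proj₁ (proj₂ (proj₂ exhausted))
      matched = proj₁ (proj₂ (proj₂ (proj₂ exhausted)))
      length-ys₂ : length ys₂ ≡ 7 * u i
      length-ys₂ = proj₂ (proj₂ (proj₂ (proj₂ exhausted)))

      rest : Matching π σ (ys₂ ++ suffix (s′ + c)) (suffix s) (cost d)
      rest = stage d (<⇒≤ d<2a) (λ d′ lt → swap (good d′ lt)) ys₂ s′ (s′ + c) s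
        (Unique-++⁻ʳ ys₁ (Unique-resp-↭ ys↭ (slice! s′ c)))
        (λ y∈ → ys-in (∈-resp-↭ (↭-sym ys↭) (∈-++⁺ʳ ys₁ y∈)))
        (≤-trans (≤-reflexive (trans (cong (_+ u i) length-ys₂) (+-comm (7 * u i) (u i)))) (*-monoˡ-≤ (u i) 8≤μ))
        (trans (+-assoc s′ c (u i)) s′≡′)
        (trans (cong (s +_) (trans (cong (_+ u i) length-ys₂) (trans (+-comm (7 * u i) (u i)) (sym u-step)))) s≡)

      cost≤ : suc (q * q * τ i + 0) + cost d ≤ cost (suc d)
      cost≤ = begin
        suc (q * q * τ i + 0) + cost d
          ≤⟨ +-monoˡ-≤ (cost d) (+-mono-≤ {1} (>-nonZero⁻¹ (q * q * τ i) {{m*n≢0 (q * q) (τ i) {{m*n≢0 q q}} {{τ≢0 i}}}}) (≤-reflexive (+-identityʳ (q * q * τ i)))) ⟩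
        q * q * τ i + q * q * τ i + cost d
          ≡⟨ double (q * q) h (2 ^ i) (μ * u a) ⟩
        16 * (q * q * (h * (2 * 2 ^ i))) + μ * u a
          ≡⟨ cong (λ j → 16 * (q * q * (h * 2 ^ j)) + μ * u a) (+-suc a d) ⟨
        cost (suc d) ∎
        where
        double : ∀ p h e r → p * (8 * (h * e)) + p * (8 * (h * e)) + (16 * (p * (h * e)) + r) ≡ 16 * (p * (h * (2 * e))) + r
        double = solve-∀

    -- Nothing has been carried over at the start; the first `n - u J` positions of `σ` take the
    -- part of the carried points.
    Good⇒U≤ : ∀ {σ π} → Good σ π → U σ π ≤ cost (a + a)
    Good⇒U≤ {σ} {π} good = U≤matching {σ = σ} {π} (Matching-resp (↭-reflexive (sym (slice-++ 0 z))) ↭-refl ≤-refl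
      (stage (a + a) ≤-refl good (slice 0 z) 0 z 0 (slice! 0 z)
        (λ x∈ → let (lo , hi) = ∈-slice 0 z x∈ in lo , ≤-trans hi (≤-trans z≤μu (m≤n*m (μ * u J) 8)))
        (≤-trans (≤-reflexive (trans (cong (_+ u J) |slice|) z+u≡n)) upper)
        z+u≡n (trans (cong (_+ u J) |slice|) z+u≡n)))
      where
      z = n ∸ u J
      z+u≡n : z + u J ≡ n
      z+u≡n = m∸n+n≡m lower
      |slice| : length (slice 0 z) ≡ z
      |slice| = length-slice {s = 0} {c = z} {d = u J} z+u≡n
      z≤μu : z ≤ μ * u J
      z≤μu = ≤-trans (m∸n≤m n (u J)) upper

    levelBad failure : Permutation′ n → Permutation′ n → ℕ
    levelBad σ π = ∑ (upTo (a + a)) λ d → BadEvents.bad (grid (a + d)) (hₛ (a + d)) σ π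
    failure  σ π = levelBad σ π + levelBad π σ

    failure≡0⇒Good : ∀ {σ π} → failure σ π ≡ 0 → Good σ π
    failure≡0⇒Good {σ} {π} none d d<2a =
      BadEvents.bad≡0⇒Spread (grid (a + d)) (hₛ (a + d)) σ π (∑-upTo≡0 _ (a + a) (m+n≡0⇒m≡0 (levelBad σ π) none) d d<2a) ,
      BadEvents.bad≡0⇒Spread (grid (a + d)) (hₛ (a + d)) π σ (∑-upTo≡0 _ (a + a) (m+n≡0⇒n≡0 (levelBad σ π) none) d d<2a)

    -- If some event fails, `failure` is at least 1 and the trivial bound `U ≤ n` is charged to it.
    U≤cost+failure : ∀ σ π → U σ π ≤ cost (a + a) + n * failure σ π
    U≤cost+failure σ π with failure σ π in eq
    ... | zero  = ≤-trans (Good⇒U≤ {σ} {π} (failure≡0⇒Good {σ} {π} eq)) (m≤m+n _ _)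
    ... | suc f = ≤-trans (U≤n σ π) (≤-trans (m≤m*n n (suc f)) (m≤n+m _ _))

    K = X * X

    events : ℕ
    events = K * (K * 1) + K * (K * 1) + (K * (K * (K * 1)) + K * (K * (K * (K * (K * 1)))))

    Rare-levelBad : Rare A levelBad ((a + a) * events)
    Rare-levelBad = subst (λ k → Rare A levelBad (k * events)) (length-upTo (a + a)) (Rare-∑ (upTo (a + a)) λ d d∈ →
      let i≤J = +-monoʳ-≤ a (<⇒≤ (∈-upTo⁻ d∈))
          a≤i = m≤m+n a d
      in BadEvents.Rare-bad (grid (a + d)) (hₛ (a + d)) A B {{n≢0}} (few i≤J a≤i) A≤B^q
           (strip-tail i≤J) (A≤2^hₛ i≤J a≤i) (row-tail i≤J) (column-tail i≤J) A≤2^h)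
      where
      open import Data.List.Properties using (length-upTo)
      open import Data.List.Membership.Propositional.Properties using (∈-upTo⁻)

    Rare-failure : Rare A failure ((a + a) * events + (a + a) * events)
    Rare-failure = Rare-+ Rare-levelBad (Rare-flip Rare-levelBad)

    2a≤n : a + a ≤ n
    2a≤n = begin
      a + a              ≤⟨ <⇒≤ (m<2^m (a + a)) ⟩
      2 ^ (a + a)        ≤⟨ ^-monoʳ-≤ 2 (m≤n+m (a + a) a) ⟩
      2 ^ J              ≤⟨ ^-monoˡ-≤ J (m≤m+n 2 6) ⟩
      8 ^ J              ≤⟨ m≤n*m (8 ^ J) q ⟩
      u J                ≤⟨ lower ⟩
      n                  ∎
      where open ≤-Reasoning

    -- `n` and `a + a` contribute at most `X` each and the events at most `4 X¹⁰`, so the product is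
    -- at most `8 X¹² ≤ X¹⁶`.
    n*events≤A : n * ((a + a) * events + (a + a) * events) ≤ A
    n*events≤A = begin
      n * ((a + a) * events + (a + a) * events)
        ≤⟨ *-mono-≤ n≤ (+-mono-≤ (*-monoˡ-≤ events 2a≤X) (*-monoˡ-≤ events 2a≤X)) ⟩
      X * (X * events + X * events)
        ≤⟨ *-monoʳ-≤ X (+-mono-≤ (*-monoʳ-≤ X events≤) (*-monoʳ-≤ X events≤)) ⟩
      X * (X * (4 * (K * (K * (K * (K * K))))) + X * (4 * (K * (K * (K * (K * K))))))
        ≡⟨ collect X ⟩
      2 * (2 * (2 * (1 * X ^ 12)))
        ≤⟨ *-mono-≤ 2≤X (*-mono-≤ 2≤X (*-mono-≤ 2≤X (*-monoˡ-≤ (X ^ 12) (≤-trans (s≤s z≤n) 2≤X)))) ⟩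
      X ^ 16 ∎
      where
      open ≤-Reasoning
      2a≤X : a + a ≤ X
      2a≤X = ≤-trans 2a≤n n≤
      collect : ∀ x → x * (x * (4 * (x * x * (x * x * (x * x * (x * x * (x * x)))))) + x * (4 * (x * x * (x * x * (x * x * (x * x * (x * x)))))))
                ≡ 2 * (2 * (2 * (1 * (x * (x * (x * (x * (x * (x * (x * (x * (x * (x * (x * (x * 1)))))))))))))))
      collect = solve-∀
      1≤K : 1 ≤ K
      1≤K = ≤-trans (≤-trans (s≤s z≤n) 2≤X) X≤XX
      instance
        K≢0 : NonZero K
        K≢0 = >-nonZero 1≤K
      grow : ∀ x → x ≤ K * x
      grow x = m≤n*m x K
      K² = K * (K * 1)
      K³ = K * K²
      K⁵ = K * (K * K³)
      2≤5 : K² ≤ K⁵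
      2≤5 = ≤-trans (grow K²) (≤-trans (grow K³) (grow (K * K³)))
      3≤5 : K³ ≤ K⁵
      3≤5 = ≤-trans (grow K³) (grow (K * K³))
      events≤ : events ≤ 4 * (K * (K * (K * (K * K))))
      events≤ = ≤-trans (+-mono-≤ (+-mono-≤ 2≤5 2≤5) (+-monoˡ-≤ K⁵ 3≤5)) (≤-reflexive (four K))
        where
        four : ∀ k → (k * (k * (k * (k * (k * 1)))) + k * (k * (k * (k * (k * 1))))) + (k * (k * (k * (k * (k * 1)))) + k * (k * (k * (k * (k * 1)))))
                   ≡ 4 * (k * (k * (k * (k * k))))
        four = solve-∀

    -- The successor is the whole contribution of failure: `n` times its expectation is at most 1.
    ∑∑U≤ : ∑∑ n U ≤ suc (cost (a + a)) * (n ! * n !)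
    ∑∑U≤ = begin
      ∑∑ n U
        ≤⟨ ∑-mono (λ σ → ∑-mono (U≤cost+failure σ) ps) ps ⟩
      ∑∑ n (λ σ π → G + n * failure σ π)
        ≡⟨ ∑-cong (λ σ → trans (∑-+ (λ _ → G) (λ π → n * failure σ π) ps) (cong₂ _+_ (∑-const G ps) (∑-*ˡ (failure σ) n ps))) ps ⟩
      ∑ ps (λ σ → length ps * G + n * ∑ ps (failure σ))
        ≡⟨ trans (∑-+ (λ _ → length ps * G) (λ σ → n * ∑ ps (failure σ)) ps) (cong₂ _+_ (∑-const (length ps * G) ps) (∑-*ˡ (λ σ → ∑ ps (failure σ)) n ps)) ⟩
      length ps * (length ps * G) + n * ∑∑ n failure
        ≤⟨ +-mono-≤ (≤-reflexive (cong (λ l → l * (l * G)) (length-permutations n))) rare-part ⟩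
      n ! * (n ! * G) + n ! * n !
        ≡⟨ collect (n !) G ⟩
      suc G * (n ! * n !) ∎
      where
      open ≤-Reasoning
      ps = permutations n
      G = cost (a + a)
      collect : ∀ f g → f * (f * g) + f * f ≡ (1 + g) * (f * f)
      collect = solve-∀
      c = (a + a) * events + (a + a) * events
      A≢0 : NonZero A
      A≢0 = m^n≢0 X 16 {{m^n≢0 2 (q * q)}}
      rare-part : n * ∑∑ n failure ≤ n ! * n !
      rare-part = *-cancelʳ-≤ _ _ A {{A≢0}} (begin
        n * ∑∑ n failure * A            ≡⟨ *-assoc n (∑∑ n failure) A ⟩
        n * (∑∑ n failure * A)          ≤⟨ *-monoʳ-≤ n (bound Rare-failure) ⟩
        n * (c * (n ! * n !))           ≡⟨ *-assoc n c (n ! * n !) ⟨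
        n * c * (n ! * n !)             ≤⟨ *-monoˡ-≤ (n ! * n !) n*events≤A ⟩
        A * (n ! * n !)                 ≡⟨ *-comm A (n ! * n !) ⟩
        n ! * n ! * A                   ∎)

-- Choosing `q` and `a` for a given large `n`.

module LargeScale where
  open import Data.Nat.Base
  open import Data.Nat.Properties
  open import Data.Nat.Tactic.RingSolver using (solve-∀)
  open import Data.Product.Base using (∃; _×_; proj₁; proj₂)
  open import Relation.Binary.PropositionalEquality using (_≡_; sym; trans; cong; cong₂; subst)
  open import Defs using (least)
  open Arithmetic
  open Scales using (Scale)

  triple : ℕ → ℕ
  triple a = a + (a + a)

  8^triple-suc : ∀ a → 8 ^ triple (suc a) ≡ 8 * (8 * (8 * 8 ^ triple a))
  8^triple-suc a = cong (8 ^_) (shift a)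
    where
    shift : ∀ a → triple (suc a) ≡ suc (suc (suc (triple a)))
    shift a = cong suc (trans (cong (a +_) (cong suc (+-suc a a))) (trans (+-suc a (suc (a + a))) (cong suc (+-suc a (a + a)))))

  triple-mono : ∀ {a b} → a ≤ b → triple a ≤ triple b
  triple-mono le = +-mono-≤ le (+-mono-≤ le le)

  module _ (ν : ℕ) (9≤ν : 9 ≤ ν) where

    -- Rounding `n` down to some `q 8 ^ (3 a)` loses a factor of at most `8³ = 2⁹`, whence `9 ≤ ν`.
    -- As `μ` is a power of two, the threshold for `2 ^ a` is bounded by a power of two with
    -- exponent linear in `q`.
    μ : ℕ
    μ = 2 ^ ν

    8³≤μ : 8 ^ 3 ≤ μ
    8³≤μ = ^-monoʳ-≤ 2 9≤ν

    -- abstract, since unfolding 2 ^ (k + x) for a numeral k takes 2 ^ k steps.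
    abstract
      p₀ : ℕ
      p₀ = suc ν * 155

      3≤p₀ : 3 ≤ p₀
      3≤p₀ = s≤s (s≤s (s≤s z≤n))

      exponent : ℕ → ℕ
      exponent q = triple ν + q + q * 16

      threshold≤ : ∀ q → 8 * (8 * μ) * μ * q * (2 ^ q) ^ 16 ≤ 2 ^ exponent q
      threshold≤ q = begin
        8 * (8 * μ) * μ * q * (2 ^ q) ^ 16             ≤⟨ *-monoˡ-≤ ((2 ^ q) ^ 16) (*-mono-≤ 64μμ≤ (<⇒≤ (m<2^m q))) ⟩
        μ * (μ * μ) * 2 ^ q * (2 ^ q) ^ 16             ≡⟨ cong₂ _*_ (cong (λ x → μ * x * 2 ^ q) (sym (^-distribˡ-+-* 2 ν ν))) (^-*-assoc 2 q 16) ⟩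
        μ * 2 ^ (ν + ν) * 2 ^ q * 2 ^ (q * 16)         ≡⟨ cong (λ x → x * 2 ^ q * 2 ^ (q * 16)) (^-distribˡ-+-* 2 ν (ν + ν)) ⟨
        2 ^ triple ν * 2 ^ q * 2 ^ (q * 16)            ≡⟨ cong (_* 2 ^ (q * 16)) (^-distribˡ-+-* 2 (triple ν) q) ⟨
        2 ^ (triple ν + q) * 2 ^ (q * 16)              ≡⟨ ^-distribˡ-+-* 2 (triple ν + q) (q * 16) ⟨
        2 ^ exponent q                                 ∎
        where
        open ≤-Reasoning
        64μμ≤ : 8 * (8 * μ) * μ ≤ μ * (μ * μ)
        64μμ≤ = begin
          8 * (8 * μ) * μ      ≡⟨ move μ ⟩
          8 * 8 * (μ * μ)      ≤⟨ *-monoˡ-≤ (μ * μ) (≤-trans (m≤m+n 64 448) 8³≤μ) ⟩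
          μ * (μ * μ)          ∎
          where
          move : ∀ m → 8 * (8 * m) * m ≡ 8 * 8 * (m * m)
          move = solve-∀

      -- A linear function of `p` against `p²`. The left side is at most `154 (ν + 1 + p)` with
      -- `154 = 1 + 17 · 9`, and `p₀ = 155 (ν + 1)` leaves one extra unit to absorb the constant.
      exponent-quadratic : ∀ p → p₀ ≤ p → suc p + 3 * triple (exponent (suc p)) ≤ p * p
      exponent-quadratic p p₀≤p = begin
        suc p + 3 * triple (exponent (suc p))   ≡⟨ cong (suc p +_) (nine (exponent (suc p))) ⟩
        suc p + exponent (suc p) * 9            ≤⟨ +-mono-≤ (s≤s (m≤n+m p ν)) (*-monoˡ-≤ 9 exponent≤) ⟩
        (suc ν + p) + (suc ν + p) * 17 * 9      ≡⟨ cong (suc ν + p +_) (*-assoc (suc ν + p) 17 9) ⟩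
        (suc ν + p) + (suc ν + p) * 153         ≡⟨ *-suc (suc ν + p) 153 ⟨
        (suc ν + p) * 154                       ≡⟨ *-distribʳ-+ 154 (suc ν) p ⟩
        suc ν * 154 + p * 154                   ≤⟨ +-monoˡ-≤ (p * 154) (≤-trans (*-monoʳ-≤ (suc ν) (n≤1+n 154)) p₀≤p) ⟩
        p + p * 154                             ≡⟨ *-suc p 154 ⟨
        p * 155                                 ≤⟨ *-monoʳ-≤ p (≤-trans (m≤n*m 155 (suc ν)) p₀≤p) ⟩
        p * p                                   ∎
        where
        open ≤-Reasoning
        nine : ∀ e → 3 * (e + (e + e)) ≡ e * 9
        nine = solve-∀
        slack : ∀ p ν → ν + (ν + ν) + suc p + suc p * 16 + ν * 14 ≡ (suc ν + p) * 17
        slack = solve-∀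
        exponent≤ : exponent (suc p) ≤ (suc ν + p) * 17
        exponent≤ = ≤-trans (m≤m+n (exponent (suc p)) (ν * 14)) (≤-reflexive (slack p ν))

    module _ (n : ℕ) (n-large : 2 ^ (p₀ * p₀) < n) where

      private
        -- The least such `q` is the square root of the binary logarithm of `n`, rounded up; its
        -- predecessor `p` gives the reverse inequality `2 ^ (p * p) < n`.
        log-bound : ∃ λ q → n ≤ 2 ^ (q * q) × (∀ j → n ≤ 2 ^ (j * j) → q ≤ j)
        log-bound = least (λ q → n ≤? 2 ^ (q * q)) n (≤-trans (<⇒≤ (m<2^m n)) (^-monoʳ-≤ 2 (n≤n*n n)))
          where
          n≤n*n : ∀ n → n ≤ n * n
          n≤n*n zero    = z≤n
          n≤n*n (suc n) = m≤m*n (suc n) (suc n)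

        p₀<q : p₀ < proj₁ log-bound
        p₀<q = ≰⇒> λ q≤p₀ → <⇒≱ n-large (≤-trans (proj₁ (proj₂ log-bound)) (^-monoʳ-≤ 2 (*-mono-≤ q≤p₀ q≤p₀)))

      p : ℕ
      p = pred (proj₁ log-bound)

      private
        q≡ : proj₁ log-bound ≡ suc p
        q≡ = sym (suc-pred (proj₁ log-bound) {{>-nonZero (≤-trans (s≤s z≤n) p₀<q)}})

      p₀≤p : p₀ ≤ p
      p₀≤p = s≤s⁻¹ (≤-trans p₀<q (≤-reflexive q≡))

      2^p²<n : 2 ^ (p * p) < n
      2^p²<n = ≰⇒> λ n≤ → <⇒≱ ≤-refl (≤-trans (≤-reflexive (sym q≡)) (proj₂ (proj₂ log-bound) p n≤))

      private
        n≤2^q² : n ≤ 2 ^ (suc p * suc p)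
        n≤2^q² = subst (λ q → n ≤ 2 ^ (q * q)) q≡ (proj₁ (proj₂ log-bound))

        q = suc p

        -- The largest `a` with `q * 8 ^ triple a ≤ n`, found as the least one whose successor
        -- overshoots.
        size-bound : ∃ λ a → n < q * 8 ^ triple (suc a) × (∀ j → n < q * 8 ^ triple (suc j) → a ≤ j)
        size-bound = least (λ a → n <? q * 8 ^ triple (suc a)) n (begin-strict
          n                          <⟨ m<2^m n ⟩
          2 ^ n                      ≤⟨ ^-monoʳ-≤ 2 (≤-trans (n≤1+n n) (m≤m+n (suc n) _)) ⟩
          2 ^ triple (suc n)         ≤⟨ ^-monoˡ-≤ (triple (suc n)) (m≤m+n 2 6) ⟩
          8 ^ triple (suc n)         ≤⟨ m≤n*m (8 ^ triple (suc n)) q ⟩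
          q * 8 ^ triple (suc n)     ∎)
          where open ≤-Reasoning

        q≤n : q ≤ n
        q≤n = begin
          suc p           ≤⟨ m<2^m p ⟩
          2 ^ p           ≤⟨ ^-monoʳ-≤ 2 (m≤m*n p p {{>-nonZero (≤-trans (s≤s z≤n) (≤-trans 3≤p₀ p₀≤p))}}) ⟩
          2 ^ (p * p)     ≤⟨ <⇒≤ 2^p²<n ⟩
          n               ∎
          where open ≤-Reasoning

        lower′ : ∀ a → (∀ j → n < q * 8 ^ triple (suc j) → a ≤ j) → q * 8 ^ triple a ≤ n
        lower′ zero    min = ≤-trans (≤-reflexive (*-identityʳ q)) q≤n
        lower′ (suc a) min = ≮⇒≥ λ lt → <⇒≱ ≤-refl (min a lt)

        a = proj₁ size-bound

        -- A smaller `a` would give `n < q 8 ^ (3 exponent) ≤ 2 ^ (p * p) < n`.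
        exponent≤a : exponent q ≤ a
        exponent≤a = ≮⇒≥ λ a<e → <⇒≱ (begin-strict
          2 ^ (p * p)                         <⟨ 2^p²<n ⟩
          n                                   ≤⟨ <⇒≤ (proj₁ (proj₂ size-bound)) ⟩
          q * 8 ^ triple (suc a)              ≤⟨ *-mono-≤ (<⇒≤ (m<2^m q)) (^-monoʳ-≤ 8 (triple-mono a<e)) ⟩
          2 ^ q * 8 ^ triple (exponent q)     ≡⟨ cong (2 ^ q *_) (^-*-assoc 2 3 (triple (exponent q))) ⟩
          2 ^ q * 2 ^ (3 * triple (exponent q)) ≡⟨ ^-distribˡ-+-* 2 q (3 * triple (exponent q)) ⟨
          2 ^ (q + 3 * triple (exponent q))   ∎) (^-monoʳ-≤ 2 (exponent-quadratic p p₀≤p))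
          where open ≤-Reasoning

      scale : Scale n
      scale = record
        { μ = μ ; q = suc p ; a = a
        ; 8≤μ = ≤-trans (m≤m+n 8 504) 8³≤μ
        ; n≤ = n≤2^q²
        ; lower = lower′ a (proj₂ (proj₂ size-bound))
        ; upper = begin
            n                                          ≤⟨ <⇒≤ (proj₁ (proj₂ size-bound)) ⟩
            q * 8 ^ triple (suc a)                     ≡⟨ cong (q *_) (8^triple-suc a) ⟩
            q * (8 * (8 * (8 * 8 ^ triple a)))         ≡⟨ move q (8 ^ triple a) ⟩
            8 * (8 * 8) * (q * 8 ^ triple a)           ≤⟨ *-monoˡ-≤ (q * 8 ^ triple a) 8³≤μ ⟩
            μ * (q * 8 ^ triple a)                     ∎
        ; a-large = ≤-trans (threshold≤ q) (^-monoʳ-≤ 2 exponent≤a)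
        }
        where
        open ≤-Reasoning
        move : ∀ a c → a * (8 * (8 * (8 * c))) ≡ 8 * (8 * 8) * (a * c)
        move = solve-∀

-- The total cost in terms of `q` and `J`.

module TotalCost where
  open import Data.Nat.Base
  open import Data.Nat.Properties
  open import Data.Nat.Tactic.RingSolver using (solve-∀)
  open import Relation.Binary.PropositionalEquality using (_≡_; trans; cong)
  open Arithmetic

  costConstant : ℕ → ℕ
  costConstant μ = 16 * ((8 * (μ * (8 * (8 * μ)))) * (8 * (μ * (8 * (8 * μ))))) + μ + 1

  costConstant>0 : ∀ μ → 1 ≤ costConstant μ
  costConstant>0 μ = m≤n+m 1 (16 * ((8 * (μ * (8 * (8 * μ)))) * (8 * (μ * (8 * (8 * μ))))) + μ)

  module _ {n : ℕ} (S : Scales.Scale n) where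
    open Scales.Levels S
    open Stages.Bound S using (cost)

    -- One `q²` comes from the halvings and one from `h`. The lowest level is no dearer because
    -- `J = 3 a` means `8 ^ a = 2 ^ J`.
    suc-cost≤ : suc (cost (a + a)) ≤ costConstant μ * (q ^ 4 * 2 ^ J)
    suc-cost≤ = begin
      suc (16 * (q * q * (h * 2 ^ J)) + μ * (q * 8 ^ a))          ≡⟨ +-comm 1 _ ⟩
      16 * (q * q * (h * 2 ^ J)) + μ * (q * 8 ^ a) + 1            ≤⟨ +-mono-≤ (+-mono-≤ (≤-reflexive (collect 16 8 q μ κ (2 ^ J))) (*-monoʳ-≤ μ middle)) 1≤W ⟩
      16 * (H * H) * W + μ * W + W                                ≡⟨ factor (16 * (H * H)) μ W ⟩
      costConstant μ * W                                          ∎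
      where
      open ≤-Reasoning
      H = 8 * (μ * κ)
      W = q ^ 4 * 2 ^ J
      collect : ∀ c k q m x e → c * (q * q * (k * (m * (x * q)) * (k * (m * (x * q))) * e)) ≡ c * (k * (m * x) * (k * (m * x))) * (q * (q * (q * (q * 1))) * e)
      collect = solve-∀
      factor : ∀ a b w → a * w + b * w + w ≡ (a + b + 1) * w
      factor = solve-∀
      8^a≡ : 8 ^ a ≡ 2 ^ J
      8^a≡ = trans (^-*-assoc 2 3 a) (cong (2 ^_) (triple a))
        where
        triple : ∀ a → 3 * a ≡ a + (a + a)
        triple = solve-∀
      middle : q * 8 ^ a ≤ W
      middle = ≤-trans (≤-reflexive (cong (q *_) 8^a≡)) (*-monoˡ-≤ (2 ^ J) (m≤m*n q (q ^ 3) {{m^n≢0 q 3}}))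
      1≤W : 1 ≤ W
      1≤W = *-mono-≤ (m^n>0 q 4) (m^n>0 2 J)

-- Comparison with rational bounds for roots and logarithms.

module Rationals where
  open import Data.Integer.Base as ℤ using (+_)
  import Data.Integer.Properties as ℤₚ
  open import Data.Nat.Base as ℕ using (ℕ; zero; suc)
  import Data.Nat.Properties as ℕₚ
  open import Data.Nat.Tactic.RingSolver using (solve-∀)
  open import Data.Rational.Unnormalised.Base
  open import Data.Rational.Unnormalised.Properties
  open import Algebra.Bundles using (module CommutativeRing)
  open import Algebra.Properties.CommutativeSemiring.Exp (CommutativeRing.commutativeSemiring +-*-commutativeRing)
    using (^-distrib-*; ^-assocʳ; ^-congˡ)
  open import Relation.Binary.PropositionalEquality using (_≡_; sym; trans; cong; cong₂)
  open import Data.Product.Base using (_,_)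
  open import Defs using (_^_; 0≤n/1; 0≤*; 0≤^)
  open Arithmetic using ([k+y]^k≤4^y*k^k; [m*n]^k≡m^k*n^k)

  ι : ℕ → ℚᵘ
  ι m = + m / 1

  ι-mono : ∀ {m n} → m ℕ.≤ n → ι m ≤ ι n
  ι-mono {m} {n} m≤n = *≤* (ℤₚ.*-monoʳ-≤-nonNeg (+ 1) (ℤ.+≤+ m≤n))

  ι-positive : ∀ {m} → 0 ℕ.< m → 0ℚᵘ < ι m
  ι-positive {m} 0<m = *<* (ℤₚ.*-monoʳ-<-pos (+ 1) (ℤ.+<+ 0<m))

  ι-cancel : ∀ {m n} → ι m ≤ ι n → m ℕ.≤ n
  ι-cancel (*≤* le) = ℤₚ.drop‿+≤+ (ℤₚ.*-cancelʳ-≤-pos _ _ (+ 1) le)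

  ι-+ : ∀ m n → ι m + ι n ≃ ι (m ℕ.+ n)
  ι-+ m n = *≡* (cong (ℤ._* + 1) (cong₂ ℤ._+_ (ℤₚ.*-identityʳ (+ m)) (ℤₚ.*-identityʳ (+ n))))

  ι-* : ∀ m n → ι m * ι n ≃ ι (m ℕ.* n)
  ι-* m n = *≡* (cong (ℤ._* + 1) (sym (ℤₚ.pos-* m n)))

  ι-^ : ∀ m k → ι m ^ k ≃ ι (m ℕ.^ k)
  ι-^ m zero    = ≃-refl
  ι-^ m (suc k) = ≃-trans (*-congˡ {ι m} (ι-^ m k)) (ι-* m (m ℕ.^ k))

  *-mono : ∀ {p q r s} → 0ℚᵘ ≤ p → 0ℚᵘ ≤ r → p ≤ q → r ≤ s → p * r ≤ q * s
  *-mono 0≤p 0≤r = *-mono-≤-nonNeg {{nonNegative 0≤p}} {{nonNegative 0≤r}}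

  ^-mono : ∀ {p q} k → 0ℚᵘ ≤ p → p ≤ q → p ^ k ≤ q ^ k
  ^-mono zero    0≤p p≤q = ≤-refl
  ^-mono (suc k) 0≤p p≤q = *-mono 0≤p (0≤^ k 0≤p) p≤q (^-mono k 0≤p p≤q)

  ^-mono-< : ∀ {p q} k → 0ℚᵘ ≤ p → p < q → p ^ suc k < q ^ suc k
  ^-mono-< {p} {q} zero    0≤p p<q = <-respˡ-≃ (≃-sym (*-identityʳ p)) (<-respʳ-≃ (≃-sym (*-identityʳ q)) p<q)
  ^-mono-< {p} {q} (suc k) 0≤p p<q = *-mono-<-nonNeg {{nonNegative 0≤p}} {{nonNegative (0≤^ (suc k) 0≤p)}} p<q (^-mono-< k 0≤p p<q)

  ^-cancel-≤ : ∀ {p q} k → 0ℚᵘ ≤ q → p ^ suc k ≤ q ^ suc k → p ≤ q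
  ^-cancel-≤ k 0≤q pow = ≮⇒≥ λ q<p → <⇒≱ (^-mono-< k 0≤q q<p) pow

  fraction-≤ : ∀ s g d .{{_ : ℕ.NonZero d}} → s ℕ.≤ g ℕ.* d → + s / d ≤ ι g
  fraction-≤ s g d@(suc _) le = *≤* (ℤₚ.≤-trans (ℤₚ.≤-reflexive (ℤₚ.*-identityʳ (+ s)))
    (ℤₚ.≤-trans (ℤ.+≤+ le) (ℤₚ.≤-reflexive (ℤₚ.pos-* g d))))

  inverse : ∀ k → (+ 1 / suc k) * ι (suc k) ≃ 1ℚᵘ
  inverse k = *-inverseˡ (ι (suc k))

  -- If `x < y`, then `n ≤ (1 + y/k)^k ≤ 4^y`, for whatever `k` witnesses the bound on the
  -- logarithm; no limit is taken.
  log-lower : ∀ {n y x} k → 0ℚᵘ ≤ x → ι n ≤ (1ℚᵘ + x * (+ 1 / suc k)) ^ suc k → 4 ℕ.^ y ℕ.< n → ι y ≤ x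
  log-lower {n} {y} {x} k-1 0≤x bound 4^y<n = ≮⇒≥ λ x<y → ℕₚ.<⇒≱ 4^y<n
    (ℕₚ.*-cancelʳ-≤ n (4 ℕ.^ y) (k ℕ.^ k) {{ℕₚ.m^n≢0 k k}} (ι-cancel (begin
      ι (n ℕ.* k ℕ.^ k)                        ≃⟨ ι-* n (k ℕ.^ k) ⟨
      ι n * ι (k ℕ.^ k)                        ≤⟨ *-mono (0≤n/1 n) (0≤n/1 (k ℕ.^ k)) (≤-trans bound (^-mono k 0≤base (+-monoʳ-≤ 1ℚᵘ (*-mono 0≤x 0≤1/k (<⇒≤ x<y) ≤-refl)))) ≤-refl ⟩
      (1ℚᵘ + ι y * 1/k) ^ k * ι (k ℕ.^ k)      ≃⟨ *-congˡ {(1ℚᵘ + ι y * 1/k) ^ k} (≃-sym (ι-^ k k)) ⟩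
      (1ℚᵘ + ι y * 1/k) ^ k * ι k ^ k          ≃⟨ ^-distrib-* (1ℚᵘ + ι y * 1/k) (ι k) k ⟨
      ((1ℚᵘ + ι y * 1/k) * ι k) ^ k            ≃⟨ ^-congˡ k cleared ⟩
      ι (k ℕ.+ y) ^ k                          ≃⟨ ι-^ (k ℕ.+ y) k ⟩
      ι ((k ℕ.+ y) ℕ.^ k)                      ≤⟨ ι-mono ([k+y]^k≤4^y*k^k k y) ⟩
      ι (4 ℕ.^ y ℕ.* k ℕ.^ k)                  ∎)))
    where
    open ≤-Reasoning
    k = suc k-1
    1/k = + 1 / suc k-1
    0≤1/k : 0ℚᵘ ≤ 1/k
    0≤1/k = nonNegative⁻¹ 1/k
    0≤base : 0ℚᵘ ≤ 1ℚᵘ + x * 1/k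
    0≤base = ≤-trans (0≤n/1 1) (p≤p+q 1ℚᵘ (x * 1/k) {{nonNegative (0≤* 0≤x 0≤1/k)}})
    cleared : (1ℚᵘ + ι y * 1/k) * ι k ≃ ι (k ℕ.+ y)
    cleared = begin-equality
      (1ℚᵘ + ι y * 1/k) * ι k          ≃⟨ *-distribʳ-+ (ι k) 1ℚᵘ (ι y * 1/k) ⟩
      1ℚᵘ * ι k + ι y * 1/k * ι k      ≃⟨ +-cong (*-identityˡ (ι k)) (≃-trans (*-assoc (ι y) 1/k (ι k)) (*-congˡ {ι y} (inverse k-1))) ⟩
      ι k + ι y * 1ℚᵘ                  ≃⟨ +-congʳ (ι k) (*-identityʳ (ι y)) ⟩
      ι k + ι y                        ≃⟨ ι-+ k y ⟩
      ι (k ℕ.+ y)                      ∎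

  private
    -- `q²⁴ E⁶ = (q E³)² (q²)¹¹`: with `q E³` at most `n` and `q²` of order `log n`, these are the
    -- sixth powers of `n^(1/3)` and `(log n)^(11/6)`.
    sixth-power : ∀ c q E n → q ℕ.* E ℕ.^ 3 ℕ.≤ n →
      (c ℕ.* (q ℕ.^ 4 ℕ.* E)) ℕ.^ 6 ℕ.≤ c ℕ.^ 6 ℕ.* (n ℕ.^ 2 ℕ.* (q ℕ.* q) ℕ.^ 11)
    sixth-power c q E n qE³≤n = begin
      (c ℕ.* (q ℕ.^ 4 ℕ.* E)) ℕ.^ 6                        ≡⟨ [m*n]^k≡m^k*n^k c _ 6 ⟩
      c ℕ.^ 6 ℕ.* (q ℕ.^ 4 ℕ.* E) ℕ.^ 6                    ≡⟨ cong (c ℕ.^ 6 ℕ.*_) exponents ⟩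
      c ℕ.^ 6 ℕ.* ((q ℕ.* E ℕ.^ 3) ℕ.^ 2 ℕ.* (q ℕ.* q) ℕ.^ 11) ≤⟨ ℕₚ.*-monoʳ-≤ (c ℕ.^ 6) (ℕₚ.*-monoˡ-≤ ((q ℕ.* q) ℕ.^ 11) (ℕₚ.^-monoˡ-≤ 2 qE³≤n)) ⟩
      c ℕ.^ 6 ℕ.* (n ℕ.^ 2 ℕ.* (q ℕ.* q) ℕ.^ 11)           ∎
      where
      open ℕₚ.≤-Reasoning
      move : ∀ a b c → a ℕ.* b ℕ.* c ≡ a ℕ.* c ℕ.* b
      move = solve-∀
      exponents : (q ℕ.^ 4 ℕ.* E) ℕ.^ 6 ≡ (q ℕ.* E ℕ.^ 3) ℕ.^ 2 ℕ.* (q ℕ.* q) ℕ.^ 11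
      exponents = begin-equality
        (q ℕ.^ 4 ℕ.* E) ℕ.^ 6                              ≡⟨ [m*n]^k≡m^k*n^k (q ℕ.^ 4) E 6 ⟩
        (q ℕ.^ 4) ℕ.^ 6 ℕ.* E ℕ.^ 6                        ≡⟨ cong₂ ℕ._*_ (ℕₚ.^-*-assoc q 4 6) (sym (ℕₚ.^-*-assoc E 3 2)) ⟩
        q ℕ.^ 24 ℕ.* (E ℕ.^ 3) ℕ.^ 2                       ≡⟨ cong (ℕ._* (E ℕ.^ 3) ℕ.^ 2) (ℕₚ.^-distribˡ-+-* q 2 22) ⟩
        q ℕ.^ 2 ℕ.* q ℕ.^ 22 ℕ.* (E ℕ.^ 3) ℕ.^ 2           ≡⟨ move (q ℕ.^ 2) (q ℕ.^ 22) ((E ℕ.^ 3) ℕ.^ 2) ⟩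
        q ℕ.^ 2 ℕ.* (E ℕ.^ 3) ℕ.^ 2 ℕ.* q ℕ.^ 22           ≡⟨ cong₂ ℕ._*_ (sym ([m*n]^k≡m^k*n^k q (E ℕ.^ 3) 2)) (ℕₚ.^-distribˡ-+-* q 11 11) ⟩
        (q ℕ.* E ℕ.^ 3) ℕ.^ 2 ℕ.* (q ℕ.^ 11 ℕ.* q ℕ.^ 11)  ≡⟨ cong ((q ℕ.* E ℕ.^ 3) ℕ.^ 2 ℕ.*_) ([m*n]^k≡m^k*n^k q q 11) ⟨
        (q ℕ.* E ℕ.^ 3) ℕ.^ 2 ℕ.* (q ℕ.* q) ℕ.^ 11         ∎

  -- With q² ≤ 8 x, u ≥ n ^ (1 / 3) and v ≥ x ^ (11 / 6), compare sixth powers.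
  q⁴E≤uv : ∀ c q E n {x u v} → q ℕ.* E ℕ.^ 3 ℕ.≤ n → ι (q ℕ.* q) ≤ ι 8 * x →
    0ℚᵘ ≤ x → 0ℚᵘ ≤ u → 0ℚᵘ ≤ v → ι n ≤ u ^ 3 → x ^ 11 ≤ v ^ 6 →
    ι (c ℕ.* (q ℕ.^ 4 ℕ.* E)) ≤ ι (c ℕ.* 64) * u * v
  q⁴E≤uv c q E n {x} {u} {v} qE³≤n q²≤8x 0≤x 0≤u 0≤v n≤u³ x¹¹≤v⁶ = ^-cancel-≤ 5 (0≤* (0≤* (0≤n/1 (c ℕ.* 64)) 0≤u) 0≤v) (begin
    ι (c ℕ.* (q ℕ.^ 4 ℕ.* E)) ^ 6
      ≃⟨ ι-^ (c ℕ.* (q ℕ.^ 4 ℕ.* E)) 6 ⟩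
    ι ((c ℕ.* (q ℕ.^ 4 ℕ.* E)) ℕ.^ 6)
      ≤⟨ ι-mono (sixth-power c q E n qE³≤n) ⟩
    ι (c ℕ.^ 6 ℕ.* (n ℕ.^ 2 ℕ.* (q ℕ.* q) ℕ.^ 11))
      ≃⟨ ≃-trans (≃-sym (ι-* (c ℕ.^ 6) _)) (*-congˡ {ι (c ℕ.^ 6)} (≃-sym (ι-* (n ℕ.^ 2) _))) ⟩
    ι (c ℕ.^ 6) * (ι (n ℕ.^ 2) * ι ((q ℕ.* q) ℕ.^ 11))
      ≤⟨ *-mono (0≤n/1 (c ℕ.^ 6)) (0≤* (0≤n/1 (n ℕ.^ 2)) (0≤n/1 ((q ℕ.* q) ℕ.^ 11))) ≤-refl
           (*-mono (0≤n/1 (n ℕ.^ 2)) (0≤n/1 ((q ℕ.* q) ℕ.^ 11)) ≤-refl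
             (≤-trans (≤-reflexive (≃-sym (ι-^ (q ℕ.* q) 11))) (^-mono 11 (0≤n/1 (q ℕ.* q)) q²≤8x))) ⟩
    ι (c ℕ.^ 6) * (ι (n ℕ.^ 2) * (ι 8 * x) ^ 11)
      ≃⟨ *-congˡ {ι (c ℕ.^ 6)} (*-congˡ {ι (n ℕ.^ 2)} (≃-trans (^-distrib-* (ι 8) x 11) (*-congʳ {x ^ 11} (ι-^ 8 11)))) ⟩
    ι (c ℕ.^ 6) * (ι (n ℕ.^ 2) * (ι (8 ℕ.^ 11) * x ^ 11))
      ≃⟨ move (ι (c ℕ.^ 6)) (ι (n ℕ.^ 2)) (ι (8 ℕ.^ 11)) (x ^ 11) ⟩
    ι (c ℕ.^ 6) * ι (8 ℕ.^ 11) * (ι (n ℕ.^ 2) * x ^ 11)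
      ≃⟨ *-congʳ {ι (n ℕ.^ 2) * x ^ 11} (ι-* (c ℕ.^ 6) (8 ℕ.^ 11)) ⟩
    ι (c ℕ.^ 6 ℕ.* 8 ℕ.^ 11) * (ι (n ℕ.^ 2) * x ^ 11)
      ≤⟨ *-mono (0≤n/1 (c ℕ.^ 6 ℕ.* 8 ℕ.^ 11)) (0≤* (0≤n/1 (n ℕ.^ 2)) (0≤^ 11 0≤x)) (ι-mono constants)
           (*-mono (0≤n/1 (n ℕ.^ 2)) (0≤^ 11 0≤x) (≤-trans (≤-reflexive (≃-sym (ι-^ n 2))) (^-mono 2 (0≤n/1 n) n≤u³)) x¹¹≤v⁶) ⟩
    ι ((c ℕ.* 64) ℕ.^ 6) * ((u ^ 3) ^ 2 * v ^ 6)
      ≃⟨ *-cong (≃-sym (ι-^ (c ℕ.* 64) 6)) (*-congʳ (^-assocʳ u 3 2)) ⟩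
    ι (c ℕ.* 64) ^ 6 * (u ^ 6 * v ^ 6)
      ≃⟨ *-assoc (ι (c ℕ.* 64) ^ 6) (u ^ 6) (v ^ 6) ⟨
    ι (c ℕ.* 64) ^ 6 * u ^ 6 * v ^ 6
      ≃⟨ ≃-trans (^-distrib-* (ι (c ℕ.* 64) * u) v 6) (*-congʳ (^-distrib-* (ι (c ℕ.* 64)) u 6)) ⟨
    (ι (c ℕ.* 64) * u * v) ^ 6 ∎)
    where
    open ≤-Reasoning
    constants : c ℕ.^ 6 ℕ.* 8 ℕ.^ 11 ℕ.≤ (c ℕ.* 64) ℕ.^ 6
    -- The factor 64 in the constant is chosen for this: `64⁶ = 8¹²` absorbs the `8¹¹` from
    -- `q² ≤ 8 x`.
    constants = ℕₚ.≤-trans (ℕₚ.*-monoʳ-≤ (c ℕ.^ 6) (ℕₚ.^-monoʳ-≤ 8 (ℕₚ.n≤1+n 11)))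
      (ℕₚ.≤-reflexive (sym (trans ([m*n]^k≡m^k*n^k c 64 6) (cong (c ℕ.^ 6 ℕ.*_) (ℕₚ.^-*-assoc 8 2 6)))))
    move : ∀ a b k x → a * (b * (k * x)) ≃ a * k * (b * x)
    move a b k x = ≃-trans (*-congˡ {a} (≃-trans (≃-sym (*-assoc b k x)) (≃-trans (*-congʳ (*-comm b k)) (*-assoc k b x))))
      (≃-sym (*-assoc a k (b * x)))

-- The expectation bound for a single large `n`.

module Conclusion where
  import Data.List.Properties as Listₚ
  open import Data.Nat.Base as ℕ using (ℕ; zero; suc; _!; ⌊_/2⌋; ⌈_/2⌉)
  import Data.Nat.Properties as ℕₚ
  open import Data.Nat.ListAction using (sum)
  open import Data.Nat.Tactic.RingSolver using (solve-∀)
  open import Data.Product.Base using (_,_)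
  open import Data.Rational.Unnormalised.Base using (0ℚᵘ; _≤_; _<_; _*_)
  open import Data.Rational.Unnormalised.Properties using (≤-trans; ≤-refl; ≤-reflexive; ≃-sym; *-identityʳ; <⇒≤)
  open import Function.Base using (id)
  open import Relation.Binary.PropositionalEquality using (_≡_; sym; trans; cong)
  open import Defs hiding (_^_)
  open LargeScale using (p₀; μ; scale; p; p₀≤p; 2^p²<n)
  open TotalCost using (costConstant; costConstant>0; suc-cost≤)
  open Rationals

  -- Here `y = ⌊ p * p /2⌋` will be the lower bound for `log n` read off from
  -- `4 ^ y ≤ 2 ^ (p * p) < n`; the factor 8 pays for the halving, the floor and the step from `p`
  -- to `q = p + 1`.
  q²≤8y : ∀ p → 3 ℕ.≤ p → suc p ℕ.* suc p ℕ.≤ 8 ℕ.* ⌊ p ℕ.* p /2⌋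
  q²≤8y p 3≤p = ℕₚ.+-cancelʳ-≤ 4 _ _ (begin
    suc p ℕ.* suc p ℕ.+ 4                ≡⟨ expand p ⟩
    p ℕ.* p ℕ.+ 2 ℕ.* p ℕ.+ 5            ≤⟨ ℕₚ.+-mono-≤ (ℕₚ.+-monoʳ-≤ (p ℕ.* p) (ℕₚ.*-monoˡ-≤ p (ℕₚ.≤-trans (ℕₚ.n≤1+n 2) 3≤p))) (ℕₚ.≤-trans (ℕₚ.m≤m+n 5 4) (ℕₚ.*-mono-≤ 3≤p 3≤p)) ⟩
    p ℕ.* p ℕ.+ p ℕ.* p ℕ.+ p ℕ.* p      ≤⟨ ℕₚ.m≤m+n _ (p ℕ.* p) ⟩
    p ℕ.* p ℕ.+ p ℕ.* p ℕ.+ p ℕ.* p ℕ.+ p ℕ.* p ≡⟨ four (p ℕ.* p) ⟩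
    4 ℕ.* (p ℕ.* p)                      ≤⟨ ℕₚ.*-monoʳ-≤ 4 (halves (p ℕ.* p)) ⟩
    4 ℕ.* (2 ℕ.* ⌊ p ℕ.* p /2⌋ ℕ.+ 1)    ≡⟨ collect ⌊ p ℕ.* p /2⌋ ⟩
    8 ℕ.* ⌊ p ℕ.* p /2⌋ ℕ.+ 4            ∎)
    where
    open ℕₚ.≤-Reasoning
    expand : ∀ p → suc p ℕ.* suc p ℕ.+ 4 ≡ p ℕ.* p ℕ.+ 2 ℕ.* p ℕ.+ 5
    expand = solve-∀
    four : ∀ a → a ℕ.+ a ℕ.+ a ℕ.+ a ≡ 4 ℕ.* a
    four = solve-∀
    collect : ∀ y → 4 ℕ.* (2 ℕ.* y ℕ.+ 1) ≡ 8 ℕ.* y ℕ.+ 4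
    collect = solve-∀
    halves : ∀ k → k ℕ.≤ 2 ℕ.* ⌊ k /2⌋ ℕ.+ 1
    halves zero          = ℕ.z≤n
    halves (suc zero)    = ℕₚ.≤-refl
    halves (suc (suc k)) = ℕₚ.≤-trans (ℕ.s≤s (ℕ.s≤s (halves k))) (ℕₚ.≤-reflexive (shift ⌊ k /2⌋))
      where
      shift : ∀ y → 2 ℕ.+ (2 ℕ.* y ℕ.+ 1) ≡ 2 ℕ.* (1 ℕ.+ y) ℕ.+ 1
      shift = solve-∀

  4^half≤ : ∀ k → 4 ℕ.^ ⌊ k /2⌋ ℕ.≤ 2 ℕ.^ k
  4^half≤ k = ℕₚ.≤-trans (ℕₚ.≤-reflexive (ℕₚ.^-*-assoc 2 2 ⌊ k /2⌋)) (ℕₚ.^-monoʳ-≤ 2 (begin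
    2 ℕ.* ⌊ k /2⌋                 ≡⟨ cong (⌊ k /2⌋ ℕ.+_) (ℕₚ.+-identityʳ ⌊ k /2⌋) ⟩
    ⌊ k /2⌋ ℕ.+ ⌊ k /2⌋           ≤⟨ ℕₚ.+-monoʳ-≤ ⌊ k /2⌋ (ℕₚ.⌊n/2⌋≤⌈n/2⌉ k) ⟩
    ⌊ k /2⌋ ℕ.+ ⌈ k /2⌉           ≡⟨ ℕₚ.⌊n/2⌋+⌈n/2⌉≡n k ⟩
    k                             ∎))
    where open ℕₚ.≤-Reasoning

  𝔼≤ : ∀ n X g → RareEvents.∑∑ n X ℕ.≤ g ℕ.* (n ! ℕ.* n !) → 𝔼 n X ≤ ι g
  𝔼≤ n X g bound = fraction-≤ (sum values) g (n ! ℕ.* n !) {{ℕₚ.m*n≢0 (n !) (n !) {{n ℕₚ.!≢0}} {{n ℕₚ.!≢0}}}}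
    (ℕₚ.≤-trans (ℕₚ.≤-reflexive (trans (cong sum (sym (Listₚ.map-id values)))
      (Moments.∑-product id X (permutations n) (permutations n)))) bound)
    where
    open import Data.List.Base using (List; cartesianProductWith)
    values : List ℕ
    values = cartesianProductWith X (permutations n) (permutations n)

  module _ (ν : ℕ) (9≤ν : 9 ℕ.≤ ν) where

    C : ℕ
    C = costConstant (μ ν 9≤ν) ℕ.* 64

    C>0 : 0ℚᵘ < ι C
    C>0 = ι-positive (ℕₚ.*-mono-≤ {1} {costConstant (μ ν 9≤ν)} {1} {64} (costConstant>0 (μ ν 9≤ν)) (ℕ.s≤s ℕ.z≤n))

    -- An inequality with `≤ᴿ` quantifies over the rational bounds `r` of the product. Such an `r`
    -- supplies `c₁ ≥ ι C`, `u³ ≥ n`, a bound `x` of `log n` and `v⁶ ≥ x¹¹`, with the product of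
    -- `c₁`, `u` and `v` at most `r`; everything then happens between rationals.
    expected-U : ∀ n → 2 ℕ.^ (p₀ ν 9≤ν ℕ.* p₀ ν 9≤ν) ℕ.< n →
      𝔼 n U ≤ᴿ fromℚ (ι C) (<⇒≤ C>0) · fromℕ n ^[ 1 / 3 ] · log n ^[ 11 / 6 ]
    expected-U n n-large r (uc , v , (c₁ , u , C≤c₁ , (0≤u , n₁ , n≤n₁ , n₁≤u³) , c₁u≤uc) , (0≤v , x , (0≤x , k , n≤[1+x/k]^k) , x¹¹≤v⁶) , ucv≤r) =
      ≤-trans (𝔼≤ n U _ (Stages.Bound.∑∑U≤ S)) (≤-trans (ι-mono (suc-cost≤ S)) (≤-trans
        (q⁴E≤uv (costConstant (μ ν 9≤ν)) (suc p′) (2 ℕ.^ J) n qE³≤n q²≤8x 0≤x 0≤u 0≤v n≤u³ x¹¹≤v⁶)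
        (≤-trans (*-mono (0≤* (<⇒≤ C>0) 0≤u) 0≤v (≤-trans (*-mono (<⇒≤ C>0) 0≤u C≤c₁ ≤-refl) c₁u≤uc) ≤-refl) ucv≤r)))
      where
      S = scale ν 9≤ν n n-large
      p′ = p ν 9≤ν n n-large
      open Scales.Levels S using (J; lower)
      n≤u³ = ≤-trans (≤-trans n≤n₁ (≤-reflexive (≃-sym (*-identityʳ n₁)))) n₁≤u³
      qE³≤n : suc p′ ℕ.* (2 ℕ.^ J) ℕ.^ 3 ℕ.≤ n
      qE³≤n = ℕₚ.≤-trans (ℕₚ.≤-reflexive (cong (suc p′ ℕ.*_)
        (trans (ℕₚ.^-*-assoc 2 J 3) (trans (cong (2 ℕ.^_) (ℕₚ.*-comm J 3)) (sym (ℕₚ.^-*-assoc 2 3 J)))))) lower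
      y = ⌊ p′ ℕ.* p′ /2⌋
      3≤p : 3 ℕ.≤ p′
      3≤p = ℕₚ.≤-trans (LargeScale.3≤p₀ ν 9≤ν) (p₀≤p ν 9≤ν n n-large)
      q²≤8x : ι (suc p′ ℕ.* suc p′) ≤ ι 8 * x
      q²≤8x = ≤-trans (ι-mono (q²≤8y p′ 3≤p)) (≤-trans (≤-reflexive (≃-sym (ι-* 8 y)))
        (*-mono (0≤n/1 8) (0≤n/1 y) ≤-refl
          (log-lower k 0≤x n≤[1+x/k]^k (ℕₚ.≤-<-trans (4^half≤ (p′ ℕ.* p′)) (2^p²<n ν 9≤ν n n-large)))))

open import Defs
open import Data.Nat.Base using (ℕ)
open import Data.Nat.Base as ℕ using ()
open import Data.Nat.Properties using (≤-refl)
open import Data.Product.Base using (Σ-syntax; ∃-syntax; _,_)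
open import Data.Rational.Unnormalised.Base using (ℚᵘ; 0ℚᵘ; _<_)
open import Data.Rational.Unnormalised.Properties using (<⇒≤)

corollary1p3 : ∃[ C ] Σ[ C>0 ∈ 0ℚᵘ < C ] ∃[ N ] (∀ n → 2 ℕ.≤ n → N ℕ.≤ n →
    𝔼 n U ≤ᴿ fromℚ C (<⇒≤ C>0) · fromℕ n ^[ 1 / 3 ] · log n ^[ 11 / 6 ])
corollary1p3 =
  -- 9 is the least admissible `ν`, that is `μ = 2⁹ = 8³`.
  Rationals.ι (Conclusion.C 9 ≤-refl) , Conclusion.C>0 9 ≤-refl ,
  ℕ.suc (2 ℕ.^ (LargeScale.p₀ 9 ≤-refl ℕ.* LargeScale.p₀ 9 ≤-refl)) ,
  λ n _ → Conclusion.expected-U 9 ≤-refl n
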